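{- For every $\alpha,\eta>0$ there is a constant $C=C(\alpha,\eta)$ such that the following holds. If $D_0$ is an $n$-vertex digraph on vertex set $[n]$ with minimum total degree $\delta(D_0)\ge 2\alpha n$, then asymptotically almost surely (i.e., with probability tending to $1$ as $n\to\infty$) the digraph $D_0\cup D(n,C/n)$ contains every orientation of a cycle of every length between $2$ and $n$ that contains at most $(1-\eta)n$ vertices of indegree $1$.
   Context: A digraph is a loop-free set of vertices with a set of ordered pairs of distinct vertices (edges); between two vertices there is at most one edge in each direction. The minimum total degree $\delta(D)$ is the minimum over vertices $v$ of the number of edges incident to $v$ (i.e., indegree plus outdegree). $D(n,p)$ is the random digraph on $[n]$ in which each of the $n(n-1)$ possible directed edges is present independently with probability $p$; $D_0\cup D(n,p)$ is the digraph on $[n]$ whose edge set is the union of the two edge sets. An orientation of a cycle of length $\ell\ge 3$ is obtained from the undirected cycle on $\ell$ vertices by replacing each edge $uv$ by exactly one of the directed edges $uv$ or $vu$; a cycle of length $2$ consists of two vertices $u,v$ with both edges $uv$ and $vu$. The indegree of a vertex refers to its indegree within the oriented cycle. "Contains" means contains a subdigraph isomorphic to it. -}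

module Defs where

open import Data.Bool using (Bool; true; false; _∧_; _∨_; not; if_then_else_)
open import Data.Nat as ℕ using (ℕ; zero; suc; _≡ᵇ_; _≤_)
open import Data.Integer using (+_)
open import Data.Fin using (Fin; toℕ)
open import Data.Fin.Properties using () renaming (_≟_ to _≟ᶠ_)
open import Data.Vec using (Vec; lookup) renaming ([] to []ᵥ; _∷_ to _∷ᵥ_)
open import Data.List using (List; []; _∷_; map; allFin; concatMap; foldr)
open import Data.Nat.ListAction using (sum)
open import Data.Rational using (ℚ; 0ℚ; 1ℚ; _*_; _+_; _-_; _⊓_) renaming (_/_ to _/ℚ_)
open import Data.Product using (Σ; _×_; ∃-syntax)
open import Relation.Binary.PropositionalEquality using (_≡_)
open import Relation.Nullary using (does)
open import Function.Definitions using (Injective)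

-- Digraphs on vertex set Fin n, given by a Boolean adjacency function:
-- A u v ≡ true means the directed edge u → v is present.

Adj : ℕ → Set
Adj n = Fin n → Fin n → Bool

Loopless : ∀ {n} → Adj n → Set
Loopless A = ∀ v → A v v ≡ false

b2n : Bool → ℕ
b2n true  = 1
b2n false = 0

ℕtoℚ : ℕ → ℚ
ℕtoℚ k = (+ k) /ℚ 1

outdeg : ∀ {n} → Adj n → Fin n → ℕ
outdeg {n} A v = sum (map (λ u → b2n (A v u)) (allFin n))

indeg : ∀ {n} → Adj n → Fin n → ℕ
indeg {n} A v = sum (map (λ u → b2n (A u v)) (allFin n))

totdeg : ∀ {n} → Adj n → Fin n → ℕ
totdeg A v = outdeg A v ℕ.+ indeg A v

MinTotDegAtLeast : ∀ {n} → Adj n → ℚ → Set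
MinTotDegAtLeast A x = ∀ v → x Data.Rational.≤ ℕtoℚ (totdeg A v)

_∪_ : ∀ {n} → Adj n → Adj n → Adj n
(A ∪ B) u v = A u v ∨ B u v

Contains : ∀ {n ℓ} → Adj n → Adj ℓ → Set
Contains {n} {ℓ} H K =
  Σ (Fin ℓ → Fin n) λ φ → Injective _≡_ _≡_ φ × (∀ i j → K i j ≡ true → H (φ i) (φ j) ≡ true)

succ? : ∀ {ℓ} → Fin ℓ → Fin ℓ → Bool
succ? {ℓ} i j = (suc (toℕ i) ≡ᵇ toℕ j) ∨ ((suc (toℕ i) ≡ᵇ ℓ) ∧ (toℕ j ≡ᵇ 0))

-- digon: the cycle of length 2 (both edges);
-- orient: an orientation of a cycle of length ℓ ≥ 3, given by
--   o i = true  : edge i → succ(i),   o i = false : edge succ(i) → i.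
data CycleOrientation : ℕ → Set where
  digon  : CycleOrientation 2
  orient : ∀ {ℓ} → 3 ≤ ℓ → (Fin ℓ → Bool) → CycleOrientation ℓ

cycleAdj : ∀ {ℓ} → CycleOrientation ℓ → Adj ℓ
cycleAdj digon      i j = not (does (i ≟ᶠ j))
cycleAdj (orient _ o) i j = (succ? i j ∧ o i) ∨ (succ? j i ∧ not (o j))

indeg1Count : ∀ {ℓ} → CycleOrientation ℓ → ℕ
indeg1Count {ℓ} K = sum (map (λ v → b2n (indeg (cycleAdj K) v ≡ᵇ 1)) (allFin ℓ))

ContainsAllCycles : ∀ {n} → ℚ → Adj n → Set
ContainsAllCycles {n} η H =
  ∀ ℓ → ℓ ≤ n → (K : CycleOrientation ℓ) →
  ℕtoℚ (indeg1Count K) Data.Rational.≤ (1ℚ - η) * ℕtoℚ n →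
  Contains H (cycleAdj K)

-- The random digraph D(n,p).  Outcomes are n×n Boolean matrices
-- M (edge u → v present iff lookup (lookup M u) v ≡ true).
-- Diagonal entries are forced false (weight 0 if true), off-diagonal
-- entries are independent Bernoulli(p).

Matrix : ℕ → Set
Matrix n = Vec (Vec Bool n) n

toAdj : ∀ {n} → Matrix n → Adj n
toAdj M u v = lookup (lookup M u) v

allVecs : ∀ {a} {A : Set a} → List A → (k : ℕ) → List (Vec A k)
allVecs xs zero    = []ᵥ ∷ []
allVecs xs (suc k) = concatMap (λ x → map (x ∷ᵥ_) (allVecs xs k)) xs

allMatrices : (n : ℕ) → List (Matrix n)
allMatrices n = allVecs (allVecs (true ∷ false ∷ []) n) n

prodℚ : List ℚ → ℚ
prodℚ = foldr _*_ 1ℚ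

sumℚ : List ℚ → ℚ
sumℚ = foldr _+_ 0ℚ

entryWeight : ∀ {n} → ℚ → Fin n → Fin n → Bool → ℚ
entryWeight p u v b =
  if does (u ≟ᶠ v) then (if b then 0ℚ else 1ℚ) else (if b then p else 1ℚ - p)

weight : ∀ {n} → ℚ → Matrix n → ℚ
weight {n} p M =
  prodℚ (concatMap (λ u → map (λ v → entryWeight p u v (toAdj M u v)) (allFin n)) (allFin n))

-- Pr_{G ~ D(n,p)} [ E G ] ≥ q : some (Boolean-selected) set of outcomes, all
-- in the event E, has total probability at least q.
ProbAtLeast : (n : ℕ) → ℚ → (Adj n → Set) → ℚ → Set
ProbAtLeast n p E q =
  Σ (Matrix n → Bool) λ f →
    (∀ M → f M ≡ true → E (toAdj M)) ×
    (q Data.Rational.≤ sumℚ (map (λ M → if f M then weight p M else 0ℚ) (allMatrices n)))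

-- edge probability C/n (capped at 1; for n = 0 irrelevant)
edgeProb : ℚ → ℕ → ℚ
edgeProb C zero    = 0ℚ
edgeProb C (suc m) = (C * ((+ 1) /ℚ suc m)) ⊓ 1ℚ

{-# OPTIONS --safe #-}
module Submission where

-- With high probability G ~ D(n, C/n) has no hole: any two sets of m = ⌊n/T⌋ vertices span an edge in either
-- direction. Only a digon and a directed triangle need more randomness than this. All three failures mean that G
-- misses at least m(m - 1) positions, each chosen knowing only earlier rows; the union bound runs over 4^n + 2 events.
--
-- In H = D₀ ∪ G every vertex v has a type τ v, a direction in which it has linearly many neighbours, and may be put
-- at a source or sink of the cycle, according to its type, with both cycle neighbours taken from that neighbourhood.
-- Depth-first search in a hole-free digraph embeds any oriented path between two large sets as long as about 7m
-- vertices are spare. This settles the cycles of length at most n - 8m.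
--
-- A longer cycle has linearly many sources and sinks. In a short window of it we place 8m absorbers: segments with a
-- gap that any vertex, up to fewer than m exceptions, can fill. An absorber grows by a slot (x, ·, x') and a vertex t
-- accepted by the old absorber and joined in G to x and x': then all common neighbours of x and x' become acceptable,
-- and by pigeonhole among 4a neighbours of t some pair covers a constant proportion of the vertices not yet accepted,
-- so boundedly many rounds suffice. The at most 2m vertices accepted by fewer than 2m absorbers are placed by hand,
-- the rest of the cycle is one depth-first path, and left-over vertices are matched to the absorbers with exchanges.

module Arithmetic where
  open import Data.Nat
  open import Data.Nat.Properties
  open import Data.Nat.Tactic.RingSolver using (solve-∀; solve)
  open import Data.List using ([]; _∷_)
  open import Data.Empty
  open import Relation.Binary.PropositionalEquality

  infixr 5 _⊕_
  _⊕_ : ∀ {a b c d} → a ≤ b → c ≤ d → a + c ≤ b + d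
  _⊕_ = +-mono-≤

  lin : ∀ {L R A B} S → A ≤ B → L + B + S ≡ R + A → L ≤ R
  lin {L} {R} {A} {B} S h e = +-cancelʳ-≤ B L R
      (≤-trans (≤-trans (m≤m+n (L + B) S) (≤-reflexive e)) (+-monoʳ-≤ R h))

  scale : ∀ {a b} k → a ≤ b → k * a ≤ k * b
  scale k = *-monoʳ-≤ k

  live-large : ∀ u a b c k → 4 * k ≤ u + (a + (b + c)) → a < k → b < k → c < k → k ≤ u
  live-large u a b c k h p q r = lin 3 (h ⊕ p ⊕ q ⊕ r) (solve (u ∷ a ∷ b ∷ c ∷ k ∷ []))

  not-all-dead : ∀ u w a b c k → w + 3 * k ≤ u + (a + (b + c)) → u ≤ w → a < k → b < k → c < k → ⊥
  not-all-dead u w a b c k h l p q r = 1+n≰n {3 * k}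
      (lin 2 (h ⊕ l ⊕ p ⊕ q ⊕ r) (solve (u ∷ w ∷ a ∷ b ∷ c ∷ k ∷ [])))

  pair-step : ∀ a u p p' sx ix l → 8 * a * a * ix ≤ l * u → u ≤ 2 * a * sx → p + sx ≤ p' + ix →
    l * (8 * a + 1) * u ≤ 2 * (8 * a * a) * p + l * l * u →
    suc l * (8 * a + 1) * u ≤ 2 * (8 * a * a) * p' + suc l * suc l * u
  pair-step a u p p' sx ix l h1 h2 h3 h4 = lin 0
      (h4 ⊕ scale 2 h1 ⊕ scale (8 * a) h2 ⊕ scale (2 * (8 * a * a)) h3)
    (solve (a ∷ u ∷ p ∷ p' ∷ sx ∷ ix ∷ l ∷ []))

  pair-end : ∀ a u p → 1 ≤ a → 1 ≤ u → p ≤ u →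
      4 * a * (8 * a + 1) * u ≤ 2 * (8 * a * a) * p + 4 * a * (4 * a) * u → ⊥
  pair-end a u p ha hu hp h = 1+n≰n {0}
      (≤-trans (*-mono-≤ ha hu) (lin (3 * (a * u)) (h ⊕ scale (2 * (8 * a * a)) hp) (solve (a ∷ u ∷ p ∷ []))))

  deg-end : ∀ n a u σ x → u * n ≤ a * σ → 2 * a * σ ≤ x * (2 * a * u) + n * u → 1 ≤ u → n ≤ 2 * a * x
  deg-end n a u σ x h1 h2 hu = *-cancelʳ-≤ n (2 * a * x) u {{>-nonZero hu}}
    (lin 0 (scale 2 h1 ⊕ h2) (solve (n ∷ a ∷ u ∷ σ ∷ x ∷ [])))

  need-mono : ∀ a m s l₁ l₂ L → s ≤ L → l₁ ≤ L → l₂ ≤ L →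
    s + m + m + (4 * m + l₁) + (4 * m + l₂) + (4 * a * m + 3 * m + 3 * m) + suc (4 * a * m) ≤
    L + m + m + (4 * m + L) + (4 * m + L) + (4 * a * m + 3 * m + 3 * m) + suc (4 * a * m)
  need-mono a m s l₁ l₂ L h1 h2 h3 = lin 0 (h1 ⊕ h2 ⊕ h3) (solve (a ∷ m ∷ s ∷ l₁ ∷ l₂ ∷ L ∷ []))

  shrink-round : ∀ b' e f u u' x n → u ≤ suc b' * x → u' + x ≤ u → e * u ≤ f * n → suc b' * e * u' ≤ b' * f * n
  shrink-round b' e f u u' x n h1 h2 h3 = ≤-trans (lin 0 (scale e (step u u' x h1 h2)) (eq1 b' e u u'))
      (≤-trans (scale b' h3) (≤-reflexive (eq2 b' f n)))
    where
    step : ∀ u u' x → u ≤ suc b' * x → u' + x ≤ u → suc b' * u' ≤ b' * u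
    step u u' x h1 h2 = lin 0 (scale (suc b') h2 ⊕ h1) (solve (b' ∷ u ∷ u' ∷ x ∷ []))
    eq1 : ∀ b' e u u' → suc b' * e * u' + e * (b' * u) + 0 ≡ b' * (e * u) + e * (suc b' * u')
    eq1 = solve-∀
    eq2 : ∀ b' f n → b' * (f * n) ≡ b' * f * n
    eq2 = solve-∀

  need-connect : ∀ a m L l → l ≤ L → L + 3 * m + m + (4 * m + l) ≤
    L + m + m + (4 * m + L) + (4 * m + L) + (4 * a * m + 3 * m + 3 * m) + suc (4 * a * m)
  need-connect a m L l h = lin (L + 8 * m + 8 * (a * m) + 1) h (solve (a ∷ m ∷ L ∷ l ∷ []))

  few-bad : ∀ m x σ → 1 ≤ m → x * (6 * m) ≤ σ → σ ≤ 8 * m * m → x ≤ 2 * m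
  few-bad m x σ m≥1 h1 h2 = *-cancelʳ-≤ x (2 * m) (6 * m) {{>-nonZero (≤-trans m≥1 (m≤n*m m 6))}}
    (lin (4 * (m * m)) (h1 ⊕ h2) (solve (m ∷ x ∷ σ ∷ [])))

  swap-count : ∀ m c u c' x → 2 * m ≤ c + u → u < m → c ≤ c' → c' ≤ x → x < m → ⊥
  swap-count m c u c' x h1 h2 h3 h4 h5 = 1+n≰n {0}
      (lin 1 (h1 ⊕ h2 ⊕ h3 ⊕ h4 ⊕ h5) (solve (m ∷ c ∷ u ∷ c' ∷ x ∷ [])))

  miss-many : ∀ m c x → c + x ≡ 8 * m → c < 2 * m → 6 * m ≤ x
  miss-many m c x e h = lin 1 (h ⊕ ≤-reflexive (sym e)) (solve (m ∷ c ∷ x ∷ []))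

  enough-turns : ∀ e n ℓ t i x y → n ≤ ℓ + y → ℓ ≤ suc (t + i) → i * e + n ≤ e * n →
      e * (x + y + 1) ≤ n → 1 ≤ e → x ≤ t
  enough-turns e n ℓ t i x y h₁ h₂ h₃ h₄ e≥1 = *-cancelˡ-≤ e {{>-nonZero e≥1}}
    (lin 0 (scale e h₁ ⊕ scale e h₂ ⊕ h₃ ⊕ h₄) (solve (e ∷ n ∷ ℓ ∷ t ∷ i ∷ x ∷ y ∷ [])))

module FiniteSets where
  open Arithmetic
  open import Data.Bool using (Bool; true; false; _∧_; _∨_; not)
  open import Data.Nat
  open import Data.Nat.Properties
  open import Data.Nat.Tactic.RingSolver using (solve-∀)
  open import Data.Fin using (Fin; zero; suc)
  open import Data.Fin.Properties using () renaming (_≟_ to _≟ᶠ_)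
  open import Data.List using (List; []; _∷_; length)
  open import Data.List.Relation.Unary.All using (All; []; _∷_)
  open import Data.List.Relation.Unary.Unique.Propositional using ([]; _∷_)
  open import Data.List.Relation.Unary.Any using (here; there)
  open import Data.List.Membership.Propositional using () renaming (_∈_ to _∈ˡ_)
  open import Data.Product using (_×_; _,_; proj₁; proj₂; ∃)
  open import Data.Sum using (_⊎_; inj₁; inj₂)
  open import Data.Empty
  open import Function using (_∘_)
  open import Relation.Nullary
  open import Relation.Binary.PropositionalEquality
  open import Defs using () renaming (b2n to bit) public

  S : ∀ {n} → (Fin n → ℕ) → ℕ
  S {zero}  f = 0
  S {suc n} f = f zero + S (f ∘ suc)

  Pred : ℕ → Set
  Pred n = Fin n → Bool

  # : ∀ {n} → Pred n → ℕ
  # P = S (bit ∘ P)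

  infix 4 _∈_ _⊆_
  _∈_ : ∀ {n} → Fin n → Pred n → Set
  v ∈ P = P v ≡ true

  _⊆_ : ∀ {n} → Pred n → Pred n → Set
  P ⊆ Q = ∀ v → v ∈ P → v ∈ Q

  infix 4 _∥_
  _∥_ : ∀ {n} → Pred n → Pred n → Set
  P ∥ Q = ∀ v → v ∈ P → v ∈ Q → ⊥

  infixl 7 _∩_ _∖_
  infixl 6 _⊔ᵖ_
  _∩_ _∖_ _⊔ᵖ_ : ∀ {n} → Pred n → Pred n → Pred n
  (P ∩ Q) v = P v ∧ Q v
  (P ∖ Q) v = P v ∧ not (Q v)
  (P ⊔ᵖ Q) v = P v ∨ Q v

  ∅ᵖ full : ∀ {n} → Pred n
  ∅ᵖ _ = false
  full _ = true

  single : ∀ {n} → Fin n → Pred n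
  single u v = does (v ≟ᶠ u)

  mem : ∀ {n} → List (Fin n) → Pred n
  mem []       v = false
  mem (x ∷ xs) v = does (v ≟ᶠ x) ∨ mem xs v

  true≢false : true ≢ false
  true≢false ()

  ∧-true : ∀ {a b} → a ∧ b ≡ true → a ≡ true × b ≡ true
  ∧-true {true} {true} refl = refl , refl

  ∧-intro : ∀ {a b} → a ≡ true → b ≡ true → a ∧ b ≡ true
  ∧-intro refl refl = refl

  ∨-true : ∀ {a b} → a ∨ b ≡ true → a ≡ true ⊎ b ≡ true
  ∨-true {true}  e = inj₁ refl
  ∨-true {false} e = inj₂ e

  ∨-introˡ : ∀ {a b} → a ≡ true → a ∨ b ≡ true
  ∨-introˡ refl = refl

  ∨-introʳ : ∀ {a b} → b ≡ true → a ∨ b ≡ true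
  ∨-introʳ {true}  refl = refl
  ∨-introʳ {false} refl = refl

  not-true : ∀ {a} → not a ≡ true → a ≡ false
  not-true {false} refl = refl

  ¬true⇒not : ∀ {a} → ¬ (a ≡ true) → not a ≡ true
  ¬true⇒not {true}  h = ⊥-elim (h refl)
  ¬true⇒not {false} h = refl

  not⇒¬true : ∀ {a} → not a ≡ true → ¬ (a ≡ true)
  not⇒¬true {false} _ ()

  bool? : ∀ b → b ≡ true ⊎ b ≡ false
  bool? true  = inj₁ refl
  bool? false = inj₂ refl

  does-sound : ∀ {P : Set} (d : Dec P) → does d ≡ true → P
  does-sound (yes p) _ = p

  does-false : ∀ {P : Set} (d : Dec P) → does d ≡ false → ¬ P
  does-false (no p) _ = p

  does-true : ∀ {P : Set} (d : Dec P) → P → does d ≡ true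
  does-true (yes _) _ = refl
  does-true (no h)  p = ⊥-elim (h p)

  ∈∖ : ∀ {n} {P Q : Pred n} {v} → v ∈ P ∖ Q → v ∈ P × ¬ (v ∈ Q)
  ∈∖ {P = P} {Q} {v} h with ∧-true {P v} h
  ... | a , b = a , not⇒¬true b

  ∖∈ : ∀ {n} {P Q : Pred n} {v} → v ∈ P → ¬ (v ∈ Q) → v ∈ P ∖ Q
  ∖∈ a b = ∧-intro a (¬true⇒not b)

  ∈? : ∀ {n} (v : Fin n) (P : Pred n) → v ∈ P ⊎ ¬ (v ∈ P)
  ∈? v P with P v
  ... | true  = inj₁ refl
  ... | false = inj₂ λ ()

  single-∈ : ∀ {n} (u : Fin n) → u ∈ single u
  single-∈ u with u ≟ᶠ u
  ... | yes _ = refl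
  ... | no h  = ⊥-elim (h refl)

  single-≡ : ∀ {n} {u v : Fin n} → v ∈ single u → v ≡ u
  single-≡ {u = u} {v} h with v ≟ᶠ u
  ... | yes e = e
  single-≡ () | no _

  mem⇒∈ : ∀ {n} {xs : List (Fin n)} {v} → v ∈ mem xs → v ∈ˡ xs
  mem⇒∈ {xs = x ∷ xs} {v} h with v ≟ᶠ x
  ... | yes e = here e
  ... | no _  = there (mem⇒∈ h)

  ∈⇒mem : ∀ {n} {xs : List (Fin n)} {v} → v ∈ˡ xs → v ∈ mem xs
  ∈⇒mem {xs = x ∷ xs} {v} (here e) with v ≟ᶠ x
  ... | yes _ = refl
  ... | no h  = ⊥-elim (h e)
  ∈⇒mem {xs = x ∷ xs} {v} (there h) = ∨-introʳ {does (v ≟ᶠ x)} (∈⇒mem h)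

  S-cong : ∀ {n} {f g : Fin n → ℕ} → (∀ i → f i ≡ g i) → S f ≡ S g
  S-cong {zero}  h = refl
  S-cong {suc n} h = cong₂ _+_ (h zero) (S-cong (h ∘ suc))

  S-mono : ∀ {n} {f g : Fin n → ℕ} → (∀ i → f i ≤ g i) → S f ≤ S g
  S-mono {zero}  h = z≤n
  S-mono {suc n} h = +-mono-≤ (h zero) (S-mono (h ∘ suc))

  +-interchange : ∀ a b c d → (a + b) + (c + d) ≡ (a + c) + (b + d)
  +-interchange = solve-∀

  S-+ : ∀ {n} (f g : Fin n → ℕ) → S (λ i → f i + g i) ≡ S f + S g
  S-+ {zero}  f g = refl
  S-+ {suc n} f g = trans (cong (f zero + g zero +_) (S-+ (f ∘ suc) (g ∘ suc)))
      (+-interchange (f zero) (g zero) (S (f ∘ suc)) (S (g ∘ suc)))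

  S-0 : ∀ n → S {n} (λ _ → 0) ≡ 0
  S-0 zero    = refl
  S-0 (suc n) = S-0 n

  S-* : ∀ {n} (f : Fin n → ℕ) c → S (λ i → f i * c) ≡ S f * c
  S-* {zero}  f c = refl
  S-* {suc n} f c = trans (cong (f zero * c +_) (S-* (f ∘ suc) c)) (sym (*-distribʳ-+ c (f zero) (S (f ∘ suc))))

  S-const : ∀ n c → S {n} (λ _ → c) ≡ n * c
  S-const zero    c = refl
  S-const (suc n) c = cong (c +_) (S-const n c)

  S-swap : ∀ {n k} (f : Fin n → Fin k → ℕ) → S (λ i → S (λ j → f i j)) ≡ S (λ j → S (λ i → f i j))
  S-swap {zero}  {k} f = sym (S-0 k)
  S-swap {suc n} {k} f = trans (cong (S (f zero) +_) (S-swap (f ∘ suc)))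
      (sym (S-+ (f zero) (λ j → S (λ i → f (suc i) j))))

  bit≤1 : ∀ b → bit b ≤ 1
  bit≤1 true  = ≤-refl
  bit≤1 false = z≤n

  bit-mono : ∀ {a b} → (a ≡ true → b ≡ true) → bit a ≤ bit b
  bit-mono {false} h = z≤n
  bit-mono {true} {b} h rewrite h refl = ≤-refl

  #-mono : ∀ {n} {P Q : Pred n} → P ⊆ Q → # P ≤ # Q
  #-mono h = S-mono (λ i → bit-mono (h i))

  #≤n : ∀ {n} (P : Pred n) → # P ≤ n
  #≤n {n} P = ≤-trans (S-mono (λ i → bit≤1 (P i))) (≤-reflexive (trans (S-const n 1) (*-identityʳ n)))

  #-full : ∀ n → # (full {n}) ≡ n
  #-full n = trans (S-const n 1) (*-identityʳ n)

  #-∅ : ∀ n → # (∅ᵖ {n}) ≡ 0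
  #-∅ n = S-0 n

  bit-∨ : ∀ a b → bit (a ∨ b) ≤ bit a + bit b
  bit-∨ true  b = s≤s z≤n
  bit-∨ false b = ≤-refl

  #-∨ : ∀ {n} (P Q : Pred n) → # (P ⊔ᵖ Q) ≤ # P + # Q
  #-∨ P Q = ≤-trans (S-mono (λ i → bit-∨ (P i) (Q i))) (≤-reflexive (S-+ (bit ∘ P) (bit ∘ Q)))

  bit-split : ∀ a b → bit a ≡ bit (a ∧ not b) + bit (a ∧ b)
  bit-split true  true  = refl
  bit-split true  false = refl
  bit-split false b     = refl

  #-split : ∀ {n} (P Q : Pred n) → # P ≡ # (P ∖ Q) + # (P ∩ Q)
  #-split P Q = trans (S-cong (λ i → bit-split (P i) (Q i))) (S-+ (bit ∘ (P ∖ Q)) (bit ∘ (P ∩ Q)))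

  #-∖ : ∀ {n} (P Q : Pred n) → # P ≤ # (P ∖ Q) + # Q
  #-∖ P Q = ≤-trans (≤-reflexive (#-split P Q))
      (+-monoʳ-≤ (# (P ∖ Q)) (#-mono (λ v h → proj₂ (∧-true {P v} h))))

  #-compl : ∀ {n} (P : Pred n) → # P + # (full ∖ P) ≡ n
  #-compl {n} P = trans (+-comm (# P) _) (trans (sym (#-split full P)) (#-full n))

  bit-disj : ∀ {a b} → (a ≡ true → b ≡ true → ⊥) → bit a + bit b ≤ bit (a ∨ b)
  bit-disj {true}  {true}  h = ⊥-elim (h refl refl)
  bit-disj {true}  {false} h = ≤-refl
  bit-disj {false} {b}     h = ≤-refl

  #-disj : ∀ {n} (P Q : Pred n) → P ∥ Q → # P + # Q ≤ # (P ⊔ᵖ Q)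
  #-disj P Q h = ≤-trans (≤-reflexive (sym (S-+ (bit ∘ P) (bit ∘ Q)))) (S-mono (λ i → bit-disj (h i)))

  #-pos : ∀ {n} {P : Pred n} {v} → v ∈ P → 1 ≤ # P
  #-pos {suc n} {P} {zero}  h rewrite h = s≤s z≤n
  #-pos {suc n} {P} {suc v} h = ≤-trans (#-pos {P = P ∘ suc} h) (m≤n+m _ (bit (P zero)))

  #-single : ∀ {n} (u : Fin n) → # (single u) ≡ 1
  #-single {suc n} zero    = cong suc (S-0 n)
  #-single {suc n} (suc u) = trans (S-cong aux) (#-single u)
    where aux : ∀ i → bit (single (suc u) (suc i)) ≡ bit (single u i)
          aux i with i ≟ᶠ u
          ... | yes _ = refl
          ... | no _  = refl

  #-mem≤ : ∀ {n} (xs : List (Fin n)) → # (mem xs) ≤ length xs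
  #-mem≤ {n} []   = ≤-reflexive (#-∅ n)
  #-mem≤ (x ∷ xs) = ≤-trans (#-∨ (single x) (mem xs)) (+-mono-≤ (≤-reflexive (#-single x)) (#-mem≤ xs))

  all∉ : ∀ {n} {x : Fin n} {xs} → All (x ≢_) xs → ¬ (x ∈ mem xs)
  all∉ {x = x} {xs = y ∷ ys} (h ∷ hs) e with ∨-true {does (x ≟ᶠ y)} e
  ... | inj₁ p = h (single-≡ p)
  ... | inj₂ p = all∉ hs p

  ∉all : ∀ {n} {x : Fin n} {xs} → ¬ (x ∈ mem xs) → All (x ≢_) xs
  ∉all {xs = []}     h = []
  ∉all {x = x} {xs = y ∷ xs} h = (λ { refl → h (∨-introˡ (single-∈ x)) }) ∷ ∉all (λ e →
      h (∨-introʳ {does (x ≟ᶠ y)} e))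

  find : ∀ {n} (P : Pred n) → (∃ λ v → v ∈ P) ⊎ (∀ v → ¬ (v ∈ P))
  find {zero}  P = inj₂ λ ()
  find {suc n} P with bool? (P zero)
  ... | inj₁ h = inj₁ (zero , h)
  ... | inj₂ h with find (P ∘ suc)
  ...   | inj₁ (v , k) = inj₁ (suc v , k)
  ...   | inj₂ k       = inj₂ λ { zero e → true≢false (trans (sym e) h) ; (suc v) e → k v e }

  #-empty : ∀ {n} {P : Pred n} → (∀ v → ¬ (v ∈ P)) → # P ≡ 0
  #-empty {n} {P} h = n≤0⇒n≡0 (≤-trans (#-mono {P = P} {Q = ∅ᵖ} (λ v e → ⊥-elim (h v e))) (≤-reflexive (#-∅ n)))

  #-find : ∀ {n} (P : Pred n) → 1 ≤ # P → ∃ λ v → v ∈ P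
  #-find P h with find P
  ... | inj₁ r = r
  ... | inj₂ k = ⊥-elim (<-irrefl refl (≤-trans h (≤-reflexive (#-empty {P = P} k))))

  take : ∀ {n} (P : Pred n) k → k ≤ # P → ∃ λ Q → Q ⊆ P × # Q ≡ k
  take {zero}  P zero    h = P , (λ v e → e) , refl
  take {suc n} P k h with bool? (P zero)
  take {suc n} P zero    h | _ = ∅ᵖ , (λ v ()) , #-∅ (suc n)
  take {suc n} P (suc k) h | inj₁ e with take (P ∘ suc) k
      (≤-pred (subst (suc k ≤_) (cong (λ b → bit b + # (P ∘ suc)) e) h))
  ... | Q , s , c = (λ { zero → true ; (suc i) → Q i }) , (λ { zero _ → e ; (suc i) q → s i q }) , cong suc c
  take {suc n} P (suc k) h | inj₂ e with take (P ∘ suc) (suc k)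
      (subst (suc k ≤_) (cong (λ b → bit b + # (P ∘ suc)) e) h)
  ... | Q , s , c = (λ { zero → false ; (suc i) → Q i }) , (λ { zero () ; (suc i) q → s i q }) , c

  pick : ∀ {n} (P A : Pred n) k → k + # A ≤ # P → ∃ λ Q → Q ⊆ P × Q ∥ A × # Q ≡ k
  pick P A k h with take (P ∖ A) k (+-cancelʳ-≤ (# A) k _ (≤-trans h (#-∖ P A)))
  ... | Q , s , c = Q , (λ v q → proj₁ (∈∖ {P = P} {A} (s v q))) , (λ v q a →
      proj₂ (∈∖ {P = P} {A} (s v q)) a) , c

  harvest : ∀ {n} (G : Fin n → Set) c (X : Pred n) → (∀ X' → X' ⊆ X → c ≤ # X' → ∃ λ v → v ∈ X' × G v) →
            ∀ k → k + c ≤ # X → ∃ λ Y → Y ⊆ X × (∀ v → v ∈ Y → G v) × # Y ≡ k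
  harvest {n} G c X f zero h = ∅ᵖ , (λ v ()) , (λ v ()) , #-∅ n
  harvest {n} G c X f (suc k) h with f X (λ v q → q) (≤-trans (m≤n+m c (suc k)) h)
  ... | v , vX , gv with harvest G c (X ∖ single v) (λ X' s →
      f X' (λ u q → proj₁ (∈∖ {P = X} {single v} (s u q)))) k
         (≤-pred (subst (suc (k + c) ≤_) (+-comm _ 1)
             (≤-trans h (≤-trans (#-∖ X (single v)) (≤-reflexive (cong (# (X ∖ single v) +_) (#-single v)))))))
  ... | Y , s , g , e = single v ⊔ᵖ Y , sub , good , cnt
    where
    sub : single v ⊔ᵖ Y ⊆ X
    sub u h with ∨-true {single v u} h
    ... | inj₁ p = subst (_∈ X) (sym (single-≡ p)) vX
    ... | inj₂ p = proj₁ (∈∖ {P = X} {single v} (s u p))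
    good : ∀ u → u ∈ single v ⊔ᵖ Y → G u
    good u h with ∨-true {single v u} h
    ... | inj₁ p = subst G (sym (single-≡ p)) gv
    ... | inj₂ p = g u p
    cnt : # (single v ⊔ᵖ Y) ≡ suc k
    cnt = ≤-antisym (≤-trans (#-∨ (single v) Y) (≤-reflexive (cong₂ _+_ (#-single v) e)))
          (≤-trans (≤-reflexive (cong₂ _+_ (sym (#-single v)) (sym e)))
            (#-disj (single v) Y (λ u p q → proj₂ (∈∖ {P = X} {single v} (s u q)) p)))

  pick⁺ : ∀ {n} (P A : Pred n) s k → # A ≤ s → s + k ≤ # P →
          ∃ λ Q → Q ⊆ P × Q ∥ A × # Q ≡ k × # (A ⊔ᵖ Q) ≤ s + k
  pick⁺ P A s k a h with pick P A k (≤-trans (+-monoʳ-≤ k a) (≤-trans (≤-reflexive (+-comm k s)) h))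
  ... | Q , sub , dj , e = Q , sub , dj , e , ≤-trans (#-∨ A Q) (+-mono-≤ a (≤-reflexive e))

module Paths where
  open Arithmetic
  open FiniteSets
  open import Data.Bool using (Bool; true; false; _∧_; not)
  open import Data.Bool.Properties using (not-involutive)
  open import Data.Nat
  open import Data.Nat.Properties
  open import Data.Fin using (Fin; zero; suc)
  open import Data.List using (List; []; _∷_; length; _++_; map; reverse)
  open import Data.List.Properties using
      (length-reverse; length-map; unfold-reverse; reverse-involutive; reverse-map; map-∘; map-cong; map-id)
  open import Data.List.Relation.Unary.All using (All; []; _∷_)
  import Data.List.Relation.Unary.All as All
  open import Data.List.Relation.Unary.Unique.Propositional using (Unique; []; _∷_)
  open import Data.Maybe using (Maybe; just; nothing)
  open import Data.Product using (_×_; _,_; proj₁; proj₂; ∃; ∃₂)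
  open import Data.Sum using (_⊎_; inj₁; inj₂; [_,_]′)
  open import Data.Empty
  open import Relation.Nullary
  open import Relation.Binary.PropositionalEquality

  module Walks {n} (H : Fin n → Fin n → Bool) where

    V : Set
    V = Fin n

    E : Bool → V → V → Bool
    E true  u v = H u v
    E false u v = H v u

    E-not : ∀ d u v → E (not d) u v ≡ E d v u
    E-not true  u v = refl
    E-not false u v = refl

    data Walk : V → List Bool → List V → V → Set where
      edge : ∀ {u w d} → E d u w ≡ true → Walk u (d ∷ []) [] w
      step : ∀ {u v w d ds vs} → E d u v ≡ true → Walk v ds vs w → Walk u (d ∷ ds) (v ∷ vs) w

    _⋈_ : ∀ {u x w ds es vs us} → Walk u ds vs x → Walk x es us w → Walk u (ds ++ es) (vs ++ x ∷ us) w
    edge e   ⋈ q = step e q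
    step e p ⋈ q = step e (p ⋈ q)

    inv : List Bool → List Bool
    inv ds = reverse (map not ds)

    inv-inv : ∀ ds → inv (inv ds) ≡ ds
    inv-inv ds = trans (cong reverse (reverse-map not (map not ds)))
      (trans (reverse-involutive _) (trans (sym (map-∘ ds)) (trans (map-cong not-involutive ds) (map-id ds))))

    length-inv : ∀ ds → length (inv ds) ≡ length ds
    length-inv ds = trans (length-reverse (map not ds)) (length-map not ds)

    flip : ∀ {u ds vs w} → Walk u ds vs w → Walk w (inv ds) (reverse vs) u
    flip {u} {w = w} (edge {d = d} e) = edge (trans (E-not d w u) e)
    flip {u} {w = w} (step {v = v} {d = d} {ds} {vs} e p) =
      subst₂ (λ es us → Walk w es us u) (sym (unfold-reverse (not d) (map not ds))) (sym (unfold-reverse v vs))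
        (flip p ⋈ edge (trans (E-not d v u) e))

    Walk-length : ∀ {u ds vs w} → Walk u ds vs w → length ds ≡ suc (length vs)
    Walk-length (edge _)   = refl
    Walk-length (step _ p) = cong suc (Walk-length p)

    HoleFree : ℕ → Set
    HoleFree m = ∀ (X Y : Pred n) → m ≤ # X → m ≤ # Y → ∃₂ λ u v → u ∈ X × v ∈ Y × H u v ≡ true

    hole : ∀ {m} → HoleFree m → ∀ d (X Y : Pred n) → m ≤ # X → m ≤ # Y → ∃₂ λ u v →
        u ∈ X × v ∈ Y × E d u v ≡ true
    hole hf true  X Y a b = hf X Y a b
    hole hf false X Y a b with hf Y X b a
    ... | u , v , p , q , e = v , u , q , p , e

    lastof : Bool → List Bool → Bool
    lastof d []       = d
    lastof _ (d ∷ ds) = lastof d ds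

    -- Depth-first search with backtracking: abandoned vertices are dead, and since the unvisited set only shrinks
    -- they remain dead; by hole-freeness fewer than m vertices of each kind can die.
    module DFS {m} (hf : HoleFree m) (N : Pred n) (m≤N : m ≤ # N) (dl : Bool) where

      -- just d: vertices without an edge in direction d into the unvisited set; nothing: without a last edge into N
      Kind : Set
      Kind = Maybe Bool

      kdir : Kind → Bool
      kdir (just d) = d
      kdir nothing  = dl

      tgt : Kind → Pred n → Pred n
      tgt (just _) U = U
      tgt nothing  U = N

      tgt-mono : ∀ κ {U U'} → U' ⊆ U → tgt κ U' ⊆ tgt κ U
      tgt-mono (just _) s = s
      tgt-mono nothing  s = λ v h → h

      dead : (Kind → Pred n) → ℕ
      dead D = # (D (just true)) + (# (D (just false)) + # (D nothing))

      record St : Set where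
        constructor mkSt
        field
          U    : Pred n
          D    : Kind → Pred n
          noEdge : ∀ κ {u w} → u ∈ D κ → w ∈ tgt κ U → ¬ (E (kdir κ) u w ≡ true)
          disj : ∀ κ → D κ ∥ U
          bnd  : ∀ κ → # (D κ) < m
      open St

      size : St → ℕ
      size s = # (U s) + dead (D s)

      record Fail (x : V) (s : St) : Set where
        constructor fail
        field
          s'    : St
          U⊆    : U s' ⊆ U s
          D⊆    : ∀ κ v → v ∈ D s' κ → v ∈ D s κ ⊎ v ∈ U s ⊎ v ≡ x
          grow  : size s < size s'
      open Fail

      Found : V → List Bool → Pred n → Set
      Found x ds U = ∃₂ λ vs w → Walk x ds vs w × w ∈ N × All (_∈ U) vs × Unique vs

      eqκ : Kind → Kind → Bool
      eqκ nothing      nothing      = true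
      eqκ (just true)  (just true)  = true
      eqκ (just false) (just false) = true
      eqκ _            _            = false

      eqκ-sound : ∀ κ κ' → eqκ κ κ' ≡ true → κ ≡ κ'
      eqκ-sound nothing      nothing      _ = refl
      eqκ-sound (just true)  (just true)  _ = refl
      eqκ-sound (just false) (just false) _ = refl

      upd : (Kind → Pred n) → Kind → V → Kind → Pred n
      upd D κ x κ' = D κ' ⊔ᵖ (λ v → eqκ κ κ' ∧ single x v)

      upd-case : ∀ D κ x κ' v → v ∈ upd D κ x κ' → v ∈ D κ' ⊎ (κ ≡ κ' × v ≡ x)
      upd-case D κ x κ' v h with ∨-true {D κ' v} h
      ... | inj₁ p = inj₁ p
      ... | inj₂ p with ∧-true {eqκ κ κ'} p
      ...   | a , b = inj₂ (eqκ-sound κ κ' a , single-≡ b)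

      upd-≥ : ∀ D κ x κ' → # (D κ') ≤ # (upd D κ x κ')
      upd-≥ D κ x κ' = #-mono {P = D κ'} {Q = upd D κ x κ'} (λ v → ∨-introˡ)

      upd-same : ∀ D κ x → eqκ κ κ ≡ true → ¬ (x ∈ D κ) → suc (# (D κ)) ≤ # (upd D κ x κ)
      upd-same D κ x e h = ≤-trans (≤-reflexive (trans (+-comm 1 _) (cong (# (D κ) +_) (sym (#-single x)))))
        (≤-trans (#-disj (D κ) (single x) (λ v p q → h (subst (_∈ D κ) (single-≡ q) p)))
          (#-mono {P = D κ ⊔ᵖ single x} {Q = upd D κ x κ} λ v k → aux v (∨-true {D κ v} k)))
        where aux : ∀ v → v ∈ D κ ⊎ v ∈ single x → v ∈ upd D κ x κ
              aux v (inj₁ p) = ∨-introˡ p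
              aux v (inj₂ q) = ∨-introʳ {D κ v} (∧-intro e q)

      upd-dead : ∀ D κ x → ¬ (x ∈ D κ) → suc (dead D) ≤ dead (upd D κ x)
      upd-dead D (just true)  x h = +-mono-≤ (upd-same D (just true) x refl h)
          (+-mono-≤ (upd-≥ D (just true) x (just false)) (upd-≥ D (just true) x nothing))
      upd-dead D (just false) x h = ≤-trans (≤-reflexive (sym (+-suc _ _)))
          (+-mono-≤ (upd-≥ D (just false) x (just true))
          (+-mono-≤ (upd-same D (just false) x refl h) (upd-≥ D (just false) x nothing)))
      upd-dead D nothing      x h = ≤-trans
          (≤-reflexive (trans (sym (+-suc _ _)) (cong (# (D (just true)) +_) (sym (+-suc _ _)))))
          (+-mono-≤ (upd-≥ D nothing x (just true))
          (+-mono-≤ (upd-≥ D nothing x (just false)) (upd-same D nothing x refl h)))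

      bigU : ∀ s → 4 * m ≤ size s → m ≤ # (U s)
      bigU s h = live-large (# (U s)) _ _ _ m h (bnd s (just true)) (bnd s (just false)) (bnd s nothing)

      die : ∀ κ x s → 4 * m ≤ size s → ¬ (x ∈ U s) → (∀ κ → ¬ (x ∈ D s κ)) →
            (∀ w → w ∈ tgt κ (U s) → ¬ (E (kdir κ) x w ≡ true)) → Fail x s
      die κ x s big x∉U x∉D none = fail s₁ (λ v h → h) Dsub
          (≤-trans (≤-reflexive (sym (+-suc _ _))) (+-monoʳ-≤ (# (U s)) (upd-dead (D s) κ x (x∉D κ))))
        where
        D₁ = upd (D s) κ x
        inv₁ : ∀ κ' {u w} → u ∈ D₁ κ' → w ∈ tgt κ' (U s) → ¬ (E (kdir κ') u w ≡ true)
        inv₁ κ' {u} p q e with upd-case (D s) κ x κ' u p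
        ... | inj₁ a = noEdge s κ' a q e
        ... | inj₂ (refl , refl) = none _ q e
        m≤tgt : ∀ κ' → m ≤ # (tgt κ' (U s))
        m≤tgt (just _) = bigU s big
        m≤tgt nothing  = m≤N
        bnd₁ : ∀ κ' → # (D₁ κ') < m
        bnd₁ κ' with m ≤? # (D₁ κ')
        ... | no h = ≰⇒> h
        ... | yes h with hole hf (kdir κ') (D₁ κ') (tgt κ' (U s)) h (m≤tgt κ')
        ...   | u , w , p , q , e = ⊥-elim (inv₁ κ' p q e)
        disj₁ : ∀ κ' → D₁ κ' ∥ U s
        disj₁ κ' v p q with upd-case (D s) κ x κ' v p
        ... | inj₁ a = disj s κ' v a q
        ... | inj₂ (_ , refl) = x∉U q
        Dsub : ∀ κ' v → v ∈ D₁ κ' → v ∈ D s κ' ⊎ v ∈ U s ⊎ v ≡ x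
        Dsub κ' v p with upd-case (D s) κ x κ' v p
        ... | inj₁ a = inj₁ a
        ... | inj₂ (_ , e) = inj₂ (inj₂ e)
        s₁ : St
        s₁ = mkSt (U s) D₁ inv₁ disj₁ bnd₁

      remove : V → St → St
      remove u s = mkSt (U s ∖ single u) (D s)
        (λ κ p q → noEdge s κ p (tgt-mono κ (λ v h → proj₁ (∈∖ {P = U s} {single u} h)) _ q))
        (λ κ v p q → disj s κ v p (proj₁ (∈∖ {P = U s} {single u} q))) (bnd s)

      remove-U : ∀ u s → # (U s) ≤ suc (# (U (remove u s)))
      remove-U u s = ≤-trans (#-∖ (U s) (single u))
          (≤-reflexive (trans (cong (# (U s ∖ single u) +_) (#-single u)) (+-comm _ 1)))

      remove-size : ∀ u s → size s ≤ suc (size (remove u s))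
      remove-size u s = +-monoˡ-≤ (dead (D s)) (remove-U u s)

      remove-< : ∀ u s → u ∈ U s → # (U (remove u s)) < # (U s)
      remove-< u s h = ≤-trans (≤-reflexive
          (trans (+-comm 1 _) (cong (# (U s ∖ single u) +_) (sym (#-single u)))))
        (≤-trans (#-disj (U s ∖ single u) (single u) (λ v p q → proj₂ (∈∖ {P = U s} {single u} p) q))
         (#-mono {P = (U s ∖ single u) ⊔ᵖ single u} λ v k →
             [ (λ p → proj₁ (∈∖ {P = U s} {single u} p)) , (λ q → subst (_∈ U s) (sym (single-≡ q)) h) ]′
             (∨-true {(U s ∖ single u) v} k)))

      Spec : Bool → List Bool → Set
      Spec d ds = ∀ x s → lastof d ds ≡ dl → 4 * m + length ds ≤ size s →
        ¬ (x ∈ U s) → (∀ κ → ¬ (x ∈ D s κ)) → Found x (d ∷ ds) (U s) ⊎ Fail x s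

      leaf : ∀ d → Spec d []
      leaf d x s e big x∉U x∉D with find (N ∩ E d x)
      ... | inj₁ (w , h) = let p , q = ∧-true {N w} h in inj₁ ([] , w , edge q , p , [] , [])
      ... | inj₂ none = inj₂ (die nothing x s (≤-trans (m≤m+n _ _) big) x∉U x∉D
                                (λ w p q → none w (∧-intro p (subst (λ d → E d x w ≡ true) (sym e) q))))

      private
        un∖ : ∀ u s v → v ∈ U (remove u s) → v ∈ U s
        un∖ u s v q = proj₁ (∈∖ {P = U s} {single u} q)

      node : ∀ d d' ds → Spec d' ds → Spec d (d' ∷ ds)
      node d d' ds child x s₀ dl≡ = λ big x∉U x∉D → loop (# (U s₀)) s₀ ≤-refl big x∉U x∉D
        where
        Goal : St → Set
        Goal s = Found x (d ∷ d' ∷ ds) (U s) ⊎ Fail x s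

        retry : ∀ u s → u ∈ U s → (f : Fail u (remove u s)) → Goal (s' f) → Goal s
        retry u s u∈U f (inj₁ (vs , w , p , wN , av , uv)) =
          inj₁ (vs , w , p , wN , All.map (λ {v} q → un∖ u s v (U⊆ f v q)) av , uv)
        retry u s u∈U f (inj₂ g) = inj₂ (fail (s' g) (λ v q → un∖ u s v (U⊆ f v (U⊆ g v q))) D₂
                  (≤-trans (s≤s (≤-trans (remove-size u s) (grow f))) (grow g)))
          where
          D₁ : ∀ κ v → v ∈ D s κ ⊎ v ∈ U (remove u s) ⊎ v ≡ u → v ∈ D s κ ⊎ v ∈ U s ⊎ v ≡ x
          D₁ κ v (inj₁ b) = inj₁ b
          D₁ κ v (inj₂ (inj₁ b)) = inj₂ (inj₁ (un∖ u s v b))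
          D₁ κ v (inj₂ (inj₂ refl)) = inj₂ (inj₁ u∈U)
          D₂ : ∀ κ v → v ∈ D (s' g) κ → v ∈ D s κ ⊎ v ∈ U s ⊎ v ≡ x
          D₂ κ v q with D⊆ g κ v q
          ... | inj₂ (inj₂ e') = inj₂ (inj₂ e')
          ... | inj₂ (inj₁ a) = inj₂ (inj₁ (un∖ u s v (U⊆ f v a)))
          ... | inj₁ a = D₁ κ v (D⊆ f κ v a)

        found : ∀ u s → u ∈ U s → E d x u ≡ true → Found u (d' ∷ ds) (U (remove u s)) → Goal s
        found u s u∈U e (vs , w , p , wN , av , uv) = inj₁ (u ∷ vs , w , step e p , wN ,
                u∈U ∷ All.map (λ {v} q → un∖ u s v q) av ,
                All.map (λ {v} q r → proj₂ (∈∖ {P = U s} {single u} q)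
                    (subst (_∈ single u) r (single-∈ u))) av ∷ uv)

        x∉D₁ : ∀ u s → u ∈ U s → ¬ (x ∈ U s) → (∀ κ → ¬ (x ∈ D s κ)) →
            (f : Fail u (remove u s)) → ∀ κ → ¬ (x ∈ D (s' f) κ)
        x∉D₁ u s u∈U x∉U x∉D f κ q with D⊆ f κ x q
        ... | inj₁ a = x∉D κ a
        ... | inj₂ (inj₁ a) = x∉U (un∖ u s x a)
        ... | inj₂ (inj₂ refl) = x∉U u∈U

        loop : ∀ fuel s → # (U s) ≤ fuel → 4 * m + length (d' ∷ ds) ≤ size s →
          ¬ (x ∈ U s) → (∀ κ → ¬ (x ∈ D s κ)) → Goal s
        loop fuel s le big x∉U x∉D with find (U s ∩ E d x)
        ... | inj₂ none = inj₂ (die (just d) x s (≤-trans (m≤m+n _ _) big) x∉U x∉D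
            (λ w p q → none w (∧-intro p q)))
        ... | inj₁ (u , h) = go fuel le
            (child u (remove u s) dl≡ (≤-pred
            (≤-trans (≤-reflexive (sym (+-suc _ _))) (≤-trans big (remove-size u s))))
                 (λ q → proj₂ (∈∖ {P = U s} {single u} q) (single-∈ u)) (λ κ q → disj s κ u q u∈U))
          where
          u∈U : u ∈ U s
          u∈U = proj₁ (∧-true {U s u} h)
          go : ∀ fuel → # (U s) ≤ fuel → Found u (d' ∷ ds) (U (remove u s)) ⊎ Fail u (remove u s) → Goal s
          go _ le (inj₁ f) = found u s u∈U (proj₂ (∧-true {U s u} h)) f
          go zero le (inj₂ f) = ⊥-elim (<-irrefl refl (≤-trans (#-pos {P = U s} u∈U) le))
          go (suc fuel) le (inj₂ f) = retry u s u∈U f (loop fuel (s' f)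
            (≤-trans (#-mono (U⊆ f)) (≤-pred (≤-trans (remove-< u s u∈U) le)))
            (≤-trans big (≤-trans (remove-size u s) (grow f))) (λ q → x∉U (un∖ u s x (U⊆ f x q)))
            (x∉D₁ u s u∈U x∉U x∉D f))

      explore : ∀ d ds → Spec d ds
      explore d []        = leaf d
      explore d (d' ∷ ds) = node d d' ds (explore d' ds)

      run : ∀ d ds (W X : Pred n) → 1 ≤ m → lastof d ds ≡ dl → 4 * m + length ds ≤ # W → X ∥ W → 3 * m ≤ # X →
            ∃ λ x → x ∈ X × Found x (d ∷ ds) W
      run d ds W X₀ m≥1 dl≡ big₀ dj big = go (3 * m) 0 refl X₀ (λ v h → h) big s₀ (λ v h → h) (λ κ v ())
          (≤-trans (≤-reflexive (+-identityʳ _)) (m≤m+n _ _))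
        where
        s₀ : St
        s₀ = mkSt W (λ _ → ∅ᵖ) (λ κ ()) (λ κ v ()) (λ κ → subst (_< m) (sym (#-∅ n)) m≥1)
        go : ∀ k j → j + k ≡ 3 * m → ∀ X → X ⊆ X₀ → k ≤ # X → (s : St) → U s ⊆ W →
             (∀ κ v → v ∈ D s κ → v ∈ W ⊎ (v ∈ X₀ × ¬ (v ∈ X))) → # W + j ≤ size s →
             ∃ λ x → x ∈ X₀ × Found x (d ∷ ds) W
        go zero j e X sub big s Us Ds sz = ⊥-elim (not-all-dead (# (U s)) (# W) _ _ _ m
           (subst (λ t → # W + t ≤ size s) (trans (sym (+-identityʳ j)) e) sz) (#-mono Us)
           (bnd s (just true)) (bnd s (just false)) (bnd s nothing))
        go (suc k) j e X sub big s Us Ds sz with #-find X (≤-trans (s≤s z≤n) big)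
        ... | x , x∈X with explore d ds x s dl≡ (≤-trans big₀ (≤-trans (m≤m+n _ _) sz)) (λ q →
            dj x (sub x x∈X) (Us x q)) x∉D
          where
          x∉D : ∀ κ → ¬ (x ∈ D s κ)
          x∉D κ q with Ds κ x q
          ... | inj₁ a = dj x (sub x x∈X) a
          ... | inj₂ (_ , a) = a x∈X
        ...   | inj₁ (vs , w , p , wN , av , uv) = x , sub x x∈X , vs , w , p , wN , All.map (Us _) av , uv
        ...   | inj₂ (fail s' Us' Ds' gr) = go k (suc j) (trans (sym (+-suc j k)) e) (X ∖ single x)
                  (λ v q → sub v (proj₁ (∈∖ {P = X} {single x} q)))
                  (≤-pred (≤-trans big (≤-trans (#-∖ X (single x))
                      (≤-reflexive (trans (cong (# (X ∖ single x) +_) (#-single x)) (+-comm _ 1))))))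
                  s' (λ v q → Us v (Us' v q)) Ds'' (≤-trans (≤-reflexive (+-suc _ _)) (≤-trans (s≤s sz) gr))
          where
          Ds'' : ∀ κ v → v ∈ D s' κ → v ∈ W ⊎ (v ∈ X₀ × ¬ (v ∈ X ∖ single x))
          Ds'' κ v q with Ds' κ v q
          ... | inj₂ (inj₁ a) = inj₁ (Us v a)
          ... | inj₂ (inj₂ refl) = inj₂ (sub v x∈X , λ r → proj₂ (∈∖ {P = X} {single x} r) (single-∈ x))
          ... | inj₁ a with Ds κ v a
          ...   | inj₁ b = inj₁ b
          ...   | inj₂ (b , c) = inj₂ (b , λ r → c (proj₁ (∈∖ {P = X} {single x} r)))

    PathIn : V → List Bool → Pred n → Pred n → Set
    PathIn x ds W N = ∃₂ λ vs w → Walk x ds vs w × w ∈ N × All (_∈ W) vs × Unique vs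

    pathFrom : ∀ {m} → HoleFree m → 1 ≤ m → ∀ ds (X W N : Pred n) → 1 ≤ length ds → X ∥ W →
               3 * m ≤ # X → m ≤ # N → 4 * m + length ds ≤ # W → ∃ λ x → x ∈ X × PathIn x ds W N
    pathFrom hf m≥1 (d ∷ ds) X W N _ dj x≥ n≥ w≥ =
      DFS.run hf N n≥ (lastof d ds) d ds W X m≥1 refl (≤-trans (+-monoʳ-≤ _ (n≤1+n _)) w≥) dj x≥

module Construction where
  open Arithmetic
  open FiniteSets
  open Paths
  open import Data.Bool using (Bool; true; false; _∧_; not)
  open import Data.Nat
  open import Data.Nat.Properties
  open import Data.Fin using (Fin; zero; suc; toℕ; inject₁; fromℕ<)
  open import Data.Fin.Properties using (toℕ<n; toℕ-injective; toℕ-inject₁; toℕ-fromℕ<)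
  open import Data.List using (List; []; _∷_; length; _++_; map; reverse; [_]; concat;
      replicate; tabulate; allFin)
  open import Data.List.Properties using
      (length-++; ++-assoc; ++-identityʳ; concat-++; length-replicate; length-tabulate; map-tabulate)
  open import Data.List.Relation.Unary.All using (All; []; _∷_)
  import Data.List.Relation.Unary.All as All
  import Data.List.Relation.Unary.All.Properties as Allₚ
  open import Data.List.Relation.Unary.Any using (here; there)
  open import Data.List.Membership.Propositional using () renaming (_∈_ to _∈ˡ_)
  open import Data.List.Relation.Unary.Unique.Propositional using (Unique; []; _∷_)
  import Data.List.Relation.Unary.Unique.Propositional.Properties as Uniqueₚ
  open import Data.List.Relation.Binary.Permutation.Propositional
  open import Data.List.Relation.Binary.Permutation.Propositional.Properties using
      (↭-reverse; All-resp-↭; ++⁺; ++⁺ˡ; ++⁺ʳ; shift; ↭-length; ++-comm)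
  open import Data.List.Relation.Binary.Pointwise using (Pointwise; []; _∷_)
  open import Data.Product using (_×_; _,_; proj₁; proj₂; ∃; ∃₂)
  open import Data.Sum using (_⊎_; inj₁; inj₂; [_,_]′)
  open import Data.Empty
  open import Function using (_∘_; case_of_)
  open import Relation.Nullary
  open import Relation.Binary.PropositionalEquality hiding ([_]) renaming (trans to ≡-trans; sym to ≡-sym)
  open import Data.Nat.Tactic.RingSolver using (solve-∀)
  import Data.List.Membership.Propositional.Properties as ∈ₚ
  open import Data.Bool.Properties using (not-involutive)
  open import Data.Nat.ListAction using (sum)
  open import Defs using (digon; orient; cycleAdj; succ?; indeg; indeg1Count; Contains)

  Unique-↭ : ∀ {A : Set} {xs ys : List A} → xs ↭ ys → Unique xs → Unique ys
  Unique-↭ refl u = u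
  Unique-↭ (prep x p) (h ∷ u) = All-resp-↭ p h ∷ Unique-↭ p u
  Unique-↭ (swap x y p) ((h ∷ hx) ∷ hy ∷ u) = ((λ e → h (≡-sym e)) ∷ All-resp-↭ p hy) ∷
      All-resp-↭ p hx ∷ Unique-↭ p u
  Unique-↭ (trans p q) u = Unique-↭ q (Unique-↭ p u)

  Unique-++ : ∀ {n} {xs ys : List (Fin n)} {P Q : Pred n} → Unique xs → Unique ys → All (_∈ P) xs →
      All (_∈ Q) ys → P ∥ Q → Unique (xs ++ ys)
  Unique-++ u v a b d = Uniqueₚ.++⁺ u v (λ { (p , q) → d _ (All.lookup a p) (All.lookup b q) })

  ∥-⊆ : ∀ {n} {P Q P' : Pred n} → P' ⊆ P → P ∥ Q → P' ∥ Q
  ∥-⊆ s d v p q = d v (s v p) q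

  ⊆ˡ : ∀ {n} (P Q : Pred n) → P ⊆ P ⊔ᵖ Q
  ⊆ˡ P Q v h = ∨-introˡ h

  ⊆ʳ : ∀ {n} (P Q : Pred n) → Q ⊆ P ⊔ᵖ Q
  ⊆ʳ P Q v h = ∨-introʳ {P v} h

  ∥⇒≢ : ∀ {n} {P Q : Pred n} {x y} → P ∥ Q → x ∈ P → y ∈ Q → x ≢ y
  ∥⇒≢ d p q refl = d _ p q

  ∥⇒all≢ : ∀ {n} {P Q : Pred n} {x ys} → P ∥ Q → x ∈ P → All (_∈ Q) ys → All (x ≢_) ys
  ∥⇒all≢ d p = All.map (λ q → ∥⇒≢ d p q)

  module Slots {n} (H : Fin n → Fin n → Bool) (m : ℕ) (1≤m : 1 ≤ m) (hf : Walks.HoleFree H m)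
               (τ : Fin n → Bool) (a : ℕ) (1≤a : 1 ≤ a) (deg : ∀ v → n ≤ a * # (Walks.E H (τ v) v)) where
    open Walks H

    Nb : V → Pred n
    Nb v = E (τ v) v

    module Leaves (θ : Bool) where

      leaves : ∀ k (X Z : Pred n) → k * m ≤ # X → suc (k * m) ≤ # Z →
               ∃₂ λ t xs → t ∈ Z × length xs ≡ k × Unique xs × All (λ x → x ∈ X × E θ t x ≡ true) xs
      leaves zero X Z hx hz with #-find Z hz
      ... | t , tZ = t , [] , tZ , refl , [] , []
      leaves (suc k) X Z hx hz with take X m (≤-trans (m≤m+n m (k * m)) hx)
      ... | X₁ , X₁⊆X , #X₁ with harvest (λ t → ∃ λ x → x ∈ X₁ × E θ t x ≡ true) m Z
              (λ Z' _ h → let u , v , p , q , e = hole hf θ Z' X₁ h (≤-reflexive (≡-sym #X₁)) in u , p , v , q , e)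
              (suc (k * m)) (≤-trans (≤-reflexive (cong suc (+-comm (k * m) m))) hz)
      ... | Z₁ , Z₁⊆Z , nb , #Z₁ with leaves k (X ∖ X₁) Z₁
              (+-cancelˡ-≤ m _ _ (≤-trans hx (≤-trans (#-∖ X X₁)
                  (≤-reflexive (≡-trans (+-comm _ (# X₁)) (cong (_+ # (X ∖ X₁)) #X₁))))))
              (≤-reflexive (≡-sym #Z₁))
      ... | t , xs , tZ₁ , len , uq , al with nb t tZ₁
      ... | x , xX₁ , e = t , x ∷ xs , Z₁⊆Z t tZ₁ , cong suc len ,
            All.map (λ { {y} (yX , _) refl → proj₂ (∈∖ {P = X} {X₁} {y} yX) xX₁ }) al ∷ uq ,
            ((X₁⊆X x xX₁ , e) ∷ All.map (λ { {y} (yX , e') → proj₁ (∈∖ {P = X} {X₁} {y} yX) , e' }) al)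

      cov : Pred n → V → Pred n
      cov U x = U ∩ λ r → E θ r x

      Rich : Pred n → V → Set
      Rich U x = # U ≤ 2 * a * # (cov U x)

      Big : Pred n → V → V → Set
      Big U x y = # U ≤ 8 * a * a * # (U ∩ λ r → E θ r x ∧ E θ r y)

      cov∩⊆ : ∀ U x y → cov U x ∩ cov U y ⊆ (U ∩ λ r → E θ r x ∧ E θ r y)
      cov∩⊆ U x y v h with ∧-true {cov U x v} h
      ... | p , q with ∧-true {U v} p | ∧-true {U v} q
      ...   | pu , px | _ , qy = ∧-intro pu (∧-intro px qy)

      meet-or : ∀ U x (P : Pred n) ys → (∀ v → v ∈ P → ∃ λ y → y ∈ˡ ys × v ∈ cov U y) →
                (∃ λ y → y ∈ˡ ys × Big U x y) ⊎ 8 * a * a * # (cov U x ∩ P) ≤ length ys * # U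
      meet-or U x P [] h = inj₂ (≤-reflexive
          (≡-trans (cong (8 * a * a *_) (#-empty {P = cov U x ∩ P} (λ v q → none v q))) (*-zeroʳ (8 * a * a))))
        where none : ∀ v → ¬ (v ∈ cov U x ∩ P)
              none v q with h v (proj₂ (∧-true {cov U x v} q))
              ... | _ , () , _
      meet-or U x P (y ∷ ys) h with # U ≤? 8 * a * a * # (U ∩ λ r → E θ r x ∧ E θ r y)
      ... | yes big = inj₁ (y , here refl , big)
      ... | no ¬big with meet-or U x (P ∖ cov U y) ys rest
        where rest : ∀ v → v ∈ P ∖ cov U y → ∃ λ z → z ∈ˡ ys × v ∈ cov U z
              rest v q with ∈∖ {P = P} {cov U y} q
              ... | vP , v∉ with h v vP
              ...   | z , here refl , vz = ⊥-elim (v∉ vz)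
              ...   | z , there i , vz = z , i , vz
      ... | inj₁ (z , i , b) = inj₁ (z , there i , b)
      ... | inj₂ le = inj₂ (≤-trans (*-monoʳ-≤ (8 * a * a) cut)
              (≤-trans (≤-reflexive (*-distribˡ-+ (8 * a * a) _ _)) (+-mono-≤ (<⇒≤ (≰⇒> ¬big)) le)))
        where cut : # (cov U x ∩ P) ≤ # (U ∩ λ r → E θ r x ∧ E θ r y) + # (cov U x ∩ (P ∖ cov U y))
              cut = ≤-trans (#-mono {P = cov U x ∩ P} {Q = (U ∩ λ r → E θ r x ∧ E θ r y) ⊔ᵖ
                  (cov U x ∩ (P ∖ cov U y))} sub)
                            (#-∨ (U ∩ λ r → E θ r x ∧ E θ r y) (cov U x ∩ (P ∖ cov U y)))
                where sub : cov U x ∩ P ⊆ (U ∩ λ r → E θ r x ∧ E θ r y) ⊔ᵖ (cov U x ∩ (P ∖ cov U y))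
                      sub v q with ∧-true {cov U x v} q
                      ... | vx , vP with ∈? v (cov U y)
                      ...   | inj₁ vy = ∨-introˡ (cov∩⊆ U x y v (∧-intro vx vy))
                      ...   | inj₂ v∉ = ∨-introʳ {(U ∩ λ r → E θ r x ∧ E θ r y) v}
                          (∧-intro vx (∖∈ {P = P} {cov U y} vP v∉))

      union : Pred n → List V → Pred n
      union U []       = ∅ᵖ
      union U (x ∷ xs) = union U xs ⊔ᵖ cov U x

      union-∈ : ∀ U xs v → v ∈ union U xs → ∃ λ y → y ∈ˡ xs × v ∈ cov U y
      union-∈ U (x ∷ xs) v h with ∨-true {union U xs v} h
      ... | inj₁ p = let y , i , q = union-∈ U xs v p in y , there i , q
      ... | inj₂ p = x , here refl , p

      union-⊆ : ∀ U xs → union U xs ⊆ U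
      union-⊆ U xs v h = let y , i , q = union-∈ U xs v h in proj₁ (∧-true {U v} q)

      PairIn : Pred n → List V → Set
      PairIn U xs = ∃₂ λ x y → x ∈ˡ xs × y ∈ˡ xs × x ≢ y × Big U x y

      grow : ∀ U xs → Unique xs → All (Rich U) xs → PairIn U xs ⊎
             length xs * (8 * a + 1) * # U ≤ 2 * (8 * a * a) * # (union U xs) + length xs * length xs * # U
      grow U [] _ _ = inj₂ z≤n
      grow U (x ∷ xs) (x∉ ∷ uq) (rx ∷ rs) with grow U xs uq rs
      ... | inj₁ (y , z , i , j , ne , b) = inj₁ (y , z , there i , there j , ne , b)
      ... | inj₂ ih with meet-or U x (union U xs) xs (union-∈ U xs)
      ...   | inj₁ (y , i , b) = inj₁ (x , y , here refl , there i , All.lookup x∉ i , b)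
      ...   | inj₂ le = inj₂ (pair-step a (# U) (# (union U xs)) (# (union U xs ⊔ᵖ cov U x)) (# (cov U x))
                  (# (cov U x ∩ union U xs)) (length xs) le rx
                  (≤-trans (+-monoʳ-≤ (# (union U xs)) (≤-reflexive (#-split (cov U x) (union U xs))))
                   (≤-trans (≤-reflexive (≡-sym (+-assoc (# (union U xs)) _ _)))
                    (+-monoˡ-≤ (# (cov U x ∩ union U xs)) (≤-trans (#-disj (union U xs) (cov U x ∖ union U xs)
                         (λ v p q → proj₂ (∈∖ {P = cov U x} {union U xs} q) p))
                       (#-mono {P = union U xs ⊔ᵖ (cov U x ∖ union U xs)} sub))))) ih)
        where sub : union U xs ⊔ᵖ (cov U x ∖ union U xs) ⊆ union U xs ⊔ᵖ cov U x
              sub v h with ∨-true {union U xs v} h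
              ... | inj₁ p = ∨-introˡ p
              ... | inj₂ p = ∨-introʳ {union U xs v} (proj₁ (∈∖ {P = cov U x} {union U xs} p))

      pigeon : ∀ U xs → 1 ≤ # U → length xs ≡ 4 * a → Unique xs → All (Rich U) xs → PairIn U xs
      pigeon U xs u≥1 len uq rs with grow U xs uq rs
      ... | inj₁ p = p
      ... | inj₂ h = ⊥-elim (pair-end a (# U) (# (union U xs)) 1≤a u≥1 (#-mono (union-⊆ U xs))
                       (subst (λ l → l * (8 * a + 1) * # U ≤ 2 * (8 * a * a) * #
                           (union U xs) + l * l * # U) len h))

      rich? : ∀ U x → Dec (Rich U x)
      rich? U x = # U ≤? 2 * a * # (cov U x)

      rich : Pred n → Pred n
      rich U x = does (rich? U x)

      rich-sound : ∀ U x → x ∈ rich U → Rich U x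
      rich-sound U x = does-sound (rich? U x)

      many-rich : ∀ U → (∀ r → r ∈ U → τ r ≡ θ) → 1 ≤ # U → n ≤ 2 * a * # (rich U)
      many-rich U ty u≥1 = deg-end n a (# U) (S (λ x → # (cov U x))) (# (rich U)) lower upper u≥1
        where
        lower : # U * n ≤ a * S (λ x → # (cov U x))
        lower = ≤-trans (≤-reflexive (≡-sym (S-* (bit ∘ U) n)))
          (≤-trans (S-mono row) (≤-reflexive (≡-trans (S-* (λ r → S (λ x → bit (cov U x r))) a)
            (≡-trans (*-comm _ a) (cong (a *_) (S-swap (λ r x → bit (cov U x r))))))))
          where
          row : ∀ r → bit (U r) * n ≤ S (λ x → bit (cov U x r)) * a
          row r with U r in eq
          ... | false = z≤n
          ... | true = ≤-trans (≤-reflexive (*-identityˡ n))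
              (≤-trans (deg r) (≤-trans (≤-reflexive (*-comm a _))
                         (≤-reflexive (cong (λ d → S (λ x → bit (E d r x)) * a) (ty r eq)))))
        upper : 2 * a * S (λ x → # (cov U x)) ≤ # (rich U) * (2 * a * # U) + n * # U
        upper = ≤-trans (≤-reflexive (≡-trans (*-comm (2 * a) _) (≡-sym (S-* (λ x → # (cov U x)) (2 * a)))))
          (≤-trans (S-mono col) (≤-reflexive (≡-trans (S-+ (λ x → bit (rich U x) * (2 * a * # U)) (λ _ → # U))
             (cong₂ _+_ (S-* (bit ∘ rich U) (2 * a * # U)) (S-const n (# U))))))
          where
          col : ∀ x → # (cov U x) * (2 * a) ≤ bit (rich U x) * (2 * a * # U) + # U
          col x = by (rich U x) refl
            where
            by : ∀ b → rich U x ≡ b → # (cov U x) * (2 * a) ≤ bit b * (2 * a * # U) + # U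
            by true _ = ≤-trans (≤-reflexive (*-comm _ (2 * a)))
                (≤-trans (scale (2 * a) (#-mono {P = cov U x} {Q = U} (λ v h → proj₁ (∧-true {U v} h))))
                          (≤-trans (≤-reflexive (≡-sym (*-identityˡ (2 * a * # U))))
                              (m≤m+n (1 * (2 * a * # U)) (# U))))
            by false e = ≤-trans (≤-reflexive (*-comm _ (2 * a))) (<⇒≤ (≰⇒> (does-false (rich? U x) e)))

      good : ∀ ds (X W N : Pred n) → 1 ≤ length ds → X ∥ W → # N ≡ m → # W ≡ 4 * m + length ds →
             ∀ k → k + 3 * m ≤ # X → ∃ λ Y → Y ⊆ X × (∀ v → v ∈ Y → PathIn v ds W N) × # Y ≡ k
      good ds X W N len dj hN hW = harvest (λ v → PathIn v ds W N) (3 * m) X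
        (λ X' s h → pathFrom hf 1≤m ds X' W N len (∥-⊆ {P = X} {W} s dj) h (≤-reflexive (≡-sym hN))
            (≤-reflexive (≡-sym hW)))

  module Absorbers {n} (H : Fin n → Fin n → Bool) (m : ℕ) (1≤m : 1 ≤ m) (hf : Walks.HoleFree H m)
               (τ : Fin n → Bool) (a : ℕ) (1≤a : 1 ≤ a) (deg : ∀ v → n ≤ a * # (Walks.E H (τ v) v)) where
    open Walks H
    open Slots H m 1≤m hf τ a 1≤a deg

    between : Bool → List Bool → Bool → List Bool
    between d p d' = d ∷ (p ++ [ not d' ])

    -- A segment from w to w' with one open position; P is the set of vertices that fit there, t one of them from Z.
    record Slot (used : Pred n) (w w' : V) (θ : Bool) (pl pr : List Bool) (U Z : Pred n) : Set where
      field
        F     : List V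
        P     : Pred n
        flex  : ∀ r → r ∈ P → ∃ λ vs → Walk w (between (τ w) pl θ ++ between θ pr (τ w')) vs w' × vs ↭ r ∷ F
        uniq  : Unique F
        fresh : All (λ v → ¬ (v ∈ used)) F
        t     : V
        t∈Z   : t ∈ Z
        t∈P   : t ∈ P
        t∉    : ¬ (t ∈ used)
        t∉F   : All (t ≢_) F
        cover : # U ≤ 8 * a * a * # (U ∩ P)

    need : ℕ → ℕ → ℕ → ℕ
    need s l₁ l₂ = s + m + m + (4 * m + l₁) + (4 * m + l₂) + (4 * a * m + 3 * m + 3 * m) + suc (4 * a * m)

    perm : ∀ (u₁ x x' u' r : V) vs vs' →
           (u₁ ∷ (reverse vs ++ x ∷ [])) ++ r ∷ (x' ∷ (vs' ++ u' ∷ [])) ↭ r ∷ (u₁ ∷ x ∷ x' ∷ u' ∷ (vs ++ vs'))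
    perm u₁ x x' u' r vs vs' = begin
        (u₁ ∷ (reverse vs ++ x ∷ [])) ++ r ∷ (x' ∷ (vs' ++ u' ∷ []))
          ↭⟨ shift r (u₁ ∷ (reverse vs ++ x ∷ [])) _ ⟩
        r ∷ u₁ ∷ ((reverse vs ++ x ∷ []) ++ (x' ∷ (vs' ++ u' ∷ [])))
          ↭⟨ prep r (prep u₁ (++⁺ (trans (shift x (reverse vs) [])
              (prep x (subst (_↭ vs) (≡-sym (++-identityʳ (reverse vs))) (↭-reverse vs))))
                                   (prep x' (trans (shift u' vs' [])
                                       (prep u' (↭-reflexive (++-identityʳ vs'))))))) ⟩
        r ∷ u₁ ∷ ((x ∷ vs) ++ (x' ∷ u' ∷ vs'))
          ↭⟨ prep r (prep u₁ (prep x (shift x' vs (u' ∷ vs')))) ⟩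
        r ∷ u₁ ∷ x ∷ x' ∷ (vs ++ u' ∷ vs')
          ↭⟨ prep r (prep u₁ (prep x (prep x' (shift u' vs vs')))) ⟩
        r ∷ u₁ ∷ x ∷ x' ∷ u' ∷ (vs ++ vs') ∎
      where open PermutationReasoning

    module _ (used : Pred n) (s : ℕ) (w w' : V) (θ : Bool) (pl pr : List Bool) (U Z : Pred n) where
      open Leaves θ

      SlotSet : V → V → Pred n
      SlotSet x x' r = E θ r x ∧ E θ r x'

      module _ (N₁ N₂ W₁ W₂ X₀ : Pred n) (N₁⊆ : N₁ ⊆ Nb w) (N₂⊆ : N₂ ⊆ Nb w')
               (N₁∥ : N₁ ∥ used) (N₂∥ : N₂ ∥ used ⊔ᵖ N₁) (W₁∥ : W₁ ∥ used ⊔ᵖ N₁ ⊔ᵖ N₂)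
               (W₂∥ : W₂ ∥ used ⊔ᵖ N₁ ⊔ᵖ N₂ ⊔ᵖ W₁) (X₀∥ : X₀ ∥ used ⊔ᵖ N₁ ⊔ᵖ N₂ ⊔ᵖ W₁ ⊔ᵖ W₂) where

        A₁ = used ⊔ᵖ N₁
        A₂ = A₁ ⊔ᵖ N₂
        A₃ = A₂ ⊔ᵖ W₁
        A₄ = A₃ ⊔ᵖ W₂
        A₅ = A₄ ⊔ᵖ X₀

        sub∥ : ∀ {P A B : Pred n} → P ∥ B → A ⊆ B → P ∥ A
        sub∥ d s v p q = d v p (s v q)

        abstract
          used⊆₂ : used ⊆ A₂
          used⊆₂ v h = ⊆ˡ A₁ N₂ v (⊆ˡ used N₁ v h)
          used⊆₃ : used ⊆ A₃
          used⊆₃ v h = ⊆ˡ A₂ W₁ v (used⊆₂ v h)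
          used⊆₄ : used ⊆ A₄
          used⊆₄ v h = ⊆ˡ A₃ W₂ v (used⊆₃ v h)
          used⊆₅ : used ⊆ A₅
          used⊆₅ v h = ⊆ˡ A₄ X₀ v (used⊆₄ v h)
          N₁⊆₂ : N₁ ⊆ A₂
          N₁⊆₂ v h = ⊆ˡ A₁ N₂ v (⊆ʳ used N₁ v h)
          N₁⊆₃ : N₁ ⊆ A₃
          N₁⊆₃ v h = ⊆ˡ A₂ W₁ v (N₁⊆₂ v h)
          N₁⊆₄ : N₁ ⊆ A₄
          N₁⊆₄ v h = ⊆ˡ A₃ W₂ v (N₁⊆₃ v h)
          N₂⊆₃ : N₂ ⊆ A₃
          N₂⊆₃ v h = ⊆ˡ A₂ W₁ v (⊆ʳ A₁ N₂ v h)
          N₂⊆₄ : N₂ ⊆ A₄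
          N₂⊆₄ v h = ⊆ˡ A₃ W₂ v (N₂⊆₃ v h)
          W₁⊆₃ : W₁ ⊆ A₃
          W₁⊆₃ = ⊆ʳ A₂ W₁
          W₁⊆₄ : W₁ ⊆ A₄
          W₁⊆₄ v h = ⊆ˡ A₃ W₂ v (W₁⊆₃ v h)
          W₂⊆₄ : W₂ ⊆ A₄
          W₂⊆₄ = ⊆ʳ A₃ W₂

        abstract
          assemble : ∀ t x x' → t ∈ Z → ¬ (t ∈ A₅) → x ∈ X₀ → x' ∈ X₀ → x ≢ x' →
              E θ t x ≡ true → E θ t x' ≡ true →
                     Big U x x' → PathIn x (inv pl) W₁ N₁ → PathIn x' pr W₂ N₂ → Slot used w w' θ pl pr U Z
          assemble t x x' t∈Z t∉A₅ x∈ x'∈ x≢x' tx tx' big (vs , u₁ , wl , u₁∈ , vs∈ , vsu)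
              (vs' , u' , wr , u'∈ , vs'∈ , vs'u) = record
            { F = F ; P = SlotSet x x' ; flex = flex ; uniq = uniq ; fresh = fresh
            ; t = t ; t∈Z = t∈Z ; t∈P = ∧-intro tx tx'
            ; t∉ = λ h → t∉A₅ (used⊆₅ t h) ; t∉F = All.map (λ { h refl → t∉A₅ h }) F∈A₅ ; cover = big }
            where
            F : List V
            F = u₁ ∷ x ∷ x' ∷ u' ∷ (vs ++ vs')

            flex : ∀ r → r ∈ SlotSet x x' → ∃ λ us →
                Walk w (between (τ w) pl θ ++ between θ pr (τ w')) us w' × us ↭ r ∷ F
            flex r h with ∧-true {E θ r x} h
            ... | rx , rx' = _ ,
              step (N₁⊆ u₁ u₁∈) (subst (λ p → Walk u₁ p (reverse vs) x) (inv-inv pl) (flip wl) ⋈ edge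
                  (≡-trans (E-not θ x r) rx))
              ⋈ step rx' (wr ⋈ edge (≡-trans (E-not (τ w') u' w') (N₂⊆ u' u'∈))) ,
              perm u₁ x x' u' r vs vs'

            X₀∥N₁ : X₀ ∥ N₁
            X₀∥N₁ = sub∥ {X₀} {N₁} {A₄} X₀∥ N₁⊆₄
            X₀∥N₂ : X₀ ∥ N₂
            X₀∥N₂ = sub∥ {X₀} {N₂} {A₄} X₀∥ N₂⊆₄
            X₀∥W₁ : X₀ ∥ W₁
            X₀∥W₁ = sub∥ {X₀} {W₁} {A₄} X₀∥ W₁⊆₄
            X₀∥W₂ : X₀ ∥ W₂
            X₀∥W₂ = sub∥ {X₀} {W₂} {A₄} X₀∥ W₂⊆₄
            N₁∥W₁ : N₁ ∥ W₁
            N₁∥W₁ v p q = W₁∥ v q (N₁⊆₂ v p)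
            N₁∥W₂ : N₁ ∥ W₂
            N₁∥W₂ v p q = W₂∥ v q (N₁⊆₃ v p)
            N₂∥W₁ : N₂ ∥ W₁
            N₂∥W₁ v p q = W₁∥ v q (⊆ʳ A₁ N₂ v p)
            N₂∥W₂ : N₂ ∥ W₂
            N₂∥W₂ v p q = W₂∥ v q (N₂⊆₃ v p)
            W₁∥W₂ : W₁ ∥ W₂
            W₁∥W₂ v p q = W₂∥ v q (W₁⊆₃ v p)
            N₁∥N₂ : N₁ ∥ N₂
            N₁∥N₂ v p q = N₂∥ v q (⊆ʳ used N₁ v p)
            sym≢ : {y z : V} → y ≢ z → z ≢ y
            sym≢ h e = h (≡-sym e)
            uniq : Unique F
            uniq = (sym≢ (∥⇒≢ {P = X₀} {N₁} X₀∥N₁ x∈ u₁∈) ∷ sym≢ (∥⇒≢ {P = X₀} {N₁} X₀∥N₁ x'∈ u₁∈) ∷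
                     ∥⇒≢ {P = N₁} {N₂} N₁∥N₂ u₁∈ u'∈ ∷
                     Allₚ.++⁺ (∥⇒all≢ {P = N₁} {W₁} N₁∥W₁ u₁∈ vs∈) (∥⇒all≢ {P = N₁} {W₂} N₁∥W₂ u₁∈ vs'∈)) ∷
                   (x≢x' ∷ ∥⇒≢ {P = X₀} {N₂} X₀∥N₂ x∈ u'∈ ∷
                     Allₚ.++⁺ (∥⇒all≢ {P = X₀} {W₁} X₀∥W₁ x∈ vs∈) (∥⇒all≢ {P = X₀} {W₂} X₀∥W₂ x∈ vs'∈)) ∷
                   (∥⇒≢ {P = X₀} {N₂} X₀∥N₂ x'∈ u'∈ ∷
                     Allₚ.++⁺ (∥⇒all≢ {P = X₀} {W₁} X₀∥W₁ x'∈ vs∈) (∥⇒all≢ {P = X₀} {W₂} X₀∥W₂ x'∈ vs'∈)) ∷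
                   Allₚ.++⁺ (∥⇒all≢ {P = N₂} {W₁} N₂∥W₁ u'∈ vs∈) (∥⇒all≢ {P = N₂} {W₂} N₂∥W₂ u'∈ vs'∈) ∷
                   Unique-++ {P = W₁} {W₂} vsu vs'u vs∈ vs'∈ W₁∥W₂
            F∈A₅ : All (_∈ A₅) F
            F∈A₅ = ⊆ˡ A₄ X₀ u₁ (N₁⊆₄ u₁ u₁∈) ∷ ⊆ʳ A₄ X₀ x x∈ ∷ ⊆ʳ A₄ X₀ x' x'∈ ∷ ⊆ˡ A₄ X₀ u' (N₂⊆₄ u' u'∈) ∷
                   Allₚ.++⁺ (All.map (λ {v} h → ⊆ˡ A₄ X₀ v (W₁⊆₄ v h)) vs∈)
                       (All.map (λ {v} h → ⊆ˡ A₄ X₀ v (W₂⊆₄ v h)) vs'∈)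
            fresh : All (λ v → ¬ (v ∈ used)) F
            fresh = N₁∥ u₁ u₁∈ ∷ (λ q → X₀∥ x x∈ (used⊆₄ x q)) ∷ (λ q → X₀∥ x' x'∈ (used⊆₄ x' q)) ∷ (λ q →
                N₂∥ u' u'∈ (⊆ˡ used N₁ u' q)) ∷
                    Allₚ.++⁺ (All.map (λ {v} h q → W₁∥ v h (used⊆₂ v q)) vs∈)
                        (All.map (λ {v} h q → W₂∥ v h (used⊆₃ v q)) vs'∈)

      l₁ = length pl
      l₂ = length pr
      s₁ = s + m
      s₂ = s₁ + m
      s₃ = s₂ + (4 * m + l₁)
      s₄ = s₃ + (4 * m + l₂)
      s₅ = s₄ + (4 * a * m + 3 * m + 3 * m)
      s₆ = need s l₁ l₂

      abstract
        slot : # used ≤ s → 1 ≤ l₁ → 1 ≤ l₂ → (∀ r → r ∈ U → τ r ≡ θ) → 1 ≤ # U →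
               2 * a * s₆ ≤ n → s₆ ≤ # Z → Slot used w w' θ pl pr U Z
        slot us≤ pl≥ pr≥ Uθ U≥1 room roomZ =
          case pick⁺ (Nb w) used s m us≤ (≤-trans s₁≤ (≤Nb w)) of λ { (N₁ , N₁⊆ , N₁∥ , #N₁ , #A₁) →
          case pick⁺ (Nb w') (used ⊔ᵖ N₁) s₁ m #A₁ (≤-trans s₂≤ (≤Nb w')) of λ { (N₂ , N₂⊆ , N₂∥ , #N₂ , #A₂) →
          case pick⁺ full (used ⊔ᵖ N₁ ⊔ᵖ N₂) s₂ (4 * m + l₁) #A₂
              (≤-trans s₃≤ ≤full) of λ { (W₁ , _ , W₁∥ , #W₁ , #A₃) →
          case pick⁺ full (used ⊔ᵖ N₁ ⊔ᵖ N₂ ⊔ᵖ W₁) s₃ (4 * m + l₂) #A₃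
              (≤-trans s₄≤ ≤full) of λ { (W₂ , _ , W₂∥ , #W₂ , #A₄) →
          case pick⁺ (rich U) (used ⊔ᵖ N₁ ⊔ᵖ N₂ ⊔ᵖ W₁ ⊔ᵖ W₂) s₄ (4 * a * m + 3 * m + 3 * m) #A₄
              (≤-trans s₅≤ ≤rich) of λ { (X₀ , X₀⊆ , X₀∥ , #X₀ , #A₅) →
          case pick⁺ Z (used ⊔ᵖ N₁ ⊔ᵖ N₂ ⊔ᵖ W₁ ⊔ᵖ W₂ ⊔ᵖ X₀) s₅
              (suc (4 * a * m)) #A₅ roomZ of λ { (Z₀ , Z₀⊆ , Z₀∥ , #Z₀ , _) →
          case good pr X₀ W₂ N₂ pr≥ (λ v p q → X₀∥ v p (⊆ʳ (used ⊔ᵖ N₁ ⊔ᵖ N₂ ⊔ᵖ W₁) W₂ v q)) #N₂ #W₂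
                 (4 * a * m + 3 * m) (≤-reflexive (≡-sym #X₀)) of λ { (X₁ , X₁⊆ , X₁p , #X₁) →
          case good (inv pl) X₁ W₁ N₁ (≤-trans pl≥ (≤-reflexive (≡-sym (length-inv pl))))
                 (λ v p q → X₀∥ v (X₁⊆ v p) (⊆ˡ (used ⊔ᵖ N₁ ⊔ᵖ N₂ ⊔ᵖ W₁) W₂ v (⊆ʳ (used ⊔ᵖ N₁ ⊔ᵖ N₂) W₁ v q)))
                     #N₁
                 (≡-trans #W₁ (cong (4 * m +_) (≡-sym (length-inv pl))))
                 (4 * a * m) (≤-reflexive (≡-sym #X₁)) of λ { (X₂ , X₂⊆ , X₂p , #X₂) →
          case leaves (4 * a) X₂ Z₀ (≤-reflexive (≡-sym #X₂))
              (≤-reflexive (≡-sym #Z₀)) of λ { (t , xs , t∈Z₀ , len , uq , adj) →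
          case pigeon U xs U≥1 len uq (All.map (λ { {y} (q , _) → rich-sound U y (X₀⊆ y (X₁⊆ y (X₂⊆ y q))) })
              adj) of λ { (x , x' , i , j , x≢x' , big) →
          assemble N₁ N₂ W₁ W₂ X₀ N₁⊆ N₂⊆ N₁∥ N₂∥ W₁∥ W₂∥ X₀∥ t x x' (Z₀⊆ t t∈Z₀) (Z₀∥ t t∈Z₀)
            (X₁⊆ x (X₂⊆ x (proj₁ (All.lookup adj i)))) (X₁⊆ x' (X₂⊆ x' (proj₁ (All.lookup adj j)))) x≢x'
            (proj₂ (All.lookup adj i)) (proj₂ (All.lookup adj j)) big
            (X₂p x (proj₁ (All.lookup adj i))) (X₁p x' (X₂⊆ x' (proj₁ (All.lookup adj j)))) }}}}}}}}}}
          where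
          ≤Nb : ∀ v → s₆ ≤ # (Nb v)
          ≤Nb v = *-cancelˡ-≤ a {{>-nonZero 1≤a}} (≤-trans (≤-trans (*-monoˡ-≤ s₆ (m≤n*m a 2)) room) (deg v))
          ≤rich : s₆ ≤ # (rich U)
          ≤rich = *-cancelˡ-≤ (2 * a) {{>-nonZero (≤-trans 1≤a (m≤n*m a 2))}}
              (≤-trans room (many-rich U Uθ U≥1))
          ≤full : s₆ ≤ # (full {n})
          ≤full = ≤-trans (≤Nb w) (≤-trans (#≤n (Nb w)) (≤-reflexive (≡-sym (#-full n))))
          s₅≤ : s₅ ≤ s₆
          s₅≤ = m≤m+n s₅ (suc (4 * a * m))
          s₄≤ : s₄ ≤ s₆
          s₄≤ = ≤-trans (m≤m+n s₄ _) s₅≤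
          s₃≤ : s₃ ≤ s₆
          s₃≤ = ≤-trans (m≤m+n s₃ (4 * m + l₂)) s₄≤
          s₂≤ : s₂ ≤ s₆
          s₂≤ = ≤-trans (m≤m+n s₂ (4 * m + l₁)) s₃≤
          s₁≤ : s₁ ≤ s₆
          s₁≤ = ≤-trans (m≤m+n s₁ m) s₂≤

  -- At consecutive steps not θ, θ the walk passes a vertex both of whose cycle neighbours lie in its E θ-neighbourhood.
  Good : List Bool → Set
  Good B = ∀ θ → ∃₂ λ P Q → B ≡ P ++ not θ ∷ θ ∷ Q × 1 ≤ length P

  Good² : List Bool → Set
  Good² D = ∃₂ λ B₁ B₂ → D ≡ B₁ ++ B₂ × Good B₁ × Good B₂

  module Rounds {n} (H : Fin n → Fin n → Bool) (m : ℕ) (1≤m : 1 ≤ m) (hf : Walks.HoleFree H m)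
               (τ : Fin n → Bool) (a : ℕ) (1≤a : 1 ≤ a) (deg : ∀ v → n ≤ a * # (Walks.E H (τ v) v))
               (L b' : ℕ) (b≡ : 16 * a * a ≡ suc b') (room : suc b' * Absorbers.need H m 1≤m hf τ a 1≤a deg L L L ≤ n) where
    open Walks H
    open Slots H m 1≤m hf τ a 1≤a deg
    open Absorbers H m 1≤m hf τ a 1≤a deg

    cut : ∀ d p P θ Q → between d (p ++ P) θ ++ θ ∷ Q ≡ (d ∷ p) ++ (P ++ not θ ∷ θ ∷ Q)
    cut d p P θ Q = cong (d ∷_) (≡-trans (++-assoc (p ++ P) (not θ ∷ []) (θ ∷ Q))
        (++-assoc p P (not θ ∷ θ ∷ Q)))

    roomL : ℕ
    roomL = need L L L

    room₁ : roomL ≤ n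
    room₁ = ≤-trans (m≤n*m roomL (suc b')) room

    L<n : L < n
    L<n = ≤-trans (s≤s (≤-trans (m≤m+n L m)
        (≤-trans (m≤m+n _ m) (≤-trans (m≤m+n _ _) (≤-trans (m≤m+n _ _) (m≤m+n _ _))))))
          (≤-trans (≤-trans (s≤s (m≤m+n _ (4 * a * m))) (≤-reflexive (≡-sym (+-suc _ (4 * a * m))))) room₁)

    new : ∀ (A : Pred n) → # A ≤ L → ∃ λ w → ¬ (w ∈ A)
    new A h with pick⁺ full A L 1 h
        (≤-trans (≤-reflexive (+-comm L 1)) (≤-trans L<n (≤-reflexive (≡-sym (#-full n)))))
    ... | Q , _ , Q∥ , #Q , _ with #-find Q (≤-reflexive (≡-sym #Q))
    ...   | w , wQ = w , Q∥ w wQ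

    part : Bool → Pred n → Pred n
    part true  U = U ∩ τ
    part false U = U ∖ τ

    part-τ : ∀ θ U r → r ∈ part θ U → τ r ≡ θ
    part-τ true  U r h = proj₂ (∧-true {U r} h)
    part-τ false U r h = not-true (proj₂ (∧-true {U r} h))

    part-⊆ : ∀ θ U → part θ U ⊆ U
    part-⊆ true  U r h = proj₁ (∧-true {U r} h)
    part-⊆ false U r h = proj₁ (∧-true {U r} h)

    majority : ∀ U → ∃ λ θ → # U ≤ 2 * # (part θ U)
    majority U with ≤-total (# (U ∖ τ)) (# (U ∩ τ))
    ... | inj₁ h = true , ≤-trans (≤-reflexive (#-split U τ)) (+-mono-≤ h (≤-reflexive (≡-sym (+-identityʳ _))))
    ... | inj₂ h = false , ≤-trans (≤-reflexive (#-split U τ))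
        (+-monoʳ-≤ (# (U ∖ τ)) (≤-trans h (≤-reflexive (≡-sym (+-identityʳ _)))))

    record Link (A : Pred n) (w w' : V) (target : List Bool) (U Z : Pred n) : Set where
      field
        ds tail : List Bool
        splits : ds ++ τ w' ∷ tail ≡ target
        F     : List V
        P     : Pred n
        flex  : ∀ r → r ∈ P → ∃ λ vs → Walk w ds vs w' × vs ↭ r ∷ F
        uniq  : Unique F
        fresh : All (λ v → ¬ (v ∈ A)) F
        t     : V
        t∈Z   : t ∈ Z
        t∈P   : t ∈ P
        t∉    : ¬ (t ∈ A)
        t∉F   : All (t ≢_) F
        cover : # U ≤ suc b' * # (U ∩ P)

    cover-arith : ∀ u p x → u ≤ 2 * p → p ≤ 8 * a * a * x → u ≤ suc b' * x
    cover-arith u p x h1 h2 = subst (λ b → u ≤ b * x) b≡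
        (≤-trans h1 (≤-trans (scale 2 h2) (≤-reflexive (eq a x))))
      where eq : ∀ a x → 2 * (8 * a * a * x) ≡ 16 * a * a * x
            eq = solve-∀

    2a≤b : 2 * a ≤ suc b'
    2a≤b = ≤-trans (≤-trans (*-mono-≤ (≤ᵇ⇒≤ 2 16 _) (≤-reflexive (≡-sym (*-identityʳ a))))
        (≤-trans (*-monoʳ-≤ 16 (*-monoʳ-≤ a 1≤a)) (≤-reflexive (≡-sym (*-assoc 16 a a))))) (≤-reflexive b≡)

    link₀ : ∀ A w w' p B₁ B₂ U Z → # A ≤ L → length (τ w ∷ p ++ (B₁ ++ B₂)) ≤ L → Good B₁ → Good B₂ →
        1 ≤ # U → roomL ≤ # Z →
           Link A w w' (τ w ∷ p ++ (B₁ ++ B₂)) U Z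
    link₀ A w w' p B₁ B₂ U Z #A len g₁ g₂ U≥1 #Z with majority U
    ... | θ , maj with g₁ θ | g₂ (τ w')
    ... | P₁ , Q₁ , refl , ≥₁ | P₂ , Q₂ , refl , ≥₂ = record
        { ds = ds ; tail = Q₂ ; splits = pat ; F = S.F ; P = S.P ; flex = S.flex ; uniq =
            S.uniq ; fresh = S.fresh
        ; t = S.t ; t∈Z = S.t∈Z ; t∈P = S.t∈P ; t∉ = S.t∉ ; t∉F = S.t∉F
        ; cover = cover-arith (# U) (# (part θ U)) (# (U ∩ S.P)) maj (≤-trans S.cover (scale (8 * a * a)
             (#-mono {P = part θ U ∩ S.P} {Q = U ∩ S.P} λ v h →
                 ∧-intro (part-⊆ θ U v (proj₁ (∧-true {part θ U v} h))) (proj₂ (∧-true {part θ U v} h))))) }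
      where
      ds = between (τ w) (p ++ P₁) θ ++ between θ (Q₁ ++ P₂) (τ w')
      total = τ w ∷ p ++ ((P₁ ++ not θ ∷ θ ∷ Q₁) ++ (P₂ ++ not (τ w') ∷ τ w' ∷ Q₂))
      pat : ds ++ τ w' ∷ Q₂ ≡ total
      pat = ≡-trans (++-assoc (between (τ w) (p ++ P₁) θ) _ _)
            (≡-trans (cong (between (τ w) (p ++ P₁) θ ++_) (cut θ Q₁ P₂ (τ w') Q₂))
            (≡-trans (≡-sym (++-assoc (between (τ w) (p ++ P₁) θ) (θ ∷ Q₁) _))
            (≡-trans (cong (_++ (P₂ ++ not (τ w') ∷ τ w' ∷ Q₂)) (cut (τ w) p P₁ θ Q₁))
                     (++-assoc (τ w ∷ p) (P₁ ++ not θ ∷ θ ∷ Q₁) _))))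
      lends : length ds ≤ L
      lends = ≤-trans (≤-trans (m≤m+n _ _) (≤-reflexive (≡-sym (length-++ ds))))
          (≤-trans (≤-reflexive (cong length pat)) len)
      between-≤ : ∀ d p d' → length p ≤ length (between d p d')
      between-≤ d p d' = ≤-trans (m≤m+n (length p) 1) (≤-trans (≤-reflexive (≡-sym (length-++ p))) (n≤1+n _))
      l₁≤ : length (p ++ P₁) ≤ L
      l₁≤ = ≤-trans (between-≤ (τ w) (p ++ P₁) θ)
          (≤-trans (m≤m+n _ _) (≤-trans (≤-reflexive (≡-sym (length-++ (between (τ w) (p ++ P₁) θ)))) lends))
      l₂≤ : length (Q₁ ++ P₂) ≤ L
      l₂≤ = ≤-trans (between-≤ θ (Q₁ ++ P₂) (τ w')) (≤-trans (m≤n+m _ (length (between (τ w) (p ++ P₁) θ)))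
          (≤-trans (≤-reflexive (≡-sym (length-++ (between (τ w) (p ++ P₁) θ)))) lends))
      need≤ : need L (length (p ++ P₁)) (length (Q₁ ++ P₂)) ≤ roomL
      need≤ = need-mono a m L _ _ L ≤-refl l₁≤ l₂≤
      pos : 1 ≤ # (part θ U)
      pos = half (# (part θ U)) maj
        where half : ∀ x → # U ≤ 2 * x → 1 ≤ x
              half zero    h = ≤-trans U≥1 h
              half (suc _) _ = s≤s z≤n
      module S = Slot (slot A L w w' θ (p ++ P₁) (Q₁ ++ P₂) (part θ U) Z #A
        (≤-trans ≥₁ (≤-trans (m≤n+m _ (length p)) (≤-reflexive (≡-sym (length-++ p)))))
        (≤-trans ≥₂ (≤-trans (m≤n+m _ (length Q₁)) (≤-reflexive (≡-sym (length-++ Q₁)))))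
        (part-τ θ U) pos (≤-trans (*-mono-≤ 2a≤b need≤) room) (≤-trans need≤ #Z))

    abstract
      link : ∀ A w w' p B₁ B₂ U Z → # A ≤ L → length (τ w ∷ p ++ (B₁ ++ B₂)) ≤ L → Good B₁ → Good B₂ →
          1 ≤ # U → roomL ≤ # Z →
             Link A w w' (τ w ∷ p ++ (B₁ ++ B₂)) U Z
      link = link₀

    -- A segment from v to w that can be completed by any single vertex of R.
    record Absorber (A : Pred n) (v : V) (target : List Bool) (i : ℕ) : Set where
      field
        w     : V
        ds tail : List Bool
        splits : ds ++ τ w ∷ tail ≡ target
        F     : List V
        R     : Pred n
        flex  : ∀ r → r ∈ R → ∃ λ vs → Walk v ds vs w × vs ↭ r ∷ F
        uniq  : Unique (w ∷ F)
        fresh : All (λ v → ¬ (v ∈ A)) (w ∷ F)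
        size  : roomL ≤ # R
        small : suc b' ^ i * # (full ∖ R) ≤ b' ^ i * n

    roomL≥1 : 1 ≤ roomL
    roomL≥1 = ≤-trans (s≤s z≤n) (≤-reflexive (≡-sym (+-suc _ (4 * a * m))))

    flex-length : ∀ {v ds w F} {R : Pred n} → (∀ r → r ∈ R → ∃ λ vs → Walk v ds vs w × vs ↭ r ∷ F) → 1 ≤ # R →
        length ds ≡ 2 + length F
    flex-length {R = R} flex h with #-find R h
    ... | r , r∈ with flex r r∈
    ...   | vs , wk , p = ≡-trans (Walk-length wk) (cong suc (↭-length p))

    base₀ : ∀ A c v p B₁ B₂ → # A ≤ c → c + length (τ v ∷ p ++ (B₁ ++ B₂)) ≤ L → Good B₁ → Good B₂ →
           Absorber A v (τ v ∷ p ++ (B₁ ++ B₂)) 1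
    base₀ A c v p B₁ B₂ #A len g₁ g₂ with new A (≤-trans #A (≤-trans (m≤m+n c _) len))
    ... | w' , w'∉ = record { w = w' ; ds = K.ds ; tail = K.tail ; splits = K.splits ; F = K.F ;
        R = K.P ; flex = K.flex
          ; uniq = All.map (λ h e → h (⊆ʳ A (single w') _ (subst (_∈ single w') e (single-∈ w')))) K.fresh ∷
              K.uniq
          ; fresh = w'∉ ∷ All.map (λ h q → h (⊆ˡ A (single w') _ q)) K.fresh
          ; size = *-cancelˡ-≤ (suc b') (≤-trans room cov)
          ; small = shrink-round b' 1 1 n (# (full ∖ K.P)) (# K.P) n cov
              (≤-reflexive (≡-trans (+-comm _ (# K.P)) (#-compl K.P))) ≤-refl }
      where
      module K = Link (link (A ⊔ᵖ single w') v w' p B₁ B₂ full full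
        (≤-trans (#-∨ A (single w')) (≤-trans (+-mono-≤ #A (≤-reflexive (#-single w')))
            (≤-trans (+-monoʳ-≤ c (s≤s z≤n)) len)))
        (≤-trans (m≤n+m _ c) len) g₁ g₂ (≤-trans (≤-trans roomL≥1 room₁) (≤-reflexive (≡-sym (#-full n))))
            (≤-trans room₁ (≤-reflexive (≡-sym (#-full n)))))
      cov : n ≤ suc b' * # K.P
      cov = ≤-trans (≤-reflexive (≡-sym (#-full n)))
          (≤-trans K.cover (scale (suc b') (#-mono {P = full ∩ K.P} {Q = K.P} (λ v h → h))))

    abstract
      base : ∀ A c v p B₁ B₂ → # A ≤ c → c + length (τ v ∷ p ++ (B₁ ++ B₂)) ≤ L → Good B₁ → Good B₂ →
             Absorber A v (τ v ∷ p ++ (B₁ ++ B₂)) 1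
      base = base₀

    -- If t fits both the old absorber and a new slot, then whichever of the two takes r, the other takes t.
    extend₀ : ∀ {A v target i} c → # A ≤ c → Absorber A v target i → ∀ B₁ B₂ →
        c + length (target ++ (B₁ ++ B₂)) ≤ L → Good B₁ → Good B₂ →
             Absorber A v (target ++ (B₁ ++ B₂)) (suc i)
    extend₀ {A} {v} {target} {i} c #A X B₁ B₂ len g₁ g₂ = go (find (full ∖ X.R))
      where
      module X = Absorber X
      pat₀ : X.ds ++ τ X.w ∷ (X.tail ++ (B₁ ++ B₂)) ≡ target ++ (B₁ ++ B₂)
      pat₀ = ≡-trans (≡-sym (++-assoc X.ds (τ X.w ∷ X.tail) (B₁ ++ B₂))) (cong (_++ (B₁ ++ B₂)) X.splits)
      lenF : length X.ds ≡ 2 + length X.F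
      lenF = flex-length X.flex (≤-trans roomL≥1 X.size)
      len' : c + (length X.ds + length (τ X.w ∷ (X.tail ++ (B₁ ++ B₂)))) ≤ L
      len' = ≤-trans (≤-reflexive (cong (c +_) (≡-trans (≡-sym (length-++ X.ds)) (cong length pat₀)))) len
      A' : Pred n
      A' = A ⊔ᵖ mem (X.w ∷ X.F)
      #A' : # A' + 1 ≤ L
      #A' = ≤-trans (+-monoˡ-≤ 1 (≤-trans (#-∨ A (mem (X.w ∷ X.F))) (+-mono-≤ #A (#-mem≤ (X.w ∷ X.F)))))
            (≤-trans (≤-reflexive (+-assoc c _ 1))
                (≤-trans (+-monoʳ-≤ c (≤-trans (≤-reflexive (≡-trans (+-comm _ 1) (≡-sym lenF))) (m≤m+n _ _)))
                len'))
      go : (∃ λ u → u ∈ full ∖ X.R) ⊎ (∀ u → ¬ (u ∈ full ∖ X.R)) → Absorber A v (target ++ (B₁ ++ B₂)) (suc i)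
      go (inj₂ none) = record { w = X.w ; ds = X.ds ; tail = X.tail ++ (B₁ ++ B₂) ; splits = pat₀ ; F = X.F ;
          R = X.R ; flex = X.flex
            ; uniq = X.uniq ; fresh = X.fresh ; size = X.size
            ; small = ≤-trans (≤-reflexive (≡-trans (cong (suc b' ^ suc i *_) (#-empty {P = full ∖ X.R} none))
                (*-zeroʳ (suc b' ^ suc i)))) z≤n }
      go (inj₁ (u , u∈)) with new A' (≤-trans (m≤m+n _ 1) #A')
      ... | w' , w'∉ = record { w = w' ; ds = X.ds ++ K.ds ; tail = K.tail
            ; splits = ≡-trans (++-assoc X.ds K.ds _) (≡-trans (cong (X.ds ++_) K.splits) pat₀)
            ; F = K.t ∷ X.w ∷ (X.F ++ K.F) ; R = X.R ⊔ᵖ K.P ; flex = flex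
            ; uniq = uniq ; fresh = (λ q → w'∉ (⊆ˡ A (mem (X.w ∷ X.F)) w' q)) ∷ (λ q →
                K.t∉ (⊆ˡ A' (single w') K.t (⊆ˡ A (mem (X.w ∷ X.F)) K.t q))) ∷ All.head X.fresh ∷
                 Allₚ.++⁺ (All.tail X.fresh) (All.map (λ h q →
                     h (⊆ˡ A' (single w') _ (⊆ˡ A (mem (X.w ∷ X.F)) _ q))) K.fresh)
            ; size = ≤-trans X.size (#-mono {P = X.R} {Q = X.R ⊔ᵖ K.P} (⊆ˡ X.R K.P))
            ; small = shrink-round b' (suc b' ^ i) (b' ^ i) (# (full ∖ X.R)) (# (full ∖ (X.R ⊔ᵖ K.P)))
                (# ((full ∖ X.R) ∩ K.P)) n
                 K.cover shr X.small }
        where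
        module K = Link (link (A' ⊔ᵖ single w') X.w w' X.tail B₁ B₂ (full ∖ X.R) X.R
          (≤-trans (#-∨ {n} A' (single w')) (≤-trans (+-monoʳ-≤ (# A') (≤-reflexive (#-single {n} w'))) #A'))
          (≤-trans (≤-trans (m≤n+m _ (length X.ds)) (m≤n+m _ c)) len') g₁ g₂ (#-pos {P = full ∖ X.R} u∈) X.size)
        shr : # (full ∖ (X.R ⊔ᵖ K.P)) + # ((full ∖ X.R) ∩ K.P) ≤ # (full ∖ X.R)
        shr = ≤-trans (+-monoˡ-≤ _ (#-mono {P = full ∖ (X.R ⊔ᵖ K.P)} {Q = (full ∖ X.R) ∖ K.P} sub))
            (≤-reflexive (≡-sym (#-split (full ∖ X.R) K.P)))
          where sub : full ∖ (X.R ⊔ᵖ K.P) ⊆ (full ∖ X.R) ∖ K.P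
                sub v h with X.R v | K.P v
                ... | false | false = refl
        flex : ∀ r → r ∈ X.R ⊔ᵖ K.P → ∃ λ vs → Walk v (X.ds ++ K.ds) vs w' × vs ↭ r ∷ K.t ∷ X.w ∷ (X.F ++ K.F)
        flex r h with ∨-true {X.R r} h
        ... | inj₁ p with X.flex r p | K.flex K.t K.t∈P
        ...   | vs , wk , q | vs' , wk' , q' = _ , wk ⋈ wk' ,
                  trans (++⁺ q (prep X.w q')) (prep r
                      (trans (++⁺ˡ X.F (swap X.w K.t refl))
                      (trans (shift K.t X.F _) (prep K.t (shift X.w X.F K.F)))))
        flex r h | inj₂ p with X.flex K.t K.t∈Z | K.flex r p
        ...   | vs , wk , q | vs' , wk' , q' = _ , wk ⋈ wk' ,
                  trans (++⁺ q (prep X.w q')) (trans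
                      (prep K.t (trans (++⁺ˡ X.F (swap X.w r refl))
                      (trans (shift r X.F _) (prep r (shift X.w X.F K.F))))) (swap K.t r refl))
        uniq : Unique (w' ∷ K.t ∷ X.w ∷ (X.F ++ K.F))
        uniq = ((λ e → K.t∉ (⊆ʳ A' (single w') K.t (subst (_∈ single w') e (single-∈ w')))) ∷
                (λ e → w'∉ (⊆ʳ A (mem (X.w ∷ X.F)) w' (∈⇒mem {xs = X.w ∷ X.F} (here e)))) ∷
                Allₚ.++⁺ (∉all {xs = X.F} (λ q →
                    w'∉ (⊆ʳ A (mem (X.w ∷ X.F)) w' (⊆ʳ (single X.w) (mem X.F) w' q))))
                         (All.map (λ h e → h (⊆ʳ A' (single w') _ (subst (_∈ single w') e (single-∈ w'))))
                             K.fresh)) ∷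
               ((λ e → K.t∉ (⊆ˡ A' (single w') K.t
                   (⊆ʳ A (mem (X.w ∷ X.F)) K.t (∈⇒mem {xs = X.w ∷ X.F} (here e))))) ∷
                Allₚ.++⁺ (∉all {xs = X.F} (λ q →
                    K.t∉ (⊆ˡ A' (single w') K.t (⊆ʳ A (mem (X.w ∷ X.F)) K.t
                    (⊆ʳ (single X.w) (mem X.F) K.t q))))) K.t∉F) ∷
               Allₚ.++⁺ (un-head X.uniq) (All.map (λ {y} h e →
                   h (⊆ˡ A' (single w') y (⊆ʳ A (mem (X.w ∷ X.F)) y
                   (subst (_∈ mem (X.w ∷ X.F)) e (∈⇒mem {xs = X.w ∷ X.F} (here refl)))))) K.fresh) ∷
               Uniqueₚ.++⁺ (un-tail X.uniq) K.uniq
                   (λ { {y} (p , q) → All.lookup K.fresh q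
                   (⊆ˡ A' (single w') y (⊆ʳ A (mem (X.w ∷ X.F)) y (∈⇒mem {xs = X.w ∷ X.F} (there p)))) })
          where
          un-head : ∀ {x : V} {xs} → Unique (x ∷ xs) → All (x ≢_) xs
          un-head (h ∷ _) = h
          un-tail : ∀ {x : V} {xs} → Unique (x ∷ xs) → Unique xs
          un-tail (_ ∷ u) = u

    abstract
      extend : ∀ {A v target i} c → # A ≤ c → Absorber A v target i → ∀ B₁ B₂ →
          c + length (target ++ (B₁ ++ B₂)) ≤ L → Good B₁ → Good B₂ →
               Absorber A v (target ++ (B₁ ++ B₂)) (suc i)
      extend = extend₀

  join-unique : ∀ {A : Set} {v₀ v w : A} {F G : List A} → Unique (v₀ ∷ v ∷ F) → Unique (w ∷ G) →
    (∀ {x} → x ∈ˡ (v₀ ∷ v ∷ F) → x ∈ˡ (w ∷ G) → ⊥) → Unique (v₀ ∷ w ∷ (F ++ v ∷ G))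
  join-unique {v₀ = v₀} {v} {w} {F} {G} u u' d = Unique-↭
    (prep v₀ (trans (prep v (shift w F G)) (trans (swap v w refl) (prep w (↭-sym (shift v F G))))))
    (Uniqueₚ.++⁺ u u' λ { (p , q) → d p q })

  module Connect {n} (H : Fin n → Fin n → Bool) (m : ℕ) (1≤m : 1 ≤ m) (hf : Walks.HoleFree H m) (τ : Fin n → Bool) where
    open Walks H

    record Path (A : Pred n) (v w : V) (ds : List Bool) : Set where
      field
        us    : List V
        walk  : Walk v ds us w
        uniq  : Unique us
        fresh : All (λ x → ¬ (x ∈ A)) us

    abstract
      connect : ∀ A s v w d e p → # A ≤ s → 1 ≤ length p → s + 3 * m ≤ # (E d v) → s + 3 * m + m ≤ # (E e w) →
                s + 3 * m + m + (4 * m + length p) ≤ n → Path A v w (d ∷ (p ++ [ not e ]))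
      connect A s v w d e p #A p≥ hv hw hn =
        case pick⁺ (E d v) A s (3 * m) #A hv of λ { (X , X⊆ , X∥ , #X , #A₁) →
        case pick⁺ (E e w) (A ⊔ᵖ X) (s + 3 * m) m #A₁ hw of λ { (N , N⊆ , N∥ , #N , #A₂) →
        case pick⁺ full (A ⊔ᵖ X ⊔ᵖ N) (s + 3 * m + m) (4 * m + length p) #A₂
            (≤-trans hn (≤-reflexive (≡-sym (#-full n)))) of λ { (W , _ , W∥ , #W , _) →
        case pathFrom hf 1≤m p X W N p≥ (λ x a b → W∥ x b (⊆ˡ (A ⊔ᵖ X) N x (⊆ʳ A X x a)))
            (≤-reflexive (≡-sym #X)) (≤-reflexive (≡-sym #N)) (≤-reflexive (≡-sym #W)) of
          λ { (x , x∈ , vs , y , wk , y∈ , vs∈ , vsu) → record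
            { us = x ∷ (vs ++ y ∷ [])
            ; walk = step (X⊆ x x∈) (wk ⋈ edge (≡-trans (E-not e y w) (N⊆ y y∈)))
            ; uniq = Allₚ.++⁺ (All.map (λ {z} q e →
                W∥ z q (⊆ˡ (A ⊔ᵖ X) N z (⊆ʳ A X z (subst (_∈ X) e x∈)))) vs∈)
                              ((λ e → N∥ y y∈ (⊆ʳ A X y (subst (_∈ X) e x∈))) ∷ []) ∷
                     Unique-↭ (trans (prep y (↭-reflexive (≡-sym (++-identityʳ vs)))) (↭-sym (shift y vs [])))
                       (All.map (λ {z} q e → W∥ z q (⊆ʳ (A ⊔ᵖ X) N z (subst (_∈ N) e y∈))) vs∈ ∷ vsu)
            ; fresh = X∥ x x∈ ∷ Allₚ.++⁺ (All.map (λ {z} q r → W∥ z q (⊆ˡ (A ⊔ᵖ X) N z (⊆ˡ A X z r))) vs∈)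
                                          ((λ r → N∥ y y∈ (⊆ˡ A X y r)) ∷ []) } }}}}

  module Chains {n} (H : Fin n → Fin n → Bool) (m : ℕ) (1≤m : 1 ≤ m) (hf : Walks.HoleFree H m)
               (τ : Fin n → Bool) (a : ℕ) (1≤a : 1 ≤ a) (deg : ∀ v → n ≤ a * # (Walks.E H (τ v) v))
               (L b' : ℕ) (b≡ : 16 * a * a ≡ suc b')
                   (room : suc b' * Absorbers.need H m 1≤m hf τ a 1≤a deg L L L ≤ n)
               (q : ℕ) (decay : b' ^ q * n < suc b' ^ q * m) where
    open Walks H
    open Slots H m 1≤m hf τ a 1≤a deg using (Nb)
    open Absorbers H m 1≤m hf τ a 1≤a deg using (between; need)
    open Rounds H m 1≤m hf τ a 1≤a deg L b' b≡ room
    open Connect H m 1≤m hf τ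

    rounds : ∀ {A v target i} c → # A ≤ c → Absorber A v target i → ∀ Ds → All Good² Ds →
        c + length (target ++ concat Ds) ≤ L →
             Absorber A v (target ++ concat Ds) (length Ds + i)
    rounds {A} {v} {target} {i} c #A X [] [] len = subst (λ t → Absorber A v t i)
        (≡-sym (++-identityʳ target)) X
    rounds {A} {v} {target} {i} c #A X (D ∷ Ds) ((B₁ , B₂ , refl , g₁ , g₂) ∷ gs) len =
      subst₂ (Absorber A v) (++-assoc target D (concat Ds)) (+-suc (length Ds) i)
        (rounds c #A (extend c #A X B₁ B₂
            (≤-trans (+-monoʳ-≤ c (≤-trans (m≤m+n _ (length (concat Ds)))
            (≤-reflexive (≡-trans (≡-sym (length-++ (target ++ D)))
            (cong length (++-assoc target D (concat Ds))))))) len) g₁ g₂) Ds gs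
          (subst (λ t → c + length t ≤ L) (≡-sym (++-assoc target D (concat Ds))) len))

    absorber : ∀ A c v p Ds → # A ≤ c → length Ds ≡ suc q → All Good² Ds →
        c + length (τ v ∷ p ++ concat Ds) ≤ L →
               Absorber A v (τ v ∷ p ++ concat Ds) (suc q)
    absorber A c v p (D ∷ Ds) #A len ((B₁ , B₂ , refl , g₁ , g₂) ∷ gs) le =
      subst₂ (Absorber A v) (++-assoc (τ v ∷ p) D (concat Ds)) (≡-trans (+-comm (length Ds) 1) len)
        (rounds c #A (base A c v p B₁ B₂ #A
            (≤-trans (+-monoʳ-≤ c (≤-trans (m≤m+n _ (length (concat Ds)))
            (≤-reflexive (≡-trans (≡-sym (length-++ (τ v ∷ p ++ D)))
            (cong length (++-assoc (τ v ∷ p) D (concat Ds))))))) le) g₁ g₂) Ds gs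
          (subst (λ t → c + length t ≤ L) (≡-sym (++-assoc (τ v ∷ p) D (concat Ds))) le))

    small-R : ∀ {A v target} (X : Absorber A v target (suc q)) → # (full ∖ Absorber.R X) < m
    small-R X = *-cancelˡ-< (suc b' ^ suc q) _ _
        (≤-trans (s≤s small) (≤-trans (s≤s
        (≤-trans (≤-reflexive (*-assoc b' (b' ^ q) n)) (m≤n+m _ (b' ^ q * n))))
        (≤-trans (*-monoʳ-< (suc b') decay) (≤-reflexive (≡-sym (*-assoc (suc b') (suc b' ^ q) m))))))
      where open Absorber X

    -- A walk from v₀ to v containing one absorber for each acceptance set in Rs.
    record Chain (v₀ : V) (target : List Bool) (Rs : List (Pred n)) : Set where
      field
        v     : V
        ds tail : List Bool
        splits : ds ++ τ v ∷ tail ≡ target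
        F     : List V
        flex  : ∀ rs → Pointwise _∈_ rs Rs → ∃ λ vs → Walk v₀ ds vs v × vs ↭ rs ++ F
        uniq  : Unique (v₀ ∷ v ∷ F)
        len   : length ds ≡ suc (length Rs + length F)
        small : All (λ R → # (full ∖ R) < m) Rs
      used : List V
      used = v₀ ∷ v ∷ F

      used-len : ∀ es → suc (length (target ++ es)) ≤ L → length used + length (τ v ∷ tail ++ es) ≤ L
      used-len es h = ≤-trans (+-monoˡ-≤ (length (τ v ∷ tail ++ es))
          (s≤s (≤-trans (s≤s (m≤n+m (length F) (length Rs))) (≤-reflexive (≡-sym len)))))
        (≤-trans (≤-reflexive (cong suc
            (≡-trans (≡-sym (length-++ ds))
            (cong length (≡-trans (≡-sym (++-assoc ds (τ v ∷ tail) es)) (cong (_++ es) splits)))))) h)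
    open Chain using (used)

    start : ∀ v₀ p Ds → length Ds ≡ suc q → All Good² Ds → suc (length (τ v₀ ∷ p ++ concat Ds)) ≤ L →
            ∃ λ R → Chain v₀ (τ v₀ ∷ p ++ concat Ds) (R ∷ [])
    start v₀ p Ds len gs le = R , record { v = w ; ds = ds ; tail = tail ; splits = splits ; F = F
        ; flex = λ { (r ∷ []) (r∈ ∷ []) → flex r r∈ } ; uniq = All.map (λ h e →
            h (subst (_∈ single v₀) e (single-∈ v₀))) fresh ∷ uniq
        ; len = flex-length flex (≤-trans roomL≥1 size) ; small = small-R X ∷ [] }
      where
      X = absorber (single v₀) 1 v₀ p Ds (≤-reflexive (#-single v₀)) len gs le
      open Absorber X

    Grows : ∀ {v₀ t t' Rs Rs'} → Chain v₀ t Rs → Chain v₀ t' Rs' → Set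
    Grows C C' = ∀ x → x ∈ˡ used C → x ∈ˡ used C'

    skip : ∀ {v₀ target Rs} → Chain v₀ target Rs → ∀ es → Chain v₀ (target ++ es) Rs
    skip C es = record { v = v ; ds = ds ; tail = tail ++ es ; splits = ≡-trans
        (≡-sym (++-assoc ds (τ v ∷ tail) es)) (cong (_++ es) splits)
      ; F = F ; flex = flex ; uniq = uniq ; len = len ; small = small }
      where open Chain C

    add : ∀ {v₀ target Rs} → Chain v₀ target Rs → ∀ Ds → length Ds ≡ suc q → All Good² Ds →
        suc (length (target ++ concat Ds)) ≤ L →
          ∃ λ R → Chain v₀ (target ++ concat Ds) (R ∷ Rs)
    add {v₀} {target} {Rs} C Ds len gs le = X.R , record
        { v = X.w ; ds = C.ds ++ X.ds ; tail = X.tail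
        ; splits = ≡-trans (++-assoc C.ds X.ds _)
            (≡-trans (cong (C.ds ++_) X.splits)
            (≡-trans (≡-sym (++-assoc C.ds _ (concat Ds))) (cong (_++ concat Ds) C.splits)))
        ; F = C.F ++ C.v ∷ X.F ; flex = flex
        ; uniq = join-unique C.uniq X.uniq (λ p q → All.lookup X.fresh q (∈⇒mem {xs = C.used} p))
        ; len = ≡-trans (length-++ C.ds)
            (≡-trans (cong₂ _+_ C.len (flex-length X.flex (≤-trans roomL≥1 X.size)))
                 (≡-trans (eq (length Rs) (length C.F) (length X.F))
                     (cong (λ t → suc (suc (length Rs + t))) (≡-sym (length-++ C.F)))))
        ; small = small-R X₀ ∷ C.small }
      where
      module C = Chain C
      X₀ = absorber (mem C.used) (length C.used) C.v C.tail Ds (#-mem≤ C.used) len gs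
          (C.used-len (concat Ds) le)
      module X = Absorber X₀
      eq : ∀ k f g → suc (k + f) + (2 + g) ≡ suc (suc (k + (f + suc g)))
      eq = solve-∀
      flex : ∀ rs → Pointwise _∈_ rs (X.R ∷ Rs) → ∃ λ vs → Walk v₀ (C.ds ++ X.ds) vs X.w ×
          vs ↭ rs ++ (C.F ++ C.v ∷ X.F)
      flex (r ∷ rs) (r∈ ∷ rs∈) =
        case C.flex rs rs∈ of λ { (vs , wk , p) →
        case X.flex r r∈ of λ { (vs' , wk' , p') →
          _ , (wk ⋈ wk') , trans (++⁺ p (prep C.v p')) (trans (++⁺ˡ (rs ++ C.F) (swap C.v r refl))
                (trans (shift r (rs ++ C.F) (C.v ∷ X.F)) (prep r (↭-reflexive (++-assoc rs C.F (C.v ∷ X.F))))))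
                    }}

    enough : ∀ l → l ≤ L → L + 3 * m + m + (4 * m + l) ≤ roomL
    enough l h = need-connect a m L l h

    deg-room : ∀ v → roomL ≤ # (E (τ v) v)
    deg-room v = *-cancelˡ-≤ a {{>-nonZero 1≤a}}
        (≤-trans (≤-trans (*-monoˡ-≤ roomL (≤-trans (m≤n*m a 2) 2a≤b)) room) (deg v))

    abstract
      enoughN : ∀ v → L + 3 * m + m ≤ # (E (τ v) v)
      enoughN v = ≤-trans (≤-trans (m≤m+n (L + 3 * m + m) (4 * m + 0)) (enough 0 z≤n)) (deg-room v)

      enoughX : ∀ v → L + 3 * m ≤ # (E (τ v) v)
      enoughX v = ≤-trans (m≤m+n (L + 3 * m) m) (enoughN v)

      enoughW : ∀ l → l ≤ L → L + 3 * m + m + (4 * m + l) ≤ n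
      enoughW l h = ≤-trans (enough l h) room₁

    append : ∀ {v₀ target Rs} (C : Chain v₀ target Rs) r → ¬ (r ∈ˡ used C) → ∀ D → Good D →
        2 + length (target ++ D) ≤ L →
             ∃ λ (C' : Chain v₀ (target ++ D) Rs) → Grows C C' × r ∈ˡ used C'
    append {v₀} {target} {Rs} C r r∉ D g le = case g (τ r) of λ { (P , Q , refl , P≥) → go P Q P≥ le }
      where
      module C = Chain C
      go : ∀ P Q → 1 ≤ length P → 2 + length (target ++ (P ++ not (τ r) ∷ τ r ∷ Q)) ≤ L →
           ∃ λ (C' : Chain v₀ (target ++ (P ++ not (τ r) ∷ τ r ∷ Q)) Rs) → Grows C C' × r ∈ˡ used C'
      go P Q P≥ le = record
          { v = r ; ds = C.ds ++ es ; tail = Q ; splits = pat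
          ; F = C.F ++ C.v ∷ K.us
          ; flex = λ rs rs∈ → case C.flex rs rs∈ of λ { (vs , wk , p) →
               _ , (wk ⋈ K.walk) , trans (++⁺ʳ (C.v ∷ K.us) p) (↭-reflexive (++-assoc rs C.F (C.v ∷ K.us))) }
          ; uniq = join-unique C.uniq (∉all {xs = K.us} (λ q →
              All.lookup K.fresh (mem⇒∈ q) (⊆ˡ (single r) (mem C.used) r (single-∈ r))) ∷ K.uniq)
                     (λ { p (here e) → r∉ (subst (_∈ˡ C.used) e p) ; {x} p (there i) →
                         All.lookup K.fresh i (⊆ʳ (single r) (mem C.used) x (∈⇒mem {xs = C.used} p)) })
          ; len = ≡-trans (length-++ C.ds) (≡-trans (cong₂ _+_ C.len (Walk-length K.walk))
                   (≡-trans (eq (length Rs) (length C.F) (length K.us))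
                       (cong (λ t → suc (length Rs + t)) (≡-sym (length-++ C.F)))))
          ; small = C.small } , grows , there (here refl)
        where
        es = between (τ C.v) (C.tail ++ P) (τ r)
        total = P ++ not (τ r) ∷ τ r ∷ Q
        pat : (C.ds ++ es) ++ τ r ∷ Q ≡ target ++ total
        pat = ≡-trans (++-assoc C.ds es _) (≡-trans (cong (C.ds ++_) (cut (τ C.v) C.tail P (τ r) Q))
                (≡-trans (≡-sym (++-assoc C.ds (τ C.v ∷ C.tail) total)) (cong (_++ total) C.splits)))
        le' : suc (length C.used) + length (τ C.v ∷ C.tail ++ total) ≤ L
        le' = ≤-trans (+-monoˡ-≤ _ (s≤s
            (s≤s (≤-trans (s≤s (m≤n+m (length C.F) (length Rs))) (≤-reflexive (≡-sym C.len))))))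
              (≤-trans (≤-reflexive (cong (λ t → suc (suc t))
                  (≡-trans (≡-sym (length-++ C.ds))
                  (cong length (≡-trans (≡-sym (++-assoc C.ds (τ C.v ∷ C.tail) total))
                  (cong (_++ total) C.splits)))))) le)
        mid≤ : length (C.tail ++ P) ≤ L
        mid≤ = ≤-trans (≤-trans (m≤m+n _ (length (not (τ r) ∷ τ r ∷ Q)))
            (≤-reflexive (≡-trans (≡-sym (length-++ (C.tail ++ P))) (cong length (++-assoc C.tail P _)))))
                (≤-trans (n≤1+n _) (≤-trans (m≤n+m _ (suc (length C.used))) le'))
        module K = Path (connect (mem (r ∷ C.used)) L C.v r (τ C.v) (τ r) (C.tail ++ P)
          (≤-trans (#-mem≤ (r ∷ C.used)) (≤-trans (m≤m+n _ _) le'))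
          (≤-trans P≥ (≤-trans (m≤n+m _ (length C.tail)) (≤-reflexive (≡-sym (length-++ C.tail)))))
          (enoughX C.v) (enoughN r) (enoughW _ mid≤))
        eq : ∀ k f g → suc (k + f) + suc g ≡ suc (k + (f + suc g))
        eq = solve-∀
        grows : ∀ x → x ∈ˡ C.used → x ∈ˡ (v₀ ∷ r ∷ (C.F ++ C.v ∷ K.us))
        grows x (here e) = here e
        grows x (there (here e)) = there (there (∈ₚ.∈-++⁺ʳ C.F (here e)))
        grows x (there (there i)) = there (there (∈ₚ.∈-++⁺ˡ i))

  module Matching {n : ℕ} where

    count : List (Pred n) → Fin n → ℕ
    count []       r = 0
    count (R ∷ Rs) r = bit (R r) + count Rs r

    misses : List (Pred n) → Fin n → ℕ
    misses []       r = 0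
    misses (R ∷ Rs) r = bit ((full ∖ R) r) + misses Rs r

    count+misses : ∀ Rs r → count Rs r + misses Rs r ≡ length Rs
    count+misses []       r = refl
    count+misses (R ∷ Rs) r = ≡-trans (+-interchange (bit (R r)) (count Rs r) _ (misses Rs r))
        (cong₂ _+_ (one (R r)) (count+misses Rs r))
      where one : ∀ b → bit b + bit (not b) ≡ 1
            one true  = refl
            one false = refl

    S-misses : ∀ m Rs → All (λ R → # (full ∖ R) < m) Rs → S (misses Rs) ≤ length Rs * m
    S-misses m []       []       = ≤-reflexive (S-0 n)
    S-misses m (R ∷ Rs) (h ∷ hs) = ≤-trans (≤-reflexive (S-+ (bit ∘ (full ∖ R)) (misses Rs)))
        (+-mono-≤ (<⇒≤ h) (S-misses m Rs hs))

    markov : ∀ (B : Pred n) (f : Fin n → ℕ) c → (∀ r → r ∈ B → c ≤ f r) → # B * c ≤ S f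
    markov B f c h = ≤-trans (≤-reflexive (≡-sym (S-* (bit ∘ B) c))) (S-mono row)
      where row : ∀ r → bit (B r) * c ≤ f r
            row r with B r in e
            ... | false = z≤n
            ... | true  = ≤-trans (≤-reflexive (*-identityˡ c)) (h r e)

    count-++ : ∀ Ms Us r → count (Ms ++ Us) r ≡ count Ms r + count Us r
    count-++ []       Us r = refl
    count-++ (M ∷ Ms) Us r = ≡-trans (cong (bit (M r) +_) (count-++ Ms Us r)) (≡-sym (+-assoc (bit (M r)) _ _))

    count-≤ : ∀ Us r → count Us r ≤ length Us
    count-≤ []       r = z≤n
    count-≤ (U ∷ Us) r = +-mono-≤ (bit≤1 (U r)) (count-≤ Us r)

    count-↭ : ∀ {Ms Ns} → Ms ↭ Ns → ∀ r → count Ms r ≡ count Ns r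
    count-↭ refl r = refl
    count-↭ (prep M p) r = cong (bit (M r) +_) (count-↭ p r)
    count-↭ (swap {ys = ys} M N p) r = ≡-trans (cong (λ t → bit (M r) + (bit (N r) + t)) (count-↭ p r))
      (≡-trans (≡-sym (+-assoc (bit (M r)) (bit (N r)) _))
          (≡-trans (cong (_+ count ys r) (+-comm (bit (M r)) (bit (N r)))) (+-assoc (bit (N r)) (bit (M r)) _)))
    count-↭ (trans p q) r = ≡-trans (count-↭ p r) (count-↭ q r)

    pointwise-↭ : ∀ {rs : List (Fin n)} {Ms Ns} → Pointwise _∈_ rs Ms → Ms ↭ Ns → ∃ λ rs' →
        rs ↭ rs' × Pointwise _∈_ rs' Ns
    pointwise-↭ pw refl = _ , refl , pw
    pointwise-↭ (h ∷ pw) (prep _ p) = let rs' , q , pw' = pointwise-↭ pw p in _ , prep _ q , h ∷ pw'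
    pointwise-↭ (h ∷ h' ∷ pw) (swap _ _ p) = let rs' , q , pw' = pointwise-↭ pw p in _ , swap _ _ q , h' ∷ h ∷ pw'
    pointwise-↭ pw (trans p p') = let _ , q , pw' = pointwise-↭ pw p ; _ , q' , pw'' = pointwise-↭ pw' p' in _ , trans q q' , pw''

    outside : Pred n → List (Fin n) → ℕ
    outside R []       = 0
    outside R (x ∷ xs) = bit ((full ∖ R) x) + outside R xs

    outside-≤ : ∀ R xs → Unique xs → outside R xs ≤ # ((full ∖ R) ∩ mem xs)
    outside-≤ R [] _ = z≤n
    outside-≤ R (x ∷ xs) (x∉ ∷ u) with ∈? x (full ∖ R)
    ... | inj₂ h = ≤-trans (≤-reflexive (cong (λ b → bit b + outside R xs) (no⇒false h)))
        (≤-trans (outside-≤ R xs u)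
        (#-mono {P = (full ∖ R) ∩ mem xs} {Q = (full ∖ R) ∩ mem (x ∷ xs)} λ v q →
            ∧-intro (proj₁ (∧-true {(full ∖ R) v} q))
            (⊆ʳ (single x) (mem xs) v (proj₂ (∧-true {(full ∖ R) v} q)))))
      where no⇒false : ∀ {b} → ¬ (b ≡ true) → b ≡ false
            no⇒false {true} h = ⊥-elim (h refl)
            no⇒false {false} _ = refl
    ... | inj₁ h = ≤-trans (≤-reflexive (cong (λ b → bit b + outside R xs) h))
        (≤-trans (+-mono-≤ (≤-reflexive (≡-sym (#-single x))) (outside-≤ R xs u))
        (≤-trans (#-disj (single x) ((full ∖ R) ∩ mem xs) (λ v p q →
            all∉ x∉ (subst (_∈ mem xs) (single-≡ p) (proj₂ (∧-true {(full ∖ R) v} q)))))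
          (#-mono {P = single x ⊔ᵖ ((full ∖ R) ∩ mem xs)} {Q = (full ∖ R) ∩ mem (x ∷ xs)} sub)))
      where sub : single x ⊔ᵖ ((full ∖ R) ∩ mem xs) ⊆ (full ∖ R) ∩ mem (x ∷ xs)
            sub v q with ∨-true {single x v} q
            ... | inj₁ p = ∧-intro (subst (_∈ full ∖ R) (≡-sym (single-≡ p)) h) (⊆ˡ (single x) (mem xs) v p)
            ... | inj₂ p = ∧-intro (proj₁ (∧-true {(full ∖ R) v} p))
                (⊆ʳ (single x) (mem xs) v (proj₂ (∧-true {(full ∖ R) v} p)))

    -- Replacing r' by r at an absorber that accepts r frees r' for R.
    exchange : ∀ R r {rs Ms} → Pointwise _∈_ rs Ms →
               (∃₂ λ r' rs₂ → r' ∈ R × Pointwise _∈_ rs₂ Ms × (r' ∷ rs₂ ↭ r ∷ rs)) ⊎ count Ms r ≤ outside R rs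
    exchange R r [] = inj₂ z≤n
    exchange R r {x ∷ rs} {M ∷ Ms} (h ∷ pw) with exchange R r pw
    ... | inj₁ (r' , rs₂ , r'∈ , pw₂ , p) = inj₁ (r' , x ∷ rs₂ , r'∈ , h ∷ pw₂ , trans (swap r' x refl)
        (trans (prep x p) (swap x r refl)))
    ... | inj₂ le with ∈? r M | ∈? x R
    ...   | inj₁ rM | inj₁ xR = inj₁ (x , r ∷ rs , xR , rM ∷ pw , swap x r refl)
    ...   | inj₁ rM | inj₂ x∉ = inj₂
        (+-mono-≤ {bit (M r)} (≤-trans (bit≤1 (M r)) (≤-reflexive (≡-sym (cong bit (¬true⇒not x∉))))) le)
    ...   | inj₂ r∉ | _ = inj₂ (≤-trans (+-monoˡ-≤ (count Ms r) (bit-mono {M r} {false} (λ e → ⊥-elim (r∉ e))))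
        (≤-trans le (m≤n+m _ _)))

    module _ (m : ℕ) (Rs : List (Pred n)) (small : All (λ R → # (full ∖ R) < m) Rs)
        (X : Pred n) (X≥ : length Rs ≤ # X)
             (ok : ∀ r → r ∈ X → 2 * m ≤ count Rs r) where

      Result : List (Pred n) → Set
      Result Ms = ∃ λ rs → Pointwise _∈_ rs Ms × Unique rs × All (_∈ X) rs

      pw-length : ∀ {rs : List (Fin n)} {Ms : List (Pred n)} → Pointwise _∈_ rs Ms → length rs ≡ length Ms
      pw-length []       = refl
      pw-length (_ ∷ pw) = cong suc (pw-length pw)

      step : ∀ R Ms Us → Result Ms → R ∷ (Ms ++ Us) ↭ Rs → Result (R ∷ Ms)
      step R Ms Us (rs , pw , uq , al) p = choose (find (X' ∩ R))
        where
        X' = X ∖ mem rs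
        X'≥ : suc (length Us) ≤ # X'
        X'≥ = +-cancelʳ-≤ (length Ms) _ _
            (≤-trans (≤-reflexive (≡-trans (cong suc
            (≡-trans (+-comm (length Us) (length Ms)) (≡-sym (length-++ Ms)))) (↭-length p)))
                (≤-trans X≥ (≤-trans (#-∖ X (mem rs))
                    (+-monoʳ-≤ (# X') (≤-trans (#-mem≤ rs) (≤-reflexive (pw-length pw)))))))
        R-small : # (full ∖ R) < m
        R-small = All.head (All-resp-↭ (↭-sym p) small)
        fresh : ∀ r → r ∈ X' → All (r ≢_) rs
        fresh r r∈ = ∉all {xs = rs} (proj₂ (∈∖ {P = X} {mem rs} r∈))
        choose : (∃ λ r → r ∈ X' ∩ R) ⊎ (∀ r → ¬ (r ∈ X' ∩ R)) → Result (R ∷ Ms)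
        choose (inj₁ (r , h)) = let a , b = ∧-true {X' r} h in r ∷ rs , b ∷ pw , fresh r a ∷ uq , proj₁ (∈∖ {P = X} {mem rs} a) ∷ al
        choose (inj₂ none) with #-find X' (≤-trans (s≤s z≤n) X'≥)
        ... | r , r∈ with exchange R r pw
        ...   | inj₁ (r' , rs₂ , r'∈ , pw₂ , q) = r' ∷ rs₂ , r'∈ ∷ pw₂ , Unique-↭ (↭-sym q)
            (fresh r r∈ ∷ uq) , All-resp-↭ (↭-sym q) (proj₁ (∈∖ {P = X} {mem rs} r∈) ∷ al)
        ...   | inj₂ le = ⊥-elim (swap-count m (count Ms r) (length Us) (outside R rs) (# (full ∖ R))
                  (≤-trans (ok r (proj₁ (∈∖ {P = X} {mem rs} r∈))) (≤-trans (≤-reflexive (≡-sym (count-↭ p r)))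
                     (≤-trans (+-mono-≤ (bit-mono {R r} {false} (λ e → ⊥-elim (none r (∧-intro r∈ e))))
                         (≤-reflexive (count-++ Ms Us r))) (+-monoʳ-≤ (count Ms r) (count-≤ Us r)))))
                  (≤-trans X'≥ (≤-trans (#-mono {P = X'} {Q = full ∖ R} (λ v q →
                      ¬true⇒not (λ e → none v (∧-intro q e)))) (<⇒≤ R-small)))
                  le (≤-trans (outside-≤ R rs uq)
                      (#-mono {P = (full ∖ R) ∩ mem rs} {Q = full ∖ R} (λ v q →
                      proj₁ (∧-true {(full ∖ R) v} q)))) R-small)

      all-matched : ∀ Us Ms → Result Ms → Ms ++ Us ↭ Rs → Result Rs
      all-matched [] Ms (rs , pw , uq , al) p = let rs' , q , pw' = pointwise-↭ pw (subst (_↭ Rs) (++-identityʳ Ms) p) in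
        rs' , pw' , Unique-↭ q uq , All-resp-↭ q al
      all-matched (R ∷ Us) Ms res p = all-matched Us (R ∷ Ms)
          (step R Ms Us res (trans (↭-sym (shift R Ms Us)) p)) (trans (↭-sym (shift R Ms Us)) p)

      matching : Result Rs
      matching = all-matched Rs [] ([] , [] , [] , []) refl

  split-list : ∀ {A : Set} k (xs : List A) {j} → length xs ≡ k + j → ∃₂ λ ys zs → xs ≡ ys ++ zs ×
      length ys ≡ k × length zs ≡ j
  split-list zero    xs       e = [] , xs , refl , refl , e
  split-list (suc k) (x ∷ xs) e = let ys , zs , p , l , l' = split-list k xs (suc-injective e) in x ∷ ys , zs , cong (x ∷_) p , cong suc l , l'

  Cycle : ∀ {n} → (Fin n → Fin n → Bool) → List Bool → Set
  Cycle H os = ∃₂ λ v vs → Walks.Walk H v os vs v × Unique (v ∷ vs)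

  module Spanning {n} (H : Fin n → Fin n → Bool) (m : ℕ) (1≤m : 1 ≤ m) (hf : Walks.HoleFree H m)
               (τ : Fin n → Bool) (a : ℕ) (1≤a : 1 ≤ a) (deg : ∀ v → n ≤ a * # (Walks.E H (τ v) v))
               (L b' : ℕ) (b≡ : 16 * a * a ≡ suc b')
                   (room : suc b' * Absorbers.need H m 1≤m hf τ a 1≤a deg L L L ≤ n)
               (q : ℕ) (decay : b' ^ q * n < suc b' ^ q * m) where
    open Walks H
    open Connect H m 1≤m hf τ
    open Chains H m 1≤m hf τ a 1≤a deg L b' b≡ room q decay
    open Matching {n}
    open Chain using (used)

    prefix-≤ : ∀ (xs ys zs : List Bool) → length (xs ++ ys) ≤ length (xs ++ (ys ++ zs))
    prefix-≤ xs ys zs = ≤-trans (m≤m+n _ (length zs))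
        (≤-reflexive (≡-trans (≡-sym (length-++ (xs ++ ys))) (cong length (++-assoc xs ys zs))))

    add-many : ∀ k {v₀ target Rs} → Chain v₀ target Rs → ∀ Ds → length Ds ≡ k * suc q → All Good² Ds →
        suc (length (target ++ concat Ds)) ≤ L →
               ∃ λ Rs' → length Rs' ≡ k + length Rs × Chain v₀ (target ++ concat Ds) Rs'
    add-many zero {v₀} {target} {Rs} C [] e gs le = Rs , refl , subst (λ t → Chain v₀ t Rs)
        (≡-sym (++-identityʳ target)) C
    add-many (suc k) {v₀} {target} {Rs} C Ds e gs le with split-list (suc q) Ds e
    ... | Ds₁ , Ds₂ , refl , l₁ , l₂ with add C Ds₁ l₁ (Allₚ.++⁻ˡ Ds₁ gs)
        (≤-trans (s≤s (≤-trans (prefix-≤ target (concat Ds₁) (concat Ds₂))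
        (≤-reflexive (cong (λ t → length (target ++ t)) (concat-++ Ds₁ Ds₂))))) le)
    ...   | R , C₁ with add-many k C₁ Ds₂ l₂ (Allₚ.++⁻ʳ Ds₁ gs)
        (≤-trans (s≤s (≤-reflexive (cong length
        (≡-trans (++-assoc target (concat Ds₁) (concat Ds₂)) (cong (target ++_) (concat-++ Ds₁ Ds₂)))))) le)
    ...     | Rs' , l , C₂ = Rs' , ≡-trans l (+-suc k (length Rs)) ,
              subst (λ t → Chain v₀ t Rs') (≡-trans (++-assoc target (concat Ds₁) (concat Ds₂))
                  (cong (target ++_) (concat-++ Ds₁ Ds₂))) C₂

    include : ∀ {v₀ target Rs} (B : Pred n) (C : Chain v₀ target Rs) → ∀ Ds →
        # (B ∖ mem (used C)) ≤ length Ds → All Good² Ds →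
              2 + length (target ++ concat Ds) ≤ L → ∃ λ (C' : Chain v₀ (target ++ concat Ds) Rs) → ∀ r →
                  r ∈ B → r ∈ mem (used C')
    include {v₀} {target} {Rs} B C Ds h gs le with find (B ∖ mem (used C))
    ... | inj₂ none = skip C (concat Ds) , all
      where all : ∀ r → r ∈ B → r ∈ mem (used C)
            all r r∈ with ∈? r (mem (used C))
            ... | inj₁ i = i
            ... | inj₂ ni = ⊥-elim (none r (∖∈ {P = B} {mem (used C)} r∈ ni))
    include {v₀} {target} {Rs} B C [] h gs le | inj₁ (r , r∈) = ⊥-elim
        (<-irrefl refl (≤-trans (#-pos {P = B ∖ mem (used C)} r∈) h))
    include {v₀} {target} {Rs} B C (D ∷ Ds) h ((B₁ , B₂ , refl , g₁ , g₂) ∷ gs) le | inj₁ (r , r∈)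
      with append C r (λ i → proj₂ (∈∖ {P = B} {mem (used C)} r∈) (∈⇒mem {xs = used C} i)) (B₁ ++ B₂) good
            (≤-trans (s≤s (s≤s (prefix-≤ target (B₁ ++ B₂) (concat Ds)))) le)
      where
      good : Good (B₁ ++ B₂)
      good θ with g₁ θ
      ... | P , Q , e , l = P , Q ++ B₂ , ≡-trans (cong (_++ B₂) e) (++-assoc P (not θ ∷ θ ∷ Q) B₂) , l
    ... | C₁ , gr , r∈₁ with include B C₁ Ds h₁ gs
        (≤-trans (s≤s (s≤s (≤-reflexive (cong length (++-assoc target (B₁ ++ B₂) (concat Ds)))))) le)
      where
      h₁ : # (B ∖ mem (used C₁)) ≤ length Ds
      h₁ = ≤-pred (≤-trans (≤-trans (≤-reflexive (≡-sym (cong (_+ _) (#-single r))))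
          (≤-trans (#-disj (single r) (B ∖ mem (used C₁))
              (λ v p q → proj₂ (∈∖ {P = B} {mem (used C₁)} q)
                  (subst (_∈ mem (used C₁)) {r} {v} (≡-sym (single-≡ {u = r} {v} p))
                  (∈⇒mem {xs = used C₁} {r} r∈₁))))
              (#-mono {P = single r ⊔ᵖ (B ∖ mem (used C₁))} {Q = B ∖ mem (used C)} sub))) h)
        where sub : single r ⊔ᵖ (B ∖ mem (used C₁)) ⊆ B ∖ mem (used C)
              sub v q with ∨-true {single r v} q
              ... | inj₁ p = subst (_∈ B ∖ mem (used C)) (≡-sym (single-≡ p)) r∈
              ... | inj₂ p = ∖∈ {P = B} {mem (used C)} (proj₁ (∈∖ {P = B} {mem (used C₁)} p))
                     (λ i → proj₂ (∈∖ {P = B} {mem (used C₁)} p) (∈⇒mem {xs = used C₁} (gr v (mem⇒∈ i))))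
    ...   | C₂ , all = subst (λ t → ∃ λ (C' : Chain v₀ t Rs) → ∀ r → r ∈ B → r ∈ mem (used C'))
        (++-assoc target (B₁ ++ B₂) (concat Ds)) (C₂ , all)

    close : ∀ {v₀ target Rs} (C : Chain v₀ target Rs) mid → length Rs ≡ 8 * m →
        (∀ r → count Rs r < 2 * m → r ∈ mem (used C)) →
            1 ≤ length mid → length (used C) ≤ L → length (target ++ (mid ++ [ not (τ v₀) ])) ≤ n →
                Cycle H (target ++ (mid ++ [ not (τ v₀) ]))
    close {v₀} {target} {Rs} C mid k≡ ok mid≥ used≤ ℓ≤ =
        case connect (mem C.used) (length C.used) C.v v₀ (τ C.v) (τ v₀) (C.tail ++ mid) (#-mem≤ C.used)
          (≤-trans mid≥ (≤-trans (m≤n+m _ (length C.tail)) (≤-reflexive (≡-sym (length-++ C.tail)))))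
          (≤-trans (+-monoˡ-≤ (3 * m) used≤) (enoughX C.v))
              (≤-trans (+-monoˡ-≤ m (+-monoˡ-≤ (3 * m) used≤)) (enoughN v₀)) big of finish
      where
      module C = Chain C
      os = target ++ (mid ++ [ not (τ v₀) ])
      l = length (C.tail ++ mid)
      pat : C.ds ++ (τ C.v ∷ ((C.tail ++ mid) ++ [ not (τ v₀) ])) ≡ os
      pat = ≡-trans (cong (λ t → C.ds ++ τ C.v ∷ t) (++-assoc C.tail mid _))
          (≡-trans (≡-sym (++-assoc C.ds (τ C.v ∷ C.tail) _)) (cong (_++ (mid ++ [ not (τ v₀) ])) C.splits))
      ℓ≡ : length os ≡ 8 * m + (length C.used + suc l)
      ℓ≡ = ≡-trans (≡-sym (cong length pat))
          (≡-trans (length-++ C.ds) (≡-trans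
          (cong₂ _+_ C.len (cong suc (≡-trans (length-++ (C.tail ++ mid)) (+-comm l 1))))
             (≡-trans (eq (length Rs) (length C.F) l) (cong (_+ (length C.used + suc l)) k≡))))
        where eq : ∀ k f l → suc (k + f) + suc (suc l) ≡ k + (suc (suc f) + suc l)
              eq = solve-∀
      big : length C.used + 3 * m + m + (4 * m + l) ≤ n
      big = ≤-trans (≤-trans (n≤1+n _) (≤-reflexive (≡-trans (eq (length C.used) m l) (≡-sym ℓ≡)))) ℓ≤
        where eq : ∀ u m l → suc (u + 3 * m + m + (4 * m + l)) ≡ 8 * m + (u + suc l)
              eq = solve-∀
      finish : Path (mem C.used) C.v v₀ (τ C.v ∷ ((C.tail ++ mid) ++ [ not (τ v₀) ])) → Cycle H os
      finish K = case matching m Rs C.small X X≥ okX of λ { (rs , pw , rsu , rs∈) →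
                 case C.flex rs pw of λ { (vs , wk , p) →
                   v₀ , vs ++ C.v ∷ K.us , subst (λ t → Walk v₀ t (vs ++ C.v ∷ K.us) v₀) pat (wk ⋈ K.walk) ,
                   Unique-↭ (perm vs rs p)
                     (Uniqueₚ.++⁺ C.uniq (Uniqueₚ.++⁺ K.uniq rsu
                         (λ { {x} (i , j) → proj₂ (∈∖ {P = full} {mem (C.used ++ K.us)} {x} (All.lookup rs∈ j))
                         (∈⇒mem {xs = C.used ++ K.us} (∈ₚ.∈-++⁺ʳ C.used i)) }))
                       (λ { {x} (i , j) → [ (λ j' → All.lookup K.fresh j' (∈⇒mem {xs = C.used} i)) , (λ j' →
                           proj₂ (∈∖ {P = full} {mem (C.used ++ K.us)} {x} (All.lookup rs∈ j'))
                           (∈⇒mem {xs = C.used ++ K.us} (∈ₚ.∈-++⁺ˡ i))) ]′ (∈ₚ.∈-++⁻ K.us j) })) }}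
        where
        module K = Path K
        X = full ∖ mem (C.used ++ K.us)
        us≡ : length K.us ≡ suc l
        us≡ = suc-injective (≡-trans (≡-sym (Walk-length K.walk))
            (cong suc (≡-trans (length-++ (C.tail ++ mid)) (+-comm l 1))))
        X≥ : length Rs ≤ # X
        X≥ = +-cancelʳ-≤ (length C.used + suc l) _ _
            (≤-trans (≤-reflexive (cong (_+ (length C.used + suc l)) k≡))
            (≤-trans (≤-reflexive (≡-sym ℓ≡)) (≤-trans ℓ≤ (≤-trans (≤-reflexive (≡-sym (#-full n)))
               (≤-trans (#-∖ full (mem (C.used ++ K.us)))
                   (+-monoʳ-≤ (# X) (≤-trans (#-mem≤ (C.used ++ K.us))
                   (≤-reflexive (≡-trans (length-++ C.used) (cong (length C.used +_) us≡))))))))))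
        okX : ∀ r → r ∈ X → 2 * m ≤ count Rs r
        okX r r∈ with 2 * m ≤? count Rs r
        ... | yes h = h
        ... | no h = ⊥-elim (proj₂ (∈∖ {P = full} {mem (C.used ++ K.us)} {r} r∈)
            (∈⇒mem {xs = C.used ++ K.us} {r} (∈ₚ.∈-++⁺ˡ (mem⇒∈ {xs = C.used} {r} (ok r (≰⇒> h))))))
        perm : ∀ vs rs → vs ↭ rs ++ C.F → C.used ++ (K.us ++ rs) ↭ v₀ ∷ (vs ++ C.v ∷ K.us)
        perm vs rs p = prep v₀ (trans (prep C.v
            (trans (++⁺ˡ C.F (++-comm K.us rs))
            (trans (↭-reflexive (≡-sym (++-assoc C.F rs K.us)))
            (++⁺ʳ K.us (trans (++-comm C.F rs) (↭-sym p))))))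
                         (↭-sym (shift C.v vs K.us)))

    spanning : ∀ v₀ p Ds mid → length Ds ≡ 8 * m * suc q + 2 * m → All Good² Ds → 1 ≤ length mid →
               2 + length (τ v₀ ∷ p ++ concat Ds) ≤ L →
                   length ((τ v₀ ∷ p ++ concat Ds) ++ (mid ++ [ not (τ v₀) ])) ≤ n →
               Cycle H ((τ v₀ ∷ p ++ concat Ds) ++ (mid ++ [ not (τ v₀) ]))
    spanning v₀ p Ds mid e gs mid≥ le ℓ≤ =
      case split-list (8 * m * suc q) Ds e of λ { (Ds₁ , Ds₃ , refl , l₁ , l₃) →
      case split-list (suc q) Ds₁ {pred (8 * m) * suc q} (≡-trans l₁ (cong (_* suc q) (≡-sym 8m≡))) of
          λ { (Ds₀ , Ds₂ , refl , l₀ , l₂) →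
        go Ds₀ Ds₂ Ds₃ l₀ l₂ l₃ (Allₚ.++⁻ˡ Ds₀ (Allₚ.++⁻ˡ (Ds₀ ++ Ds₂) gs))
            (Allₚ.++⁻ʳ Ds₀ (Allₚ.++⁻ˡ (Ds₀ ++ Ds₂) gs)) (Allₚ.++⁻ʳ (Ds₀ ++ Ds₂) gs) le ℓ≤ }}
      where
      8m≡ : suc (pred (8 * m)) ≡ 8 * m
      8m≡ = suc-pred (8 * m) {{>-nonZero (≤-trans 1≤m (m≤n*m m 8))}}
      go : ∀ Ds₀ Ds₂ Ds₃ → length Ds₀ ≡ suc q → length Ds₂ ≡ pred (8 * m) * suc q → length Ds₃ ≡ 2 * m →
          All Good² Ds₀ → All Good² Ds₂ → All Good² Ds₃ →
           2 + length (τ v₀ ∷ p ++ concat ((Ds₀ ++ Ds₂) ++ Ds₃)) ≤ L →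
               length ((τ v₀ ∷ p ++ concat ((Ds₀ ++ Ds₂) ++ Ds₃)) ++ (mid ++ [ not (τ v₀) ])) ≤ n →
           Cycle H ((τ v₀ ∷ p ++ concat ((Ds₀ ++ Ds₂) ++ Ds₃)) ++ (mid ++ [ not (τ v₀) ]))
      go Ds₀ Ds₂ Ds₃ l₀ l₂ l₃ g₀ g₂ g₃ le ℓ≤ =
        case start v₀ p Ds₀ l₀ g₀ (≤-trans (n≤1+n _)
            (≤-trans (s≤s (s≤s (≤-trans (prefix-≤ (τ v₀ ∷ p) (concat Ds₀) (concat Ds₂ ++ concat Ds₃))
            (≤-reflexive (cong length (≡-sym t≡)))))) le)) of λ { (R , C₀) →
        case add-many (pred (8 * m)) C₀ Ds₂ l₂ g₂
            (≤-trans (n≤1+n _) (≤-trans (s≤s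
            (s≤s (≤-trans (m≤m+n _ (length (concat Ds₃)))
            (≤-reflexive (≡-trans (≡-sym (length-++ ((τ v₀ ∷ p ++ concat Ds₀) ++ concat Ds₂)))
            (cong length (≡-sym t≡'))))))) le)) of λ { (Rs , lR , C₁) →
        case include (λ r → does (count Rs r <? 2 * m)) C₁ Ds₃
            (bad≤ Rs C₁ (≡-trans lR (≡-trans (+-comm _ 1) 8m≡))) g₃
            (subst (λ t → 2 + length t ≤ L) t≡' le) of λ { (C₂ , all) →
          subst (λ t → Cycle H (t ++ (mid ++ [ not (τ v₀) ]))) (≡-sym t≡')
            (close C₂ mid (≡-trans lR (≡-trans (+-comm _ 1) 8m≡)) (λ r h →
                all r (does-true (count Rs r <? 2 * m) h)) mid≥
               (≤-trans (m≤m+n _ _) (Chain.used-len C₂ []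
                   (≤-trans (n≤1+n _) (subst (λ t → 2 + length t ≤ L)
                   (≡-trans t≡' (≡-sym (++-identityʳ _))) le))))
               (subst (λ t → length (t ++ (mid ++ [ not (τ v₀) ])) ≤ n) t≡' ℓ≤)) }}}
        where
        t≡ : τ v₀ ∷ p ++ concat ((Ds₀ ++ Ds₂) ++ Ds₃) ≡ (τ v₀ ∷ p) ++ (concat Ds₀ ++ (concat Ds₂ ++ concat Ds₃))
        t≡ = cong ((τ v₀ ∷ p) ++_) (≡-trans (≡-sym (concat-++ (Ds₀ ++ Ds₂) Ds₃))
            (≡-trans (cong (_++ concat Ds₃) (≡-sym (concat-++ Ds₀ Ds₂)))
            (++-assoc (concat Ds₀) (concat Ds₂) (concat Ds₃))))
        t≡' : τ v₀ ∷ p ++ concat ((Ds₀ ++ Ds₂) ++ Ds₃) ≡ ((τ v₀ ∷ p ++ concat Ds₀) ++ concat Ds₂) ++ concat Ds₃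
        t≡' = ≡-trans t≡ (≡-trans (≡-sym (++-assoc (τ v₀ ∷ p) (concat Ds₀) _))
            (≡-sym (++-assoc (τ v₀ ∷ p ++ concat Ds₀) (concat Ds₂) (concat Ds₃))))
        bad≤ : ∀ Rs {t} (C : Chain v₀ t Rs) → length Rs ≡ 8 * m →
            # ((λ r → does (count Rs r <? 2 * m)) ∖ mem (used C)) ≤ length Ds₃
        bad≤ Rs C k≡ = ≤-trans (#-mono {P = Bad ∖ mem (used C)} {Q = Bad} (λ v h →
            proj₁ (∈∖ {P = Bad} {mem (used C)} h)))
          (≤-trans (few-bad m (# Bad) (S (misses Rs)) 1≤m
            (markov Bad (misses Rs) (6 * m) (λ r h →
                miss-many m (count Rs r) (misses Rs r) (≡-trans (count+misses Rs r) k≡)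
                (does-sound (count Rs r <? 2 * m) h)))
            (≤-trans (S-misses m Rs (Chain.small C)) (≤-reflexive (cong (_* m) k≡)))) (≤-reflexive (≡-sym l₃)))
          where Bad : Pred n
                Bad r = does (count Rs r <? 2 * m)

  turn : Bool → Bool → ℕ
  turn true  false = 1
  turn false true  = 1
  turn _     _     = 0

  turn≤1 : ∀ x y → turn x y ≤ 1
  turn≤1 true  true  = z≤n
  turn≤1 true  false = ≤-refl
  turn≤1 false true  = ≤-refl
  turn≤1 false false = z≤n

  turns : List Bool → ℕ
  turns []           = 0
  turns (x ∷ [])     = 0
  turns (x ∷ y ∷ ys) = turn x y + turns (y ∷ ys)

  turns-tail : ∀ x xs j → suc j ≤ turns (x ∷ xs) → j ≤ turns xs
  turns-tail x (y ∷ ys) j h = ≤-pred (≤-trans h (+-monoˡ-≤ (turns (y ∷ ys)) (turn≤1 x y)))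

  first-turn : ∀ x xs k → suc k ≤ turns (x ∷ xs) → ∃₂ λ P Q →
      x ∷ xs ≡ P ++ x ∷ not x ∷ Q × k ≤ turns (not x ∷ Q)
  first-turn true  (false ∷ ys) k h = [] , ys , refl , ≤-pred h
  first-turn false (true  ∷ ys) k h = [] , ys , refl , ≤-pred h
  first-turn true  (true  ∷ ys) k h = let P , Q , e , l = first-turn true ys k h in true ∷ P , Q , cong (true ∷_) e , l
  first-turn false (false ∷ ys) k h = let P , Q , e , l = first-turn false ys k h in false ∷ P , Q , cong (false ∷_) e , l

  block : Bool → Bool → List Bool → List Bool → List Bool → List Bool
  block x y P₁ P₂ P₃ = P₁ ++ x ∷ (P₂ ++ y ∷ (P₃ ++ x ∷ y ∷ []))

  block-≡ : ∀ {x y P₁ P₂ P₃ Q₁ Q₂ Q₃} → y ∷ Q₁ ≡ P₂ ++ y ∷ x ∷ Q₂ → x ∷ Q₂ ≡ P₃ ++ x ∷ y ∷ Q₃ →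
            P₁ ++ x ∷ y ∷ Q₁ ≡ block x y P₁ P₂ P₃ ++ Q₃
  block-≡ {x} {y} {P₁} {P₂} {P₃} {Q₃ = Q₃} e₂ e₃ = ≡-trans
      (cong (λ t → P₁ ++ x ∷ t) (≡-trans e₂ (cong (λ t → P₂ ++ y ∷ t) e₃)))
    (≡-sym (≡-trans (++-assoc P₁ _ Q₃)
        (cong (λ t → P₁ ++ x ∷ t) (≡-trans (++-assoc P₂ _ Q₃)
        (cong (λ t → P₂ ++ y ∷ t) (++-assoc P₃ (x ∷ y ∷ []) Q₃))))))

  pos-++ : ∀ (P R : List Bool) y → 1 ≤ length (P ++ y ∷ R)
  pos-++ []      R y = s≤s z≤n
  pos-++ (_ ∷ _) R y = s≤s z≤n

  block-late : ∀ x y P₁ P₂ P₃ → ∃₂ λ P Q → block x y P₁ P₂ P₃ ≡ P ++ x ∷ y ∷ Q × 1 ≤ length P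
  block-late x y P₁ P₂ P₃ = P₁ ++ x ∷ (P₂ ++ y ∷ P₃) , [] ,
    ≡-sym (≡-trans (++-assoc P₁ (x ∷ (P₂ ++ y ∷ P₃)) _) (cong (λ t → P₁ ++ x ∷ t) (++-assoc P₂ (y ∷ P₃) _))) ,
        pos-++ P₁ _ x

  block-early : ∀ x y P₁ P₂ P₃ {Q₂} → x ∷ Q₂ ≡ P₃ ++ x ∷ y ∷ [] → ∃₂ λ P Q →
      block x y P₁ P₂ P₃ ≡ P ++ y ∷ x ∷ Q × 1 ≤ length P
  block-early x y P₁ P₂ P₃ {Q₂} e = P₁ ++ x ∷ P₂ , Q₂ ,
    ≡-trans (cong (λ t → P₁ ++ x ∷ (P₂ ++ y ∷ t)) (≡-sym e)) (≡-sym (++-assoc P₁ (x ∷ P₂) _)) , pos-++ P₁ _ x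

  snoc-head : ∀ (P : List Bool) {x y Q Q'} → x ∷ Q ≡ P ++ x ∷ y ∷ Q' → ∃ λ Q″ → x ∷ Q″ ≡ P ++ x ∷ y ∷ []
  snoc-head []      e = _ , refl
  snoc-head (z ∷ P) refl = _ , refl

  cut-block : ∀ xs j → 4 + j ≤ turns xs → ∃₂ λ B ys → xs ≡ B ++ ys × Good B × j ≤ turns ys
  cut-block (true ∷ xs) j h with first-turn true xs (3 + j) h
  ... | P₁ , Q₁ , e₁ , h₁ with first-turn false Q₁ (2 + j) h₁
  ... | P₂ , Q₂ , e₂ , h₂ with first-turn true Q₂ (1 + j) h₂
  ... | P₃ , Q₃ , e₃ , h₃ = block true false P₁ P₂ P₃ , Q₃ , ≡-trans e₁ (block-≡ {P₁ = P₁} {P₂} {P₃} e₂ e₃) ,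
      good , turns-tail false Q₃ j h₃
    where good : Good (block true false P₁ P₂ P₃)
          good true  = block-early true false P₁ P₂ P₃ (proj₂ (snoc-head P₃ e₃))
          good false = block-late true false P₁ P₂ P₃
  cut-block (false ∷ xs) j h with first-turn false xs (3 + j) h
  ... | P₁ , Q₁ , e₁ , h₁ with first-turn true Q₁ (2 + j) h₁
  ... | P₂ , Q₂ , e₂ , h₂ with first-turn false Q₂ (1 + j) h₂
  ... | P₃ , Q₃ , e₃ , h₃ = block false true P₁ P₂ P₃ , Q₃ , ≡-trans e₁ (block-≡ {P₁ = P₁} {P₂} {P₃} e₂ e₃) ,
      good , turns-tail true Q₃ j h₃
    where good : Good (block false true P₁ P₂ P₃)
          good false = block-early false true P₁ P₂ P₃ (proj₂ (snoc-head P₃ e₃))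
          good true  = block-late false true P₁ P₂ P₃

  cut-blocks : ∀ k xs → 8 * k ≤ turns xs → ∃₂ λ Ds ys → xs ≡ concat Ds ++ ys × length Ds ≡ k × All Good² Ds
  cut-blocks zero    xs h = [] , xs , refl , refl , []
  cut-blocks (suc k) xs h with cut-block xs (4 + 8 * k) (≤-trans (≤-reflexive (≡-sym (*-suc 8 k))) h)
  ... | B₁ , xs₁ , e₁ , g₁ , h₁ with cut-block xs₁ (8 * k) h₁
  ... | B₂ , xs₂ , e₂ , g₂ , h₂ with cut-blocks k xs₂ h₂
  ... | Ds , ys , e , l , gs = (B₁ ++ B₂) ∷ Ds , ys ,
        ≡-trans e₁ (≡-trans (cong (B₁ ++_) (≡-trans e₂ (cong (B₂ ++_) e)))
          (≡-trans (≡-sym (++-assoc B₁ B₂ _)) (≡-sym (++-assoc (B₁ ++ B₂) (concat Ds) ys)))) ,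
        cong suc l , (B₁ , B₂ , refl , g₁ , g₂) ∷ gs

  -- The shortest of g + 1 groups of M consecutive blocks has at most average length.
  window : ∀ g M Ds → length Ds ≡ suc g * M → All Good² Ds →
           ∃₂ λ pre W → ∃ λ post → concat Ds ≡ pre ++ (concat W ++ post) × length W ≡ M × All Good² W ×
               suc g * length (concat W) ≤ length (concat Ds)
  window zero M Ds e gs = [] , Ds , [] , ≡-sym (++-identityʳ (concat Ds)) , ≡-trans e
      (+-identityʳ M) , gs , ≤-reflexive (+-identityʳ _)
  window (suc g) M Ds e gs with split-list M Ds e
  ... | Ds₁ , Ds₂ , refl , l₁ , l₂ with window g M Ds₂ l₂ (Allₚ.++⁻ʳ Ds₁ gs)
  ... | pre , W , post , p , l , gW , h with ≤-total (length (concat W)) (length (concat Ds₁))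
  ...   | inj₁ le = concat Ds₁ ++ pre , W , post , ≡-trans (≡-sym (concat-++ Ds₁ Ds₂))
      (≡-trans (cong (concat Ds₁ ++_) p) (≡-sym (++-assoc (concat Ds₁) pre _))) , l , gW ,
            ≤-trans (+-mono-≤ le h) (≤-reflexive
                (≡-trans (≡-sym (length-++ (concat Ds₁))) (cong length (concat-++ Ds₁ Ds₂))))
  ...   | inj₂ ge = [] , Ds₁ , concat Ds₂ , ≡-sym (concat-++ Ds₁ Ds₂) , l₁ , Allₚ.++⁻ˡ Ds₁ gs ,
            ≤-trans (+-monoʳ-≤ (length (concat Ds₁)) (≤-trans (*-monoʳ-≤ (suc g) ge) h))
                (≤-reflexive (≡-trans (≡-sym (length-++ (concat Ds₁))) (cong length (concat-++ Ds₁ Ds₂))))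

  module Rotation {n} (H : Fin n → Fin n → Bool) where
    open Walks H

    walk-split : ∀ {u w vs} d ds e es → Walk u ((d ∷ ds) ++ (e ∷ es)) vs w →
                 ∃ λ x → ∃₂ λ vs₁ vs₂ → vs ≡ vs₁ ++ x ∷ vs₂ × Walk u (d ∷ ds) vs₁ x × Walk x (e ∷ es) vs₂ w
    walk-split d []        e es (step {v = v} h p) = v , [] , _ , refl , edge h , p
    walk-split d (d' ∷ ds) e es (step {v = v} h p) = let x , vs₁ , vs₂ , eq , p₁ , p₂ = walk-split d' ds e es p in
      x , v ∷ vs₁ , vs₂ , cong (v ∷_) eq , step h p₁ , p₂

    rotate : ∀ xs ys → Cycle H (xs ++ ys) → Cycle H (ys ++ xs)
    rotate []       ys       c = subst (Cycle H) (≡-sym (++-identityʳ ys)) c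
    rotate (x ∷ xs) []       c = subst (Cycle H) (++-identityʳ (x ∷ xs)) c
    rotate (x ∷ xs) (y ∷ ys) (v , vs , p , u) with walk-split x xs y ys p
    ... | w , vs₁ , vs₂ , refl , p₁ , p₂ = w , vs₂ ++ v ∷ vs₁ , p₂ ⋈ p₁ , Unique-↭
        (++-comm (v ∷ vs₁) (w ∷ vs₂)) u

  need-window : ∀ a m b l n → 12 * b * l ≤ n → 4 * b * (16 + 8 * a) * m ≤ n → 28 * b ≤ n →
    b * ((l + 2) + m + m + (4 * m + (l + 2)) + (4 * m + (l + 2)) +
        (4 * a * m + 3 * m + 3 * m) + suc (4 * a * m)) ≤ n
  need-window a m b l n h1 h2 h3 = *-cancelˡ-≤ 4
      (≤-trans (≤-reflexive (eq a m b l)) (≤-trans (h1 ⊕ h2 ⊕ h3) (≤-trans (m≤n+m _ n) (≤-reflexive (eq' n)))))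
    where
    eq : ∀ a m b l → 4 * (b * ((l + 2) + m + m + (4 * m + (l + 2)) + (4 * m + (l + 2)) +
        (4 * a * m + 3 * m + 3 * m) + suc (4 * a * m))) ≡ 12 * b * l + (4 * b * (16 + 8 * a) * m + 28 * b)
    eq = solve-∀
    eq' : ∀ n → n + (n + (n + n)) ≡ 4 * n
    eq' = solve-∀

  module Large {n} (H : Fin n → Fin n → Bool) (m : ℕ) (1≤m : 1 ≤ m) (hf : Walks.HoleFree H m)
               (τ : Fin n → Bool) (a : ℕ) (1≤a : 1 ≤ a) (deg : ∀ v → n ≤ a * # (Walks.E H (τ v) v))
               (b' : ℕ) (b≡ : 16 * a * a ≡ suc b') (q : ℕ) (decay : b' ^ q * n < suc b' ^ q * m)
               (h₁ : 4 * suc b' * (16 + 8 * a) * m ≤ n) (h₂ : 28 * suc b' ≤ n) where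
    open Rotation H

    M : ℕ
    M = 8 * m * suc q + 2 * m

    large : ∀ os → length os ≤ n → 8 * (12 * suc b' * suc M) ≤ turns os → Cycle H os
    large os ℓ≤ many =
      case cut-blocks (12 * suc b' * suc M) os many of λ { (Ds , ys , e , l , gs) →
      case window (11 + 12 * b') (suc M) Ds (≡-trans l (cong (_* suc M) (eq b'))) gs of
          λ { (pre , D ∷ W , post , p , lW , ((B₁ , B₂ , refl , g₁ , g₂) ∷ gW) , h) →
      case #-find (full {n}) (≤-trans (≤-trans (s≤s z≤n) (≤-trans (m≤n*m (suc b') 28) h₂))
          (≤-reflexive (≡-sym (#-full n)))) of λ { (v₀ , _) →
      case g₁ (τ v₀) of λ { (P , Q , refl , P≥) →
        go os pre ((P ++ not (τ v₀) ∷ τ v₀ ∷ Q) ++ B₂) W post ys P (Q ++ B₂) v₀ (≡-trans e (cong (_++ ys) p))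
            (++-assoc P (not (τ v₀) ∷ τ v₀ ∷ Q) B₂) (suc-injective lW) gW
           (≤-trans h (≤-trans (≤-trans (m≤m+n _ (length ys))
               (≤-reflexive (≡-trans (≡-sym (length-++ (concat Ds))) (cong length (≡-sym e))))) ℓ≤)) P≥ ℓ≤ }}}}
      where
      eq : ∀ b → 12 * suc b ≡ suc (11 + 12 * b)
      eq = solve-∀
      go : ∀ os pre D W post ys P Q v₀ → os ≡ (pre ++ (concat (D ∷ W) ++ post)) ++ ys →
          D ≡ P ++ not (τ v₀) ∷ τ v₀ ∷ Q → length W ≡ M → All Good² W →
           suc (11 + 12 * b') * length (concat (D ∷ W)) ≤ n → 1 ≤ length P → length os ≤ n → Cycle H os
      go os pre .(P ++ not (τ v₀) ∷ τ v₀ ∷ Q) W post ys P Q v₀ refl refl lW gW h P≥ ℓ≤ =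
        subst (Cycle H) (≡-sym shape) (rotate R X
            (subst (Cycle H) shape' (Spanning.spanning H m 1≤m hf τ a 1≤a deg L b' b≡
            (need-window a m (suc b') l n (subst (λ t → t * l ≤ n) (≡-sym (eq b')) h) h₁ h₂)
                q decay v₀ Q W mid lW gW
            (≤-trans P≥ (≤-trans (m≤n+m _ (length (post ++ (ys ++ pre))))
                (≤-reflexive (≡-sym (length-++ (post ++ (ys ++ pre)))))))
            lenL (≤-trans (≤-reflexive len≡) ℓ≤))))
        where
        D = P ++ not (τ v₀) ∷ τ v₀ ∷ Q
        l = length (concat (D ∷ W))
        L = l + 2
        mid = (post ++ (ys ++ pre)) ++ P
        X = pre ++ (P ++ [ not (τ v₀) ])
        R = (τ v₀ ∷ Q ++ concat W) ++ (post ++ ys)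
        shape : (pre ++ (concat (D ∷ W) ++ post)) ++ ys ≡ X ++ R
        shape = ≡-trans (++-assoc pre _ ys)
            (≡-trans (cong (pre ++_) (≡-trans (++-assoc (concat (D ∷ W)) post ys)
            (≡-trans (cong (_++ (post ++ ys)) (++-assoc P (not (τ v₀) ∷ τ v₀ ∷ Q) (concat W)))
                (≡-trans (++-assoc P _ (post ++ ys)) (≡-sym (++-assoc P [ not (τ v₀) ] _))))))
            (≡-sym (++-assoc pre (P ++ [ not (τ v₀) ]) R)))
        shape' : (τ v₀ ∷ Q ++ concat W) ++ (mid ++ [ not (τ v₀) ]) ≡ R ++ X
        shape' = ≡-trans (cong ((τ v₀ ∷ Q ++ concat W) ++_)
            (≡-trans (++-assoc (post ++ (ys ++ pre)) P _)
            (≡-trans (++-assoc post (ys ++ pre) _)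
            (≡-trans (cong (post ++_) (++-assoc ys pre _)) (≡-sym (++-assoc post ys _))))))
            (≡-sym (++-assoc (τ v₀ ∷ Q ++ concat W) (post ++ ys) X))
        len≡ : length ((τ v₀ ∷ Q ++ concat W) ++ (mid ++ [ not (τ v₀) ])) ≡ length
            ((pre ++ (concat (D ∷ W) ++ post)) ++ ys)
        len≡ = ≡-trans (cong length shape')
            (≡-trans (length-++ R) (≡-trans (+-comm (length R) (length X))
            (≡-trans (≡-sym (length-++ X)) (cong length (≡-sym shape)))))
        lenL : 2 + length (τ v₀ ∷ Q ++ concat W) ≤ L
        lenL = ≤-trans (≤-reflexive (+-comm 2 _))
            (+-monoˡ-≤ 2 (≤-trans (≤-trans (n≤1+n _) (m≤n+m _ (length P)))
            (≤-reflexive (≡-trans (≡-sym (length-++ P))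
            (cong length (≡-sym (++-assoc P (not (τ v₀) ∷ τ v₀ ∷ Q) (concat W))))))))

  constant : ∀ x xs → turns (x ∷ xs) ≡ 0 → xs ≡ replicate (length xs) x
  constant x     []           e = refl
  constant true  (true ∷ xs)  e = cong (true ∷_) (constant true xs e)
  constant false (false ∷ xs) e = cong (false ∷_) (constant false xs e)

  replicate-snoc : ∀ {A : Set} k (x : A) → replicate k x ++ x ∷ [] ≡ x ∷ replicate k x
  replicate-snoc zero    x = refl
  replicate-snoc (suc k) x = cong (x ∷_) (replicate-snoc k x)

  RotatesTo : List Bool → List Bool → Set
  RotatesTo os os' = ∃₂ λ xs ys → os ≡ xs ++ ys × os' ≡ ys ++ xs

  Opens : Bool → List Bool → Set
  Opens θ os = ∃ λ mid → RotatesTo os (θ ∷ (mid ++ [ not θ ]))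

  opens-at : ∀ θ P Q os → os ≡ P ++ not θ ∷ θ ∷ Q → Opens θ os
  opens-at θ P Q os e = Q ++ P , P ++ [ not θ ] , θ ∷ Q , ≡-trans e (≡-sym (++-assoc P [ not θ ] (θ ∷ Q))) ,
      cong (θ ∷_) (++-assoc Q P [ not θ ])

  opens-wrap : ∀ θ x xs P R → x ∷ xs ≡ P ++ x ∷ (R ++ [ not θ ]) → x ≡ θ → Opens θ (x ∷ xs)
  opens-wrap θ .θ xs []      R refl refl = R , [] , θ ∷ xs , refl , ≡-sym (++-identityʳ _)
  opens-wrap θ .θ xs (z ∷ P) R refl refl = P ++ θ ∷ R , [] , θ ∷ xs , refl , ≡-trans
      (cong (θ ∷_) (++-assoc P (θ ∷ R) [ not θ ])) (≡-sym (++-identityʳ _))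

  opens-or-constant : ∀ θ os → 1 ≤ length os → Opens θ os ⊎ ∃ λ d → os ≡ replicate (length os) d
  opens-or-constant θ (x ∷ xs) _ = go x θ (turns (x ∷ xs)) refl
    where
    second : ∀ x y P Q → not x ≡ y → not y ≡ x → x ∷ xs ≡ P ++ x ∷ y ∷ Q → ∀ k →
        turns (y ∷ Q) ≡ k → Opens x (x ∷ xs)
    second x y P Q e e' eq zero k≡ = opens-wrap x x xs P (replicate (length Q) y)
      (≡-trans eq (cong (λ t → P ++ x ∷ t)
          (≡-trans (cong (y ∷_) (constant y Q k≡))
          (≡-trans (≡-sym (replicate-snoc (length Q) y))
          (cong (λ t → replicate (length Q) y ++ [ t ]) (≡-sym e)))))) refl
    second x y P Q refl e' eq (suc k) k≡ with first-turn y Q k (≤-reflexive (≡-sym k≡))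
    ... | P' , Q' , eq' , _ = opens-at x (P ++ x ∷ P') Q' (x ∷ xs)
      (≡-trans eq (≡-trans (cong (λ t → P ++ x ∷ t) (≡-trans eq' (cong (λ t → P' ++ y ∷ t ∷ Q') e')))
          (≡-sym (++-assoc P (x ∷ P') _))))
    go : ∀ x θ k → turns (x ∷ xs) ≡ k → Opens θ (x ∷ xs) ⊎ ∃ λ d → x ∷ xs ≡ replicate (suc (length xs)) d
    go x θ zero e = inj₂ (x , cong (x ∷_) (constant x xs e))
    go x θ (suc k) e with first-turn x xs k (≤-reflexive (≡-sym e))
    go true  true  (suc k) e | P , Q , eq , _ = inj₁ (second true false P Q refl refl eq _ refl)
    go false false (suc k) e | P , Q , eq , _ = inj₁ (second false true P Q refl refl eq _ refl)
    go true  false (suc k) e | P , Q , eq , _ = inj₁ (opens-at false P Q (true ∷ xs) eq)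
    go false true  (suc k) e | P , Q , eq , _ = inj₁ (opens-at true P Q (false ∷ xs) eq)

  module Degrees {n} (H : Fin n → Fin n → Bool) (τ : Fin n → Bool) (a : ℕ) (deg : ∀ v → n ≤ a * # (Walks.E H (τ v) v)) where
    open Walks H

    out-sum : Bool → ℕ
    out-sum d = S (λ v → # (E d v))

    out-sum-swap : out-sum true ≡ out-sum false
    out-sum-swap = S-swap (λ v u → bit (H v u))

    out-sum-large : ∀ d → n * n ≤ 2 * a * out-sum d
    out-sum-large d = ≤-trans (≤-reflexive (≡-sym (S-const n n))) (≤-trans (S-mono row)
      (≤-reflexive (≡-trans (S-* (λ v → # (E true v) + # (E false v)) a)
          (≡-trans (cong (_* a) (S-+ (λ v → # (E true v)) (λ v → # (E false v)))) (both d)))))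
      where
      pickτ : ∀ d v → # (E d v) ≤ # (E true v) + # (E false v)
      pickτ true  v = m≤m+n _ _
      pickτ false v = m≤n+m _ _
      row : ∀ v → n ≤ (# (E true v) + # (E false v)) * a
      row v = ≤-trans (deg v) (≤-trans (*-monoʳ-≤ a (pickτ (τ v) v)) (≤-reflexive (*-comm a _)))
      eq : ∀ x a → (x + x) * a ≡ 2 * a * x
      eq = solve-∀
      both : ∀ d → (out-sum true + out-sum false) * a ≡ 2 * a * out-sum d
      both true  = ≡-trans (cong (λ t → (out-sum true + t) * a) (≡-sym out-sum-swap)) (eq (out-sum true) a)
      both false = ≡-trans (cong (λ t → (t + out-sum false) * a) out-sum-swap) (eq (out-sum false) a)

    many : ∀ d m s → 2 * a * (m + s) < n → m ≤ # (λ v → does (s ≤? # (E d v)))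
    many d m s h with m ≤? # (λ v → does (s ≤? # (E d v)))
    ... | yes p = p
    ... | no ¬p = ⊥-elim (<-irrefl refl
        (≤-trans h (*-cancelʳ-≤ n (2 * a * (m + s)) n {{>-nonZero (≤-trans (s≤s z≤n) h)}}
        (≤-trans (out-sum-large d) (≤-trans (*-monoʳ-≤ (2 * a) bound) (≤-reflexive (eq (2 * a) m s n)))))))
      where
      D : Pred n
      D v = does (s ≤? # (E d v))
      eq : ∀ b m s n → b * (m * n + n * s) ≡ b * (m + s) * n
      eq = solve-∀
      row : ∀ v → # (E d v) ≤ bit (D v) * n + s
      row v = by (D v) refl
        where by : ∀ b → D v ≡ b → # (E d v) ≤ bit b * n + s
              by true  _ = ≤-trans (#≤n (E d v))
                  (≤-trans (≤-reflexive (≡-sym (*-identityˡ n))) (m≤m+n (1 * n) s))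
              by false e = <⇒≤ (≰⇒> (does-false (s ≤? # (E d v)) e))
      bound : out-sum d ≤ m * n + n * s
      bound = ≤-trans (S-mono row) (≤-trans
          (≤-reflexive (≡-trans (S-+ (λ v → bit (D v) * n) (λ _ → s))
          (cong₂ _+_ (S-* (bit ∘ D) n) (S-const n s))))
                (+-monoˡ-≤ (n * s) (*-monoˡ-≤ n (<⇒≤ (≰⇒> ¬p)))))

  module Small {n} (H : Fin n → Fin n → Bool) (m : ℕ) (1≤m : 1 ≤ m) (hf : Walks.HoleFree H m)
               (loopless : ∀ v → H v v ≡ false)
               (τ : Fin n → Bool) (a : ℕ) (1≤a : 1 ≤ a) (deg : ∀ v → n ≤ a * # (Walks.E H (τ v) v))
               (room : 2 * a * (6 * m + 2) < n) where
    open Walks H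
    open Connect H m 1≤m hf τ
    open Rotation H
    open Degrees H τ a deg

    E-loop : ∀ d v → ¬ (E d v v ≡ true)
    E-loop true  v e = true≢false (≡-trans (≡-sym e) (loopless v))
    E-loop false v e = true≢false (≡-trans (≡-sym e) (loopless v))

    room-a : a * (1 + 3 * m + m) ≤ n
    room-a = ≤-trans (≤-trans (m≤m+n _ (a * (3 + 8 * m))) (≤-reflexive (eq a m))) (<⇒≤ room)
      where eq : ∀ a m → a * (1 + 3 * m + m) + a * (3 + 8 * m) ≡ 2 * a * (6 * m + 2)
            eq = solve-∀

    vertex : V
    vertex = proj₁ (#-find (full {n}) (≤-trans (≤-trans (s≤s z≤n) room) (≤-reflexive (≡-sym (#-full n)))))

    opened : ∀ v mid → 1 ≤ length mid → length mid + 8 * m + 1 ≤ n → Cycle H (τ v ∷ (mid ++ [ not (τ v) ]))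
    opened v mid mid≥ fits = v , us , walk , All.map (λ h e →
        h (subst (_∈ single v) e (single-∈ v))) fresh ∷ uniq
      where
      big : 1 + 3 * m + m ≤ # (E (τ v) v)
      big = *-cancelˡ-≤ a {{>-nonZero 1≤a}} (≤-trans room-a (deg v))
      eq : ∀ l m → 1 + 3 * m + m + (4 * m + l) ≡ l + 8 * m + 1
      eq = solve-∀
      open Path (connect (single v) 1 v v (τ v) (τ v) mid (≤-reflexive (#-single v)) mid≥
          (≤-trans (m≤m+n _ m) big) big
                  (≤-trans (≤-reflexive (eq (length mid) m)) fits))

    consistent : ∀ d k → 4 + k + 8 * m ≤ n → Cycle H (replicate (4 + k) d)
    consistent d k fits = case hole hf d X Y (many (not d) m s room')
        (many d m s room') of λ { (b , c , b∈ , c∈ , e) →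
        go b c e (does-sound (s ≤? # (E (not d) b)) b∈) (does-sound (s ≤? # (E d c)) c∈) }
      where
      s = 5 * m + 2
      X Y : Pred n
      X v = does (s ≤? # (E (not d) v))
      Y v = does (s ≤? # (E d v))
      room' : 2 * a * (m + s) < n
      room' = ≤-trans (s≤s (≤-reflexive (cong (2 * a *_) (eq m)))) room
        where eq : ∀ m → m + (5 * m + 2) ≡ 6 * m + 2
              eq = solve-∀
      s≥ : 2 + 3 * m + m ≤ s
      s≥ = ≤-trans (m≤m+n _ m) (≤-reflexive (eq m))
        where eq : ∀ m → 2 + 3 * m + m + m ≡ 5 * m + 2
              eq = solve-∀
      shape : d ∷ (replicate (suc k) d ++ [ not (not d) ]) ≡ replicate (3 + k) d
      shape = cong (d ∷_) (≡-trans (cong (λ t → replicate (suc k) d ++ [ t ]) (not-involutive d))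
          (replicate-snoc (suc k) d))
      go : ∀ b c → E d b c ≡ true → s ≤ # (E (not d) b) → s ≤ # (E d c) → Cycle H (replicate (4 + k) d)
      go b c e hb hc = c , us ++ b ∷ [] , subst (λ t → Walk c t (us ++ b ∷ []) c) (replicate-snoc (3 + k) d)
          (subst (λ t → Walk c t us b) shape walk ⋈ edge e) ,
          Allₚ.++⁺ (All.map (λ h e' → h (∈⇒mem {xs = c ∷ b ∷ []} (here (≡-sym e')))) fresh)
              ((λ { refl → E-loop d c e }) ∷ []) ∷
          Unique-↭ (trans (prep b (↭-reflexive (≡-sym (++-identityʳ us)))) (↭-sym (shift b us [])))
            (All.map (λ h e' → h (∈⇒mem {xs = c ∷ b ∷ []} (there (here (≡-sym e'))))) fresh ∷ uniq)
        where
        eq : ∀ k m → 2 + 3 * m + m + (4 * m + (1 + k)) + 1 ≡ 4 + k + 8 * m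
        eq = solve-∀
        open Path (connect (mem (c ∷ b ∷ [])) 2 c b d (not d) (replicate (suc k) d)
            (#-mem≤ (c ∷ b ∷ [])) (s≤s z≤n)
          (≤-trans (m≤m+n _ m) (≤-trans s≥ hc)) (≤-trans s≥ hb)
          (≤-trans (≤-trans (m≤m+n _ 1) (≤-reflexive
              (≡-trans (cong (λ t → 2 + 3 * m + m + (4 * m + t) + 1) (length-replicate (suc k))) (eq k m))))
              fits))

    Triangle : Set
    Triangle = ∃ λ u → ∃₂ λ v w → H u v ≡ true × H v w ≡ true × H w u ≡ true

    triangle : Triangle → ∀ d → Cycle H (replicate 3 d)
    triangle (u , v , w , p , q , r) true  = u , v ∷ w ∷ [] , step p (step q (edge r)) ,
      ((λ { refl → E-loop true u p }) ∷ (λ { refl → E-loop true u r }) ∷ []) ∷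
          ((λ { refl → E-loop true v q }) ∷ []) ∷ [] ∷ []
    triangle (u , v , w , p , q , r) false = u , w ∷ v ∷ [] , step r (step q (edge p)) ,
      ((λ { refl → E-loop true u r }) ∷ (λ { refl → E-loop true u p }) ∷ []) ∷
          ((λ { refl → E-loop true v q }) ∷ []) ∷ [] ∷ []

    small : Triangle → ∀ os → 3 ≤ length os → length os + 8 * m ≤ n → Cycle H os
    small tri os ℓ≥ fits with opens-or-constant (τ vertex) os (≤-trans (s≤s z≤n) ℓ≥)
    ... | inj₁ (mid , xs , ys , refl , e) = rotate ys xs (subst (Cycle H) e (opened vertex mid
            (≤-pred (≤-pred (≤-trans ℓ≥ (≤-reflexive len))))
                (≤-trans (≤-trans (n≤1+n _) (≤-reflexive
                (≡-trans (eq (length mid) m) (cong (_+ 8 * m) (≡-sym len))))) fits)))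
      where
      len : length (xs ++ ys) ≡ 2 + length mid
      len = ≡-trans (length-++ xs) (≡-trans (+-comm (length xs) (length ys))
          (≡-trans (≡-sym (length-++ ys))
          (≡-trans (cong length (≡-sym e)) (cong suc (≡-trans (length-++ mid) (+-comm _ 1))))))
      eq : ∀ l m → suc (l + 8 * m + 1) ≡ 2 + l + 8 * m
      eq = solve-∀
    ... | inj₂ (d , e) = const (length os) e ℓ≥ fits
      where
      const : ∀ k → os ≡ replicate k d → 3 ≤ k → k + 8 * m ≤ n → Cycle H os
      const (suc (suc (suc zero)))    refl h f = triangle tri d
      const (suc (suc (suc (suc k)))) refl h f = consistent d k f
      const (suc (suc zero)) _ (s≤s (s≤s ())) _
      const (suc zero) _ (s≤s ()) _

  sum-tabulate : ∀ {n} (f : Fin n → ℕ) → sum (tabulate f) ≡ S f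
  sum-tabulate {zero}  f = refl
  sum-tabulate {suc n} f = cong (f zero +_) (sum-tabulate (f ∘ suc))

  sum-allFin : ∀ {n} (f : Fin n → ℕ) → sum (map f (allFin n)) ≡ S f
  sum-allFin f = ≡-trans (cong sum (map-tabulate (λ i → i) f)) (sum-tabulate f)

  nth : ∀ {A : Set} → A → List A → ℕ → A
  nth d []       k       = d
  nth d (x ∷ xs) zero    = x
  nth d (x ∷ xs) (suc k) = nth d xs k

  nth-tabulate : ∀ {A : Set} {n} (d : A) (f : Fin n → A) i → nth d (tabulate f) (toℕ i) ≡ f i
  nth-tabulate d f zero    = refl
  nth-tabulate d f (suc i) = nth-tabulate d (f ∘ suc) i

  nth-beyond : ∀ {A : Set} (d : A) xs → nth d xs (length xs) ≡ d
  nth-beyond d []       = refl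
  nth-beyond d (x ∷ xs) = nth-beyond d xs

  nth-∈ : ∀ {A : Set} (d : A) xs k → k < length xs → nth d xs k ∈ˡ xs
  nth-∈ d (x ∷ xs) zero    h       = here refl
  nth-∈ d (x ∷ xs) (suc k) (s≤s h) = there (nth-∈ d xs k h)

  nth-injective : ∀ {A : Set} (d : A) {xs} → Unique xs → ∀ j k → j < length xs → k < length xs →
      nth d xs j ≡ nth d xs k → j ≡ k
  nth-injective d (h ∷ u) zero    zero    _ _ e = refl
  nth-injective d {x ∷ xs} (h ∷ u) zero    (suc k) _ (s≤s l) e = ⊥-elim (All.lookup h (nth-∈ d xs k l) e)
  nth-injective d {x ∷ xs} (h ∷ u) (suc j) zero    (s≤s l) _ e = ⊥-elim
      (All.lookup h (nth-∈ d xs j l) (≡-sym e))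
  nth-injective d (h ∷ u) (suc j) (suc k) (s≤s p) (s≤s q) e = cong suc (nth-injective d u j k p q e)

  ≡ᵇ-true : ∀ j k → (j ≡ᵇ k) ≡ true → j ≡ k
  ≡ᵇ-true zero    zero    e = refl
  ≡ᵇ-true (suc j) (suc k) e = cong suc (≡ᵇ-true j k e)

  ≡ᵇ-refl : ∀ j → (j ≡ᵇ j) ≡ true
  ≡ᵇ-refl zero    = refl
  ≡ᵇ-refl (suc j) = ≡ᵇ-refl j

  succ-case : ∀ {ℓ} {i j : Fin ℓ} → succ? i j ≡ true → suc (toℕ i) ≡ toℕ j ⊎ (suc (toℕ i) ≡ ℓ × toℕ j ≡ 0)
  succ-case {ℓ} {i} {j} h with ∨-true {suc (toℕ i) ≡ᵇ toℕ j} h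
  ... | inj₁ p = inj₁ (≡ᵇ-true _ _ p)
  ... | inj₂ p = let a , b = ∧-true {suc (toℕ i) ≡ᵇ ℓ} p in inj₂ (≡ᵇ-true _ _ a , ≡ᵇ-true _ _ b)

  module Embedding {n} (H : Fin n → Fin n → Bool) where
    open Walks H

    nth-walk : ∀ {u ds vs w} d → Walk u ds vs w → ∀ k → k < length ds →
        E (nth d ds k) (nth w (u ∷ vs) k) (nth w (u ∷ vs) (suc k)) ≡ true
    nth-walk d (edge e)   zero    h = e
    nth-walk d (edge e)   (suc k) (s≤s ())
    nth-walk d (step e p) zero    h = e
    nth-walk d (step e p) (suc k) (s≤s h) = nth-walk d p k h

    embed : ∀ {ℓ} (ℓ≥ : 3 ≤ ℓ) (o : Fin ℓ → Bool) → Cycle H (tabulate o) → Contains H (cycleAdj (orient ℓ≥ o))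
    embed {ℓ} ℓ≥ o (v , vs , p , u) = φ , (λ {i} {j} e →
        toℕ-injective (nth-injective v u (toℕ i) (toℕ j) (bound i) (bound j) e)) , edges
      where
      φ : Fin ℓ → V
      φ i = nth v (v ∷ vs) (toℕ i)
      len : length (v ∷ vs) ≡ ℓ
      len = ≡-trans (≡-sym (Walk-length p)) (length-tabulate o)
      bound : ∀ i → toℕ i < length (v ∷ vs)
      bound i = subst (toℕ i <_) (≡-sym len) (toℕ<n i)
      along : ∀ i → E (o i) (φ i) (nth v (v ∷ vs) (suc (toℕ i))) ≡ true
      along i = subst (λ d → E d (φ i) (nth v (v ∷ vs) (suc (toℕ i))) ≡ true) (nth-tabulate true o i)
        (nth-walk true p (toℕ i) (subst (toℕ i <_) (≡-sym (length-tabulate o)) (toℕ<n i)))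
      next : ∀ i j → succ? i j ≡ true → E (o i) (φ i) (φ j) ≡ true
      next i j h with succ-case {i = i} {j} h
      ... | inj₁ e = subst (λ k → E (o i) (φ i) (nth v (v ∷ vs) k) ≡ true) e (along i)
      ... | inj₂ (e , e') = subst (λ x → E (o i) (φ i) x ≡ true)
              (≡-trans (≡-trans (cong (nth v (v ∷ vs)) (≡-trans e (≡-sym len))) (nth-beyond v (v ∷ vs)))
                  (≡-sym (cong (nth v (v ∷ vs)) e'))) (along i)
      edges : ∀ i j → cycleAdj (orient ℓ≥ o) i j ≡ true → H (φ i) (φ j) ≡ true
      edges i j h with ∨-true {succ? i j ∧ o i} h
      ... | inj₁ q = let a , b = ∧-true {succ? i j} q in subst (λ d → E d (φ i) (φ j) ≡ true) b (next i j a)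
      ... | inj₂ q = let a , b = ∧-true {succ? j i} q in subst (λ d → E d (φ j) (φ i) ≡ true) (not-true b) (next j i a)

    embed-digon : (∃₂ λ u v → u ≢ v × H u v ≡ true × H v u ≡ true) → Contains H (cycleAdj digon)
    embed-digon (u , v , u≢v , p , q) = φ , inj , edges
      where
      φ : Fin 2 → V
      φ zero       = u
      φ (suc zero) = v
      inj : ∀ {i j} → φ i ≡ φ j → i ≡ j
      inj {zero}     {zero}     e = refl
      inj {zero}     {suc zero} e = ⊥-elim (u≢v e)
      inj {suc zero} {zero}     e = ⊥-elim (u≢v (≡-sym e))
      inj {suc zero} {suc zero} e = refl
      edges : ∀ i j → cycleAdj digon i j ≡ true → H (φ i) (φ j) ≡ true
      edges zero       (suc zero) e = p
      edges (suc zero) zero       e = q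
      edges (suc zero) (suc zero) ()

  #-≡single : ∀ {n} {P : Pred n} u → (∀ v → v ∈ P → v ≡ u) → u ∈ P → # P ≡ 1
  #-≡single {P = P} u only mem' = ≡-trans
      (≤-antisym (#-mono {P = P} {Q = single u} (λ v h → subst (_∈ single u) (≡-sym (only v h)) (single-∈ u)))
                                        (#-mono {P = single u} {Q = P} (λ v h →
                                            subst (_∈ P) (≡-sym (single-≡ h)) mem'))) (#-single u)

  suc≡⇒inject₁ : ∀ {k} (i : Fin k) (u : Fin (suc k)) → suc (toℕ u) ≡ toℕ (Fin.suc i) → u ≡ inject₁ i
  suc≡⇒inject₁ i u e = toℕ-injective (≡-trans (suc-injective e) (≡-sym (toℕ-inject₁ i)))

  pred-succ : ∀ {k} (i : Fin k) → succ? (inject₁ i) (suc i) ≡ true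
  pred-succ i = ∨-introˡ (≡-trans (cong (λ t → suc t ≡ᵇ suc (toℕ i)) (toℕ-inject₁ i)) (≡ᵇ-refl (toℕ i)))

  only-pred : ∀ {k} (i : Fin k) (u : Fin (suc k)) → succ? u (suc i) ≡ true → u ≡ inject₁ i
  only-pred i u h with succ-case {i = u} {suc i} h
  ... | inj₁ e = suc≡⇒inject₁ i u e

  successor : ∀ {ℓ} (v : Fin ℓ) → ∃ λ u → succ? v u ≡ true × (∀ u' → succ? v u' ≡ true → u' ≡ u)
  successor {ℓ} v with suc (toℕ v) <? ℓ
  ... | yes h = fromℕ< h , ∨-introˡ (≡-trans (cong (suc (toℕ v) ≡ᵇ_) (toℕ-fromℕ< h)) (≡ᵇ-refl (toℕ v))) , only
    where only : ∀ u' → succ? v u' ≡ true → u' ≡ fromℕ< h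
          only u' s with succ-case {i = v} {u'} s
          ... | inj₁ e = toℕ-injective (≡-trans (≡-sym e) (≡-sym (toℕ-fromℕ< h)))
          ... | inj₂ (e , _) = ⊥-elim (<-irrefl e h)
  successor {suc ℓ} v | no h = zero , ∨-introʳ {suc (toℕ v) ≡ᵇ 0}
      (∧-intro (subst (λ t → (suc (toℕ v) ≡ᵇ t) ≡ true) full≡ (≡ᵇ-refl (toℕ v))) refl) , only
    where full≡ : suc (toℕ v) ≡ suc ℓ
          full≡ = ≤-antisym (toℕ<n v) (≮⇒≥ h)
          only : ∀ u' → succ? v u' ≡ true → u' ≡ zero
          only u' s with succ-case {i = v} {u'} s
          ... | inj₁ e = ⊥-elim (<-irrefl (≡-trans (≡-sym e) full≡) (toℕ<n u'))
          ... | inj₂ (_ , e) = toℕ-injective e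

  through : ∀ {k} (ℓ≥ : 3 ≤ suc k) (o : Fin (suc k) → Bool) (i : Fin k) → o (inject₁ i) ≡ o (suc i) →
      indeg (cycleAdj (orient ℓ≥ o)) (suc i) ≡ 1
  through {k} ℓ≥ o i e = ≡-trans (sum-allFin (λ u → bit (cycleAdj (orient ℓ≥ o) u (suc i))))
      (by (o (suc i)) refl)
    where
    P : Pred (suc k)
    P u = cycleAdj (orient ℓ≥ o) u (suc i)
    by : ∀ c → o (suc i) ≡ c → # P ≡ 1
    by true c≡ = #-≡single {P = P} (inject₁ i) only (∨-introˡ (∧-intro (pred-succ i) (≡-trans e c≡)))
      where only : ∀ u → u ∈ P → u ≡ inject₁ i
            only u h with ∨-true {succ? u (suc i) ∧ o u} h
            ... | inj₁ q = only-pred i u (proj₁ (∧-true {succ? u (suc i)} q))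
            ... | inj₂ q = ⊥-elim (true≢false
                (≡-trans (≡-sym c≡) (not-true (proj₂ (∧-true {succ? (suc i) u} q)))))
    by false c≡ with successor (Fin.suc i)
    ... | s , s∈ , uniq = #-≡single {P = P} s only (∨-introʳ {succ? s (suc i) ∧ o s} (∧-intro s∈ (cong not c≡)))
      where only : ∀ u → u ∈ P → u ≡ s
            only u h with ∨-true {succ? u (suc i) ∧ o u} h
            ... | inj₂ q = uniq u (proj₁ (∧-true {succ? (suc i) u} q))
            ... | inj₁ q = let a , b = ∧-true {succ? u (suc i)} q in
                  ⊥-elim (true≢false (≡-trans (≡-sym b) (≡-trans (cong o (only-pred i u a)) (≡-trans e c≡))))

  turns-tabulate : ∀ {k} (o : Fin (suc k) → Bool) →
      turns (tabulate o) ≡ S (λ i → turn (o (inject₁ i)) (o (suc i)))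
  turns-tabulate {zero}  o = refl
  turns-tabulate {suc k} o = cong (turn (o zero) (o (suc zero)) +_) (turns-tabulate (o ∘ suc))

  turns-indeg1 : ∀ {ℓ} (ℓ≥ : 3 ≤ ℓ) (o : Fin ℓ → Bool) →
      ℓ ≤ suc (turns (tabulate o) + indeg1Count (orient ℓ≥ o))
  turns-indeg1 {suc k} ℓ≥ o = s≤s (≤-trans (≤-reflexive (≡-trans (≡-sym (*-identityʳ k)) (≡-sym (S-const k 1))))
      (≤-trans (S-mono each) (≤-trans
          (≤-reflexive (S-+ (λ i → turn (o (inject₁ i)) (o (suc i))) (λ i → f (suc i))))
        (+-mono-≤ (≤-reflexive (≡-sym (turns-tabulate o)))
            (≤-trans (m≤n+m _ (f zero)) (≤-reflexive (≡-sym (sum-allFin f))))))))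
    where
    f : Fin (suc k) → ℕ
    f v = bit (indeg (cycleAdj (orient ℓ≥ o)) v ≡ᵇ 1)
    turn-≢ : ∀ x y → x ≡ y ⊎ 1 ≤ turn x y
    turn-≢ true  true  = inj₁ refl
    turn-≢ true  false = inj₂ ≤-refl
    turn-≢ false true  = inj₂ ≤-refl
    turn-≢ false false = inj₁ refl
    each : ∀ i → 1 ≤ turn (o (inject₁ i)) (o (suc i)) + f (suc i)
    each i with turn-≢ (o (inject₁ i)) (o (suc i))
    ... | inj₂ h = ≤-trans h (m≤m+n _ _)
    ... | inj₁ e = ≤-trans (≤-reflexive (cong (λ d → bit (d ≡ᵇ 1)) (≡-sym (through ℓ≥ o i e)))) (m≤n+m _ _)

module Probability where
  open import Defs using (allVecs; allMatrices; prodℚ; sumℚ; entryWeight; weight; toAdj; Matrix)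
  open FiniteSets using (Pred; #; single; _∖_; bit; ∧-true; true≢false)
  open import Data.Bool using (Bool; true; false; _∧_; not; if_then_else_)
  open import Data.Nat as ℕ using (ℕ; zero; suc; _∸_; _≡ᵇ_)
  open import Data.List.Relation.Unary.All using (All; []; _∷_)
  open import Data.Fin using (Fin; zero; suc)
  open import Data.Fin.Properties using () renaming (_≟_ to _≟ᶠ_)
  open import Data.Vec using (Vec; []; _∷_; lookup)
  open import Data.List using (List; []; _∷_; map; concatMap; _++_; length; allFin; tabulate)
  open import Data.List.Properties using (map-tabulate)
  open import Data.Rational using (ℚ; 0ℚ; 1ℚ; _+_; _*_; _-_; -_; _≤_; nonNegative)
  open import Data.Rational.Properties
  open import Data.Product using (proj₂)
  open import Data.Empty
  open import Function using (_∘_; id)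
  open import Relation.Nullary
  open import Relation.Binary.PropositionalEquality

  *-mono : ∀ {a b} c → 0ℚ ≤ c → a ≤ b → c * a ≤ c * b
  *-mono c h = *-monoˡ-≤-nonNeg c {{nonNegative h}}

  *-monoʳ : ∀ {a b} c → 0ℚ ≤ c → a ≤ b → a * c ≤ b * c
  *-monoʳ c h = *-monoʳ-≤-nonNeg c {{nonNegative h}}

  *-nonneg : ∀ {a b} → 0ℚ ≤ a → 0ℚ ≤ b → 0ℚ ≤ a * b
  *-nonneg {a} {b} h k = ≤-trans (≤-reflexive (sym (*-zeroʳ a))) (*-mono a h k)

  sumOver : ∀ {A : Set} → List A → (A → ℚ) → ℚ
  sumOver xs g = sumℚ (map g xs)

  module _ {A : Set} where

    sum-cong : ∀ (xs : List A) {f g} → (∀ x → f x ≡ g x) → sumOver xs f ≡ sumOver xs g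
    sum-cong []       h = refl
    sum-cong (x ∷ xs) h = cong₂ _+_ (h x) (sum-cong xs h)

    sum-mono : ∀ (xs : List A) {f g} → (∀ x → f x ≤ g x) → sumOver xs f ≤ sumOver xs g
    sum-mono []       h = ≤-refl
    sum-mono (x ∷ xs) h = +-mono-≤ (h x) (sum-mono xs h)

    sum-* : ∀ (xs : List A) f c → sumOver xs (λ x → f x * c) ≡ sumOver xs f * c
    sum-* []       f c = sym (*-zeroˡ c)
    sum-* (x ∷ xs) f c = trans (cong (f x * c +_) (sum-* xs f c)) (sym (*-distribʳ-+ c (f x) (sumOver xs f)))

    sum-+ : ∀ (xs : List A) f g → sumOver xs (λ x → f x + g x) ≡ sumOver xs f + sumOver xs g
    sum-+ []       f g = sym (+-identityˡ 0ℚ)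
    sum-+ (x ∷ xs) f g = trans (cong (f x + g x +_) (sum-+ xs f g))
        (interchange (f x) (g x) (sumOver xs f) (sumOver xs g))
      where interchange : ∀ a b c d → (a + b) + (c + d) ≡ (a + c) + (b + d)
            interchange a b c d = trans (+-assoc a b (c + d))
                (trans (cong (a +_) (trans (sym (+-assoc b c d))
                (trans (cong (_+ d) (+-comm b c)) (+-assoc c b d)))) (sym (+-assoc a c (b + d))))

    sum-++ : ∀ (xs ys : List A) f → sumOver (xs ++ ys) f ≡ sumOver xs f + sumOver ys f
    sum-++ []       ys f = sym (+-identityˡ _)
    sum-++ (x ∷ xs) ys f = trans (cong (f x +_) (sum-++ xs ys f)) (sym (+-assoc (f x) _ _))

  sum-map : ∀ {A B : Set} (h : A → B) xs (f : B → ℚ) → sumOver (map h xs) f ≡ sumOver xs (f ∘ h)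
  sum-map h []       f = refl
  sum-map h (x ∷ xs) f = cong (f (h x) +_) (sum-map h xs f)

  sum-allVecs : ∀ {A : Set} (xs : List A) k (f : Vec A (suc k) → ℚ) →
                sumOver (allVecs xs (suc k)) f ≡ sumOver xs (λ x → sumOver (allVecs xs k) (λ M → f (x ∷ M)))
  sum-allVecs {A} xs k f = go xs
    where go : ∀ ys → sumOver (concatMap (λ x → map (x ∷_) (allVecs xs k)) ys) f ≡ sumOver ys (λ x → sumOver (allVecs xs k) (λ M → f (x ∷ M)))
          go []       = refl
          go (y ∷ ys) = trans (sum-++ (map (y ∷_) (allVecs xs k)) _ f)
              (cong₂ _+_ (sum-map (y ∷_) (allVecs xs k) f) (go ys))

  vecWeight : ∀ {A : Set} {k} → (Fin k → A → ℚ) → Vec A k → ℚ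
  vecWeight w []      = 1ℚ
  vecWeight w (x ∷ M) = w zero x * vecWeight (w ∘ suc) M

  total-mass : ∀ {A : Set} (xs : List A) k (w : Fin k → A → ℚ) →
      (∀ i → sumOver xs (w i) ≡ 1ℚ) → sumOver (allVecs xs k) (vecWeight w) ≡ 1ℚ
  total-mass xs zero    w h = refl
  total-mass xs (suc k) w h = trans (sum-allVecs xs k (vecWeight w))
    (trans (sum-cong xs (λ x → trans (sum-cong (allVecs xs k) (λ M → *-comm (w zero x) _))
      (trans (sum-* (allVecs xs k) (vecWeight (w ∘ suc)) (w zero x))
          (trans (cong (_* w zero x) (total-mass xs k (w ∘ suc) (h ∘ suc))) (*-identityˡ (w zero x))))))
      (h zero))

  when : Bool → ℚ → ℚ
  when b q = if b then q else 0ℚ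

  when-∧ : ∀ a b x y → when (a ∧ b) (x * y) ≡ when a x * when b y
  when-∧ true  true  x y = refl
  when-∧ true  false x y = sym (*-zeroʳ x)
  when-∧ false b     x y = sym (*-zeroˡ (when b y))

  pow : ℚ → ℕ → ℚ
  pow c zero    = 1ℚ
  pow c (suc k) = c * pow c k

  module _ {c : ℚ} (c≥0 : 0ℚ ≤ c) (c≤1 : c ≤ 1ℚ) where

    pow≥0 : ∀ k → 0ℚ ≤ pow c k
    pow≥0 zero    = nonNegative⁻¹ 1ℚ
    pow≥0 (suc k) = *-nonneg c≥0 (pow≥0 k)

    pow≤1 : ∀ k → pow c k ≤ 1ℚ
    pow≤1 zero    = ≤-refl
    pow≤1 (suc k) = ≤-trans (*-mono c c≥0 (pow≤1 k)) (≤-trans (≤-reflexive (*-identityʳ c)) c≤1)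

    pow-∸ : ∀ i j → pow c i * pow c (j ∸ i) ≤ pow c j
    pow-∸ zero    j       = ≤-reflexive (*-identityˡ (pow c j))
    pow-∸ (suc i) zero    = ≤-trans (≤-reflexive (*-identityʳ (pow c (suc i)))) (pow≤1 (suc i))
    pow-∸ (suc i) (suc j) = ≤-trans (≤-reflexive (*-assoc c (pow c i) (pow c (j ∸ i))))
        (*-mono c c≥0 (pow-∸ i j))

  bools : List Bool
  bools = true ∷ false ∷ []

  avoids : ∀ {k} → Pred k → Vec Bool k → Bool
  avoids F []      = true
  avoids F (b ∷ x) = not (F zero ∧ b) ∧ avoids (F ∘ suc) x

  prob-avoids : ∀ {k} (F : Pred k) (e : Fin k → Bool → ℚ) c → 0ℚ ≤ c →
    (∀ v → e v true + e v false ≡ 1ℚ) → (∀ v → F v ≡ true → e v false ≤ c) → (∀ v → 0ℚ ≤ e v false) →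
    sumOver (allVecs bools k) (λ x → when (avoids F x) (vecWeight e x)) ≤ pow c (# F)
  prob-avoids {zero}  F e c c≥0 mass hit pos = ≤-reflexive (+-identityʳ 1ℚ)
  prob-avoids {suc k} F e c c≥0 mass hit pos =
    ≤-trans (≤-reflexive (trans (sum-allVecs bools k (λ x → when (avoids F x) (vecWeight e x)))
       (trans (sum-cong bools (λ b → trans
           (sum-cong (allVecs bools k) (λ M →
           trans (when-∧ (not (F zero ∧ b)) (avoids (F ∘ suc) M) (e zero b) (vecWeight (e ∘ suc) M))
           (*-comm (when (not (F zero ∧ b)) (e zero b)) _)))
         (sum-* (allVecs bools k) (λ M → when (avoids (F ∘ suc) M) (vecWeight (e ∘ suc) M))
             (when (not (F zero ∧ b)) (e zero b)))))
        (two rest (when (not (F zero ∧ true)) (e zero true)) (when (not (F zero ∧ false)) (e zero false))))))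
      (by (F zero) refl)
    where
    rest = sumOver (allVecs bools k) (λ M → when (avoids (F ∘ suc) M) (vecWeight (e ∘ suc) M))
    ih : rest ≤ pow c (# (F ∘ suc))
    ih = prob-avoids (F ∘ suc) (e ∘ suc) c c≥0 (mass ∘ suc) (λ v → hit (suc v)) (pos ∘ suc)
    two : ∀ r x y → r * x + (r * y + 0ℚ) ≡ (x + y) * r
    two r x y = trans (cong (r * x +_) (+-identityʳ (r * y)))
        (trans (sym (*-distribˡ-+ r x y)) (*-comm r (x + y)))
    by : ∀ b → F zero ≡ b → (when (not (b ∧ true)) (e zero true) + when (not (b ∧ false)) (e zero false)) * rest
        ≤ pow c (bit b ℕ.+ # (F ∘ suc))
    by false eq = ≤-trans (≤-reflexive (trans (cong (_* rest) (mass zero)) (*-identityˡ rest))) ih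
    by true  eq = ≤-trans (≤-reflexive (cong (_* rest) (+-identityˡ (e zero false))))
      (≤-trans (*-mono (e zero false) (pos zero) ih)
          (*-monoʳ (pow c (# (F ∘ suc))) (pow-nonneg (# (F ∘ suc))) (hit zero eq)))
      where pow-nonneg : ∀ k → 0ℚ ≤ pow c k
            pow-nonneg zero    = nonNegative⁻¹ 1ℚ
            pow-nonneg (suc k) = *-nonneg c≥0 (pow-nonneg k)

  times : ℕ → ℚ → ℚ
  times zero    δ = 0ℚ
  times (suc k) δ = δ + times k δ

  -- A query asks whether the present row misses a set that may depend on the earlier rows.
  data Queries (n : ℕ) : ℕ → Set where
    done : Queries n 0
    ask  : ∀ {k} → Pred n → (Vec Bool n → Queries n k) → Queries n (suc k)

  module _ {n : ℕ} where

    off : ∀ {k} → (Fin (suc k) → Fin n) → Pred n → Pred n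
    off ι F = F ∖ single (ι zero)

    -- Every query succeeds, and at least j positions are queried in total; the diagonal is never queried.
    escapes : ∀ {k} → (Fin k → Fin n) → Queries n k → Vec (Vec Bool n) k → ℕ → Bool
    escapes ι done         []      j = j ≡ᵇ 0
    escapes ι (ask F next) (x ∷ M) j = avoids (off ι F) x ∧ escapes (ι ∘ suc) (next x) M (j ∸ # (off ι F))

    none : List (Matrix n → Bool) → Matrix n → Bool
    none []       M = true
    none (b ∷ bs) M = not (b M) ∧ none bs M

    module _ (p : ℚ) (p≥0 : 0ℚ ≤ p) (c≥0 : 0ℚ ≤ 1ℚ - p) (c≤1 : 1ℚ - p ≤ 1ℚ) where

      c : ℚ
      c = 1ℚ - p

      rowWeight : Fin n → Vec Bool n → ℚ
      rowWeight u = vecWeight (entryWeight p u)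

      entry-mass : ∀ (u v : Fin n) → entryWeight p u v true + entryWeight p u v false ≡ 1ℚ
      entry-mass u v with u ≟ᶠ v
      ... | yes _ = +-identityˡ 1ℚ
      ... | no _  = trans (+-comm p (1ℚ - p))
          (trans (+-assoc 1ℚ (- p) p) (trans (cong (1ℚ +_) (+-inverseˡ p)) (+-identityʳ 1ℚ)))

      entry-off : ∀ (u v : Fin n) → u ≢ v → entryWeight p u v false ≤ c
      entry-off u v h with u ≟ᶠ v
      ... | yes e = ⊥-elim (h e)
      ... | no _  = ≤-refl

      entry-pos : ∀ (u v : Fin n) → 0ℚ ≤ entryWeight p u v false
      entry-pos u v with u ≟ᶠ v
      ... | yes _ = nonNegative⁻¹ 1ℚ
      ... | no _  = c≥0

      entry-posᵗ : ∀ (u v : Fin n) → 0ℚ ≤ entryWeight p u v true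
      entry-posᵗ u v with u ≟ᶠ v
      ... | yes _ = ≤-refl
      ... | no _  = p≥0

      vecWeight≥0 : ∀ {A : Set} {k} (w : Fin k → A → ℚ) → (∀ i x → 0ℚ ≤ w i x) → ∀ M → 0ℚ ≤ vecWeight w M
      vecWeight≥0 w h []      = nonNegative⁻¹ 1ℚ
      vecWeight≥0 w h (x ∷ M) = *-nonneg (h zero x) (vecWeight≥0 (w ∘ suc) (h ∘ suc) M)

      rowWeight≥0 : ∀ u x → 0ℚ ≤ rowWeight u x
      rowWeight≥0 u = vecWeight≥0 (entryWeight p u) (λ { v true → entry-posᵗ u v ; v false → entry-pos u v })

      rowWeight-mass : ∀ u → sumOver (allVecs bools n) (rowWeight u) ≡ 1ℚ
      rowWeight-mass u = total-mass bools n (entryWeight p u) (λ v →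
          trans (cong (entryWeight p u v true +_) (+-identityʳ _)) (entry-mass u v))

      prob-row : ∀ u (F : Pred n) → sumOver (allVecs bools n) (λ x →
          when (avoids (F ∖ single u) x) (rowWeight u x)) ≤ pow c (# (F ∖ single u))
      prob-row u F = prob-avoids (F ∖ single u) (entryWeight p u) c c≥0 (entry-mass u) (λ v h →
          entry-off u v (λ { refl → off-diag h })) (entry-pos u)
        where off-diag : ¬ ((F ∖ single u) u ≡ true)
              off-diag h with u ≟ᶠ u
              ... | yes _ = true≢false (sym (proj₂ (∧-true {F u} h)))
              ... | no k  = k refl

      rows : List (Vec Bool n)
      rows = allVecs bools n

      when≥0 : ∀ b {x} → 0ℚ ≤ x → 0ℚ ≤ when b x
      when≥0 true  h = h
      when≥0 false h = ≤-refl

      prob-escapes : ∀ {k} (ι : Fin k → Fin n) (σ : Queries n k) j →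
        sumOver (allVecs rows k) (λ M → when (escapes ι σ M j) (vecWeight (rowWeight ∘ ι) M)) ≤ pow c j
      prob-escapes ι done zero    = ≤-reflexive (+-identityʳ 1ℚ)
      prob-escapes ι done (suc j) = ≤-trans (≤-reflexive (+-identityʳ 0ℚ)) (pow≥0 c≥0 c≤1 (suc j))
      prob-escapes {suc k} ι (ask F next) j = ≤-trans
        (≤-reflexive (trans (sum-allVecs rows k (λ M →
            when (escapes ι (ask F next) M j) (vecWeight (rowWeight ∘ ι) M)))
          (sum-cong rows (λ x → trans (sum-cong (allVecs rows k) (λ M →
              trans (when-∧ (avoids F' x) (escapes (ι ∘ suc) (next x) M j') (rowWeight (ι zero) x)
              (vecWeight (rowWeight ∘ ι ∘ suc) M)) (*-comm (when (avoids F' x) (rowWeight (ι zero) x)) _)))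
            (sum-* (allVecs rows k) (λ M → when (escapes (ι ∘ suc) (next x) M j')
                (vecWeight (rowWeight ∘ ι ∘ suc) M)) (when (avoids F' x) (rowWeight (ι zero) x)))))))
        (≤-trans (sum-mono rows (λ x → *-monoʳ (when (avoids F' x) (rowWeight (ι zero) x))
            (when≥0 (avoids F' x) (rowWeight≥0 (ι zero) x)) (prob-escapes (ι ∘ suc) (next x) j')))
        (≤-trans (≤-reflexive (trans (sum-cong rows (λ x →
            *-comm (pow c j') (when (avoids F' x) (rowWeight (ι zero) x))))
            (sum-* rows (λ x → when (avoids F' x) (rowWeight (ι zero) x)) (pow c j'))))
        (≤-trans (*-monoʳ (pow c j') (pow≥0 c≥0 c≤1 j') (prob-row (ι zero) F)) (pow-∸ c≥0 c≤1 (# F') j))))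
        where
        F' = off ι F
        j' = j ∸ # F'

      prod-++ : ∀ xs ys → prodℚ (xs ++ ys) ≡ prodℚ xs * prodℚ ys
      prod-++ []       ys = sym (*-identityˡ _)
      prod-++ (x ∷ xs) ys = trans (cong (x *_) (prod-++ xs ys)) (sym (*-assoc x (prodℚ xs) (prodℚ ys)))

      prod-tabulate : ∀ {k} (w : Fin k → Bool → ℚ) (x : Vec Bool k) →
          prodℚ (tabulate (λ v → w v (lookup x v))) ≡ vecWeight w x
      prod-tabulate w []      = refl
      prod-tabulate w (b ∷ x) = cong (w zero b *_) (prod-tabulate (w ∘ suc) x)

      prod-concat : ∀ {k} (ι : Fin k → Fin n) (M : Vec (Vec Bool n) k) (g : Fin k → List ℚ) →
          (∀ i → prodℚ (g i) ≡ rowWeight (ι i) (lookup M i)) →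
        prodℚ (concatMap g (allFin k)) ≡ vecWeight (rowWeight ∘ ι) M
      prod-concat {k} ι M g h = go id M (λ i → h i)
        where
        go : ∀ {l} (f : Fin l → Fin k) (N : Vec (Vec Bool n) l) →
            (∀ i → prodℚ (g (f i)) ≡ rowWeight (ι (f i)) (lookup N i)) →
             prodℚ (concatMap g (tabulate f)) ≡ vecWeight (rowWeight ∘ ι ∘ f) N
        go f []      h = refl
        go f (x ∷ N) h = trans (prod-++ (g (f zero)) _) (cong₂ _*_ (h zero) (go (f ∘ suc) N (h ∘ suc)))

      weight≡ : ∀ M → weight p M ≡ vecWeight rowWeight M
      weight≡ M = prod-concat id M _ (λ u →
          trans (cong prodℚ (map-tabulate id (λ v → entryWeight p u v (toAdj M u v))))
          (prod-tabulate (entryWeight p u) (lookup M u)))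

      weight≥0 : ∀ M → 0ℚ ≤ weight p M
      weight≥0 M = ≤-trans (vecWeight≥0 rowWeight rowWeight≥0 M) (≤-reflexive (sym (weight≡ M)))

      mass : sumOver (allMatrices n) (weight p) ≡ 1ℚ
      mass = trans (sum-cong (allMatrices n) weight≡) (total-mass rows n rowWeight rowWeight-mass)

      union-bound : ∀ δ (bs : List (Matrix n → Bool)) →
          All (λ b → sumOver (allMatrices n) (λ M → when (b M) (weight p M)) ≤ δ) bs →
        1ℚ ≤ sumOver (allMatrices n) (λ M → when (none bs M) (weight p M)) + times (length bs) δ
      union-bound δ []       []       = ≤-reflexive (sym (trans (+-identityʳ _) mass))
      union-bound δ (b ∷ bs) (h ∷ hs) = ≤-trans (union-bound δ bs hs)
          (≤-trans (+-monoˡ-≤ (times (length bs) δ) splits)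
          (≤-reflexive (+-assoc (sumOver (allMatrices n) (λ M → when (none (b ∷ bs) M) (weight p M))) δ
              (times (length bs) δ))))
        where
        cases : ∀ x y {w} → 0ℚ ≤ w → when y w ≤ when (not x ∧ y) w + when x w
        cases true  true  {w} h = ≤-reflexive (sym (+-identityˡ w))
        cases true  false {w} h = ≤-trans h (≤-reflexive (sym (+-identityˡ w)))
        cases false y     {w} h = ≤-reflexive (sym (+-identityʳ (when y w)))
        splits : sumOver (allMatrices n) (λ M → when (none bs M) (weight p M)) ≤ sumOver (allMatrices n) (λ M →
            when (none (b ∷ bs) M) (weight p M)) + δ
        splits = ≤-trans (sum-mono (allMatrices n) (λ M → cases (b M) (none bs M) (weight≥0 M)))
          (≤-trans (≤-reflexive (sum-+ (allMatrices n) (λ M → when (none (b ∷ bs) M) (weight p M)) (λ M →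
              when (b M) (weight p M))))
            (+-monoʳ-≤ (sumOver (allMatrices n) (λ M → when (none (b ∷ bs) M) (weight p M))) h))

      prob-query : ∀ (σ : Queries n n) j →
          sumOver (allMatrices n) (λ M → when (escapes id σ M j) (weight p M)) ≤ pow c j
      prob-query σ j = ≤-trans (≤-reflexive
          (sum-cong (allMatrices n) (λ M → cong (when (escapes id σ M j)) (weight≡ M)))) (prob-escapes id σ j)

module Parameters where
  open Arithmetic
  open FiniteSets
  open Paths
  open Construction
  open import Data.Bool using (Bool; true; false)
  open import Data.Nat
  open import Data.Nat.Properties
  open import Data.Nat.Tactic.RingSolver using (solve-∀)
  open import Data.Fin using (Fin)
  open import Data.List using ([]; _∷_; tabulate; length; List; map; concatMap)
  open import Data.List.Properties using (length-tabulate; length-++; length-map)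
  open import Data.Product using (_×_; _,_; proj₁; proj₂; ∃; ∃₂)
  open import Data.Empty
  open import Relation.Nullary
  open import Relation.Binary.PropositionalEquality
  open import Defs using (CycleOrientation; digon; orient; cycleAdj; indeg1Count; Contains; allVecs)
  open import Data.Vec using (_∷_)
  open Probability using (bools)

  blocksNeeded : ℕ → ℕ → ℕ
  blocksNeeded m q = 8 * m * suc q + 2 * m

  module Deterministic {n} (H : Fin n → Fin n → Bool) (m : ℕ) (1≤m : 1 ≤ m) (hf : Walks.HoleFree H m)
      (loopless : ∀ v → H v v ≡ false)
      (τ : Fin n → Bool) (a : ℕ) (1≤a : 1 ≤ a) (deg : ∀ v → n ≤ a * # (Walks.E H (τ v) v))
      (b' : ℕ) (b≡ : 16 * a * a ≡ suc b') (q : ℕ) (decay : b' ^ q * n < suc b' ^ q * m)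
      (h₁ : 4 * suc b' * (16 + 8 * a) * m ≤ n) (h₂ : 28 * suc b' ≤ n) (room : 2 * a * (6 * m + 2) < n)
      (e : ℕ) (1≤e : 1 ≤ e) (win : e * (8 * (12 * suc b' * suc (blocksNeeded m q)) + 8 * m + 1) ≤ n)
      (tri : ∃ λ u → ∃₂ λ v w → H u v ≡ true × H v w ≡ true × H w u ≡ true)
      (dig : ∃₂ λ u v → u ≢ v × H u v ≡ true × H v u ≡ true) where
    open Embedding H

    contains : ∀ ℓ → ℓ ≤ n → (K : CycleOrientation ℓ) → indeg1Count K * e + n ≤ e * n → Contains H (cycleAdj K)
    contains .2 ℓ≤n digon few = embed-digon dig
    contains ℓ ℓ≤n (orient ℓ≥ o) few = embed ℓ≥ o cycle
      where
      len : length (tabulate o) ≡ ℓ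
      len = length-tabulate o
      cycle : Cycle H (tabulate o)
      cycle with ℓ + 8 * m ≤? n
      ... | yes h = Small.small H m 1≤m hf loopless τ a 1≤a deg room tri (tabulate o)
          (subst (3 ≤_) (sym len) ℓ≥) (subst (λ t → t + 8 * m ≤ n) (sym len) h)
      ... | no h  = Large.large H m 1≤m hf τ a 1≤a deg b' b≡ q decay h₁ h₂ (tabulate o)
          (subst (_≤ n) (sym len) ℓ≤n)
                      (enough-turns e n ℓ (turns (tabulate o)) (indeg1Count (orient ℓ≥ o)) _ (8 * m)
                          (<⇒≤ (≰⇒> h)) (turns-indeg1 ℓ≥ o) few win 1≤e)

  -- (1 + 1/x)^k ≥ 1 + k/x, cleared of denominators.
  bernoulli : ∀ x k → x ^ k * (x + k) ≤ x * suc x ^ k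
  bernoulli x zero    = ≤-reflexive (eq x)
    where eq : ∀ x → 1 * (x + 0) ≡ x * 1
          eq = solve-∀
  bernoulli x (suc k) = ≤-trans (lin 0 (z≤n {x ^ k * k}) (eq₁ x (x ^ k) k))
      (≤-trans (*-monoʳ-≤ (suc x) (bernoulli x k)) (≤-reflexive (eq₂ x (suc x ^ k))))
    where eq₁ : ∀ x y k → x * y * (x + suc k) + y * k + 0 ≡ suc x * (y * (x + k)) + 0
          eq₁ = solve-∀
          eq₂ : ∀ x z → suc x * (x * z) ≡ x * (suc x * z)
          eq₂ = solve-∀

  double : ∀ x → 1 ≤ x → 2 * x ^ x ≤ suc x ^ x
  double x x≥1 = *-cancelˡ-≤ x {{>-nonZero x≥1}} (≤-trans (≤-reflexive (eq x (x ^ x))) (bernoulli x x))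
    where eq : ∀ x y → x * (2 * y) ≡ y * (x + x)
          eq = solve-∀

  ^-* : ∀ x y k → (x * y) ^ k ≡ x ^ k * y ^ k
  ^-* x y zero    = refl
  ^-* x y (suc k) = trans (cong (x * y *_) (^-* x y k)) (eq x y (x ^ k) (y ^ k))
    where eq : ∀ x y u v → x * y * (u * v) ≡ x * u * (y * v)
          eq = solve-∀

  double^ : ∀ x j → 1 ≤ x → 2 ^ j * x ^ (x * j) ≤ suc x ^ (x * j)
  double^ x j x≥1 = ≤-trans (≤-reflexive
      (trans (cong (2 ^ j *_) (sym (^-*-assoc x x j))) (sym (^-* 2 (x ^ x) j))))
                      (≤-trans (^-monoˡ-≤ j (double x x≥1)) (≤-reflexive (^-*-assoc (suc x) x j)))

  n≤2^n : ∀ n → n ≤ 2 ^ n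
  n≤2^n zero    = z≤n
  n≤2^n (suc n) = ≤-trans (+-mono-≤ (m^n>0 2 n) (n≤2^n n))
      (≤-reflexive (cong (2 ^ n +_) (sym (+-identityʳ (2 ^ n)))))

  -- For j = 2i and i = 2c₁ + c₂ one has 2^j ≥ (i + 1)(2c₁ + c₂).
  beats-linear : ∀ c₁ c₂ → ∃ λ j → c₁ * j + c₂ ≤ 2 ^ j
  beats-linear c₁ c₂ = i + i , ≤-trans (lin (i * c₂ + 2 * c₁) (z≤n {0}) (eq c₁ c₂ i))
      (≤-trans (*-mono-≤ (n≤2^n' i) (n≤2^n i)) (≤-reflexive (sym (^-distribˡ-+-* 2 i i))))
    where
    i = 2 * c₁ + c₂
    n≤2^n' : ∀ n → suc n ≤ 2 ^ n
    n≤2^n' zero    = ≤-refl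
    n≤2^n' (suc n) = ≤-trans (s≤s (n≤2^n' n))
        (≤-trans (+-monoˡ-≤ (2 ^ n) (m^n>0 2 n)) (≤-reflexive (cong (2 ^ n +_) (sym (+-identityʳ (2 ^ n))))))
    eq : ∀ c₁ c₂ i → c₁ * (i + i) + c₂ + 0 + (i * c₂ + 2 * c₁) ≡ suc i * (2 * c₁ + c₂) + 0
    eq = solve-∀

  record Params (a e : ℕ) : Set where
    field
      b' q T : ℕ
      b≡  : 16 * a * a ≡ suc b'
      1≤T : 1 ≤ T
      holds : ∀ n m → 1 ≤ m → m * T ≤ n → n < suc m * T → 28 * suc b' ≤ n →
        b' ^ q * n < suc b' ^ q * m × 4 * suc b' * (16 + 8 * a) * m ≤ n × 2 * a * (6 * m + 2) < n ×
        e * (8 * (12 * suc b' * suc (blocksNeeded m q)) + 8 * m + 1) ≤ n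

  params₀ : ∀ a e → 1 ≤ a → 1 ≤ e → Params a e
  params₀ a e a≥1 e≥1 = record { b' = b' ; q = q ; T = T ; b≡ = b≡ ; 1≤T = m^n>0 2 j ; holds = holds }
    where
    b' = pred (16 * a * a)
    b = suc b'
    16aa≥2 : 2 ≤ 16 * a * a
    16aa≥2 = ≤-trans (s≤s (s≤s z≤n)) (*-mono-≤ (*-monoʳ-≤ 16 a≥1) a≥1)
    b≡ : 16 * a * a ≡ suc b'
    b≡ = sym (suc-pred (16 * a * a) {{>-nonZero (≤-trans (s≤s z≤n) 16aa≥2)}})
    b'≥1 : 1 ≤ b'
    b'≥1 = ≤-pred (≤-trans 16aa≥2 (≤-reflexive b≡))
    c₁ = e * (96 * b * (8 * b'))
    c₂ = e * (96 * b * (8 * (b' * 2) + 11) + 9) + 4 * b * (16 + 8 * a) + (16 * a + 1)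
    bl = beats-linear c₁ c₂
    j = proj₁ bl
    T = 2 ^ j
    q = b' * (2 + j)
    big : e * (96 * b * (8 * q + 11) + 9) + 4 * b * (16 + 8 * a) + (16 * a + 1) ≤ T
    big = ≤-trans (≤-reflexive (eq e b b' a j)) (proj₂ bl)
      where eq : ∀ e b b' a j → e * (96 * b * (8 * (b' * (2 + j)) + 11) + 9) + 4 * b * (16 + 8 * a) + (16 * a + 1)
                   ≡ e * (96 * b * (8 * b')) * j +
                       (e * (96 * b * (8 * (b' * 2) + 11) + 9) + 4 * b * (16 + 8 * a) + (16 * a + 1))
            eq = solve-∀
    holds : ∀ n m → 1 ≤ m → m * T ≤ n → n < suc m * T → 28 * suc b' ≤ n →
        b' ^ q * n < suc b' ^ q * m × 4 * suc b' * (16 + 8 * a) * m ≤ n × 2 * a * (6 * m + 2) < n ×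
        e * (8 * (12 * suc b' * suc (blocksNeeded m q)) + 8 * m + 1) ≤ n
    holds n m m≥1 mT≤n n<T _ = decay , h₁ , room , win
      where
      n<2mT : n < 2 * m * T
      n<2mT = ≤-trans n<T (*-monoˡ-≤ T
          (≤-trans (+-monoˡ-≤ m m≥1) (≤-reflexive (cong (m +_) (sym (+-identityʳ m))))))
      decay : b' ^ q * n < suc b' ^ q * m
      decay = ≤-trans (*-monoʳ-< (b' ^ q) {{>-nonZero (≤-trans (m^n>0 b' {{>-nonZero b'≥1}} q) ≤-refl)}} n<2mT)
        (≤-trans (≤-reflexive (eq (b' ^ q) m T))
            (*-monoˡ-≤ m (≤-trans (*-monoˡ-≤ (b' ^ q) (*-monoʳ-≤ 2 (m≤n*m T 2))) (double^ b' (2 + j) b'≥1))))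
        where eq : ∀ x m T → x * (2 * m * T) ≡ 2 * T * x * m
              eq = solve-∀
      h₁ : 4 * suc b' * (16 + 8 * a) * m ≤ n
      h₁ = ≤-trans (*-monoˡ-≤ m (≤-trans
          (≤-trans (m≤n+m _ (e * (96 * b * (8 * q + 11) + 9))) (m≤m+n _ (16 * a + 1))) big))
          (≤-trans (≤-reflexive (*-comm T m)) mT≤n)
      room : 2 * a * (6 * m + 2) < n
      room = ≤-trans (lin 0 (scale (1 + 4 * a) m≥1) (eq a m))
          (≤-trans (*-monoˡ-≤ m (≤-trans (m≤n+m _ (e * (96 * b * (8 * q + 11) + 9) + 4 * b * (16 + 8 * a)))
          big)) (≤-trans (≤-reflexive (*-comm T m)) mT≤n))
        where eq : ∀ a m → suc (2 * a * (6 * m + 2)) + (1 + 4 * a) * m + 0 ≡ (16 * a + 1) * m + (1 + 4 * a) * 1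
              eq = solve-∀
      win : e * (8 * (12 * suc b' * suc (blocksNeeded m q)) + 8 * m + 1) ≤ n
      win = ≤-trans (*-monoʳ-≤ e (lin 0 (scale (96 * b + 1) m≥1) (eq b q m)))
          (≤-trans (≤-reflexive (sym (*-assoc e (96 * b * (8 * q + 11) + 9) m)))
             (≤-trans (*-monoˡ-≤ m (≤-trans (≤-trans
                 (m≤m+n (e * (96 * b * (8 * q + 11) + 9)) (4 * b * (16 + 8 * a))) (m≤m+n _ (16 * a + 1))) big))
                 (≤-trans (≤-reflexive (*-comm T m)) mT≤n)))
        where eq : ∀ b q m → 8 * (12 * b * suc (8 * m * suc q + 2 * m)) + 8 * m + 1 + (96 * b + 1) * m + 0 ≡ (96 * b * (8 * q + 11) + 9) * m + (96 * b + 1) * 1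
              eq = solve-∀

  abstract
    params : ∀ a e → 1 ≤ a → 1 ≤ e → Params a e
    params = params₀

  -- 1 - C/n ≤ (1 - 1/n)^C with n = x + 1 and r = n - C.
  bernoulli-C : ∀ x C r → r + C ≡ suc x → r * suc x ^ C ≤ suc x * x ^ C
  bernoulli-C x zero    r e = ≤-reflexive (cong (_* 1) (trans (sym (+-identityʳ r)) e))
  bernoulli-C x (suc C) r e = ≤-trans (≤-reflexive (eq₁ r (suc x) (suc x ^ C)))
     (≤-trans (*-monoˡ-≤ (suc x ^ C) step)
     (≤-trans (≤-reflexive (*-assoc x (suc r) (suc x ^ C)))
     (≤-trans (*-monoʳ-≤ x (bernoulli-C x C (suc r) (trans (sym (+-suc r C)) e)))
         (≤-reflexive (eq₂ x (suc x) (x ^ C))))))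
    where
    eq₁ : ∀ r s y → r * (s * y) ≡ s * r * y
    eq₁ = solve-∀
    eq₂ : ∀ x s y → x * (s * y) ≡ s * (x * y)
    eq₂ = solve-∀
    r≤x : r ≤ x
    r≤x = ≤-trans (m≤m+n r C) (≤-reflexive (suc-injective (trans (sym (+-suc r C)) e)))
    step : suc x * r ≤ x * suc r
    step = ≤-trans (+-monoˡ-≤ (x * r) r≤x) (≤-reflexive (sym (*-suc x r)))

  ^-cancel-≤ : ∀ k {x y} → 1 ≤ k → x ^ k ≤ y ^ k → x ≤ y
  ^-cancel-≤ k {x} {y} k≥1 h with x ≤? y
  ... | yes p = p
  ... | no ¬p = ⊥-elim (<-irrefl refl (≤-trans (^-monoˡ-< k {{>-nonZero k≥1}} (≰⇒> ¬p)) h))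

  -- (1 - C/n)^n ≤ 2^(-C), with n and r as before.
  decay-n : ∀ x C r → 1 ≤ x → r + C ≡ suc x → r ^ suc x * 2 ^ C ≤ suc x ^ suc x
  decay-n x C r x≥1 e = *-cancelʳ-≤ _ _ (n ^ (C * n)) {{m^n≢0 n (C * n)}}
      (≤-trans (≤-reflexive (eq₁ (r ^ n) (2 ^ C) (n ^ (C * n))))
      (≤-trans (*-monoˡ-≤ (2 ^ C) lhs) (≤-trans (≤-reflexive (eq₂ (n ^ n) (x ^ (C * n)) (2 ^ C)))
          (*-monoʳ-≤ (n ^ n) rhs))))
    where
    n = suc x
    eq₁ : ∀ a b c → a * b * c ≡ a * c * b
    eq₁ = solve-∀
    eq₂ : ∀ a b c → a * b * c ≡ a * (c * b)
    eq₂ = solve-∀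
    lhs : r ^ n * n ^ (C * n) ≤ n ^ n * x ^ (C * n)
    lhs = ≤-trans (≤-reflexive (trans (cong (r ^ n *_) (sym (^-*-assoc n C n))) (sym (^-* r (n ^ C) n))))
          (≤-trans (^-monoˡ-≤ n (bernoulli-C x C r e))
              (≤-reflexive (trans (^-* n (x ^ C) n) (cong (n ^ n *_) (^-*-assoc x C n)))))
    half : 2 * x ^ n ≤ n ^ n
    half = ≤-trans (≤-reflexive (eq x (x ^ x))) (*-mono-≤ (n≤1+n x) (double x x≥1))
      where eq : ∀ x y → 2 * (x * y) ≡ x * (2 * y)
            eq = solve-∀
    rhs : 2 ^ C * x ^ (C * n) ≤ n ^ (C * n)
    rhs = ≤-trans (≤-reflexive (trans
        (cong (2 ^ C *_) (trans (cong (x ^_) (*-comm C n)) (sym (^-*-assoc x n C)))) (sym (^-* 2 (x ^ n) C))))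
          (≤-trans (^-monoˡ-≤ C half) (≤-reflexive (trans (^-*-assoc n n C) (cong (n ^_) (*-comm n C)))))

  decay-j : ∀ x Q j r → 1 ≤ x → 1 ≤ Q → r + 4 * Q ≡ suc x → suc x * suc x ≤ j * Q →
      r ^ j * 2 ^ (4 * suc x) ≤ suc x ^ j
  decay-j x Q j r x≥1 Q≥1 e h = ^-cancel-≤ Q Q≥1
      (≤-trans (≤-reflexive left) (≤-trans (*-monoʳ-≤ (r ^ d) inner)
      (≤-trans (*-monoˡ-≤ _ (^-monoˡ-≤ d r≤n)) (≤-reflexive right))))
    where
    n = suc x
    d = j * Q ∸ n * n
    split : d + n * n ≡ j * Q
    split = m∸n+n≡m h
    r≤n : r ≤ n
    r≤n = ≤-trans (m≤m+n r (4 * Q)) (≤-reflexive e)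
    inner : r ^ (n * n) * 2 ^ (4 * Q * n) ≤ n ^ (n * n)
    inner = ≤-trans (≤-reflexive (trans (cong₂ _*_ (sym (^-*-assoc r n n)) (sym (^-*-assoc 2 (4 * Q) n)))
        (sym (^-* (r ^ n) (2 ^ (4 * Q)) n))))
            (≤-trans (^-monoˡ-≤ n (decay-n x (4 * Q) r x≥1 e)) (≤-reflexive (^-*-assoc n n n)))
    left : (r ^ j * 2 ^ (4 * n)) ^ Q ≡ r ^ d * (r ^ (n * n) * 2 ^ (4 * Q * n))
    left = trans (^-* (r ^ j) (2 ^ (4 * n)) Q)
        (trans (cong₂ _*_ (trans (^-*-assoc r j Q)
        (trans (cong (r ^_) (sym split)) (^-distribˡ-+-* r d (n * n))))
             (trans (^-*-assoc 2 (4 * n) Q) (cong (2 ^_) (eq n Q)))) (*-assoc (r ^ d) (r ^ (n * n)) _))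
      where eq : ∀ n Q → 4 * n * Q ≡ 4 * Q * n
            eq = solve-∀
    right : n ^ d * n ^ (n * n) ≡ (n ^ j) ^ Q
    right = trans (sym (^-distribˡ-+-* n d (n * n))) (trans (cong (n ^_) split) (sym (^-*-assoc n j Q)))

  threshold-large : ∀ n m T → 2 ≤ m → n < suc m * T → n * n ≤ m * (m ∸ 1) * (8 * (T * T))
  threshold-large n (suc (suc k)) T h n<T = ≤-trans (*-mono-≤ n≤ n≤)
      (lin (4 * (k * k * T * T) + 8 * (k * T * T)) (z≤n {0}) (eq k T))
    where
    n≤ : n ≤ 2 * suc (suc k) * T
    n≤ = ≤-trans (<⇒≤ n<T) (*-monoˡ-≤ T (lin (suc k) (z≤n {0}) (eq' k)))
      where eq' : ∀ k → suc (suc (suc k)) + 0 + suc k ≡ 2 * suc (suc k) + 0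
            eq' = solve-∀
    eq : ∀ k T → 2 * suc (suc k) * T * (2 * suc (suc k) * T) + 0 + (4 * (k * k * T * T) + 8 * (k * T * T)) ≡ suc
        (suc k) * suc k * (8 * (T * T)) + 0
    eq = solve-∀
  threshold-large n (suc zero) T (s≤s ()) _

  length-concatMap : ∀ {A B : Set} (f : A → List B) c xs →
      (∀ x → length (f x) ≡ c) → length (concatMap f xs) ≡ length xs * c
  length-concatMap f c []       h = refl
  length-concatMap f c (x ∷ xs) h = trans (length-++ (f x)) (cong₂ _+_ (h x) (length-concatMap f c xs h))

  length-bools : ∀ k → length (allVecs bools k) ≡ 2 ^ k
  length-bools zero    = refl
  length-bools (suc k) = length-concatMap (λ b → map (b ∷_) (allVecs bools k)) (2 ^ k) bools (λ b →
      trans (length-map (b ∷_) (allVecs bools k)) (length-bools k))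

  few-events : ∀ n E → 1 ≤ n → E ≤ n → E * (2 + 2 ^ n * 2 ^ n) ≤ 2 ^ (4 * n)
  few-events n E n≥1 E≤n = ≤-trans
      (*-mono-≤ (≤-trans E≤n (n≤2^n n)) (cube (2 ^ n) (≤-trans (s≤s (s≤s z≤n)) (^-monoʳ-≤ 2 n≥1))))
      (≤-reflexive (trans (eq (2 ^ n)) (trans (^-*-assoc 2 n 4) (cong (2 ^_) (*-comm n 4)))))
    where
    cube : ∀ x → 2 ≤ x → 2 + x * x ≤ x * x * x
    cube (suc (suc y)) _ = lin (y * y * y + 5 * (y * y) + 8 * y + 2) (z≤n {0}) (eq' y)
      where eq' : ∀ y → 2 + suc (suc y) * suc (suc y) + 0 + (y * y * y + 5 * (y * y) + 8 * y + 2) ≡ suc (suc y) * suc (suc y) * suc (suc y) + 0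
            eq' = solve-∀
    cube (suc zero) (s≤s ())
    eq : ∀ x → x * (x * x * x) ≡ x ^ 4
    eq x = eq″ x
      where eq″ : ∀ x → x * (x * x * x) ≡ x * (x * (x * (x * 1)))
            eq″ = solve-∀

module Exposure where
  open import Defs using (Adj; Loopless; _∪_; toAdj; Matrix; allVecs; Contains;
      CycleOrientation; cycleAdj; indeg1Count)
  open FiniteSets
  open Paths
  open Construction
  open Parameters
  open Probability using (Queries; done; ask; escapes; off; avoids; bools)
  open import Data.Bool using (Bool; true; false; _∧_; not; if_then_else_)
  open import Data.Nat
  open import Data.Nat.Properties
  open import Data.Nat.Tactic.RingSolver using (solve-∀)
  open import Data.Fin using (Fin; zero; suc; toℕ)
  open import Data.Vec using (Vec; []; _∷_; lookup) renaming (tabulate to tabulateᵛ; replicate to replicateᵛ)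
  open import Data.Vec.Properties using (lookup∘tabulate)
  open import Data.List using (List; []; _∷_; map; concatMap)
  open import Data.List.Relation.Unary.All using (All; []; _∷_)
  import Data.List.Relation.Unary.All as All
  open import Data.List.Relation.Unary.Any using (here; there)
  open import Data.List.Membership.Propositional using (lose) renaming (_∈_ to _∈ˡ_)
  import Data.List.Membership.Propositional.Properties as ∈ₚ
  open import Data.Product using (_×_; _,_; proj₁; proj₂; ∃; ∃₂)
  open import Data.Sum using (_⊎_; inj₁; inj₂)
  open import Data.Empty
  open import Function using (_∘_; id; case_of_)
  open import Relation.Nullary
  open import Relation.Binary.PropositionalEquality

  ∧-false : ∀ {a b} → a ∧ b ≡ false → a ≡ false ⊎ (a ≡ true × b ≡ false)
  ∧-false {false} e = inj₁ refl
  ∧-false {true}  e = inj₂ (refl , e)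

  avoids-false : ∀ {k} (F : Pred k) (x : Vec Bool k) → avoids F x ≡ false → ∃ λ v → v ∈ F × lookup x v ≡ true
  avoids-false F (b ∷ x) h with ∧-false {not (F zero ∧ b)} h
  ... | inj₁ p = let q , r = ∧-true {F zero} (notfalse p) in zero , q , r
    where notfalse : ∀ {a} → not a ≡ false → a ≡ true
          notfalse {true} _ = refl
  ... | inj₂ (_ , p) = let v , q , r = avoids-false (F ∘ suc) x p in suc v , q , r

  module _ {n : ℕ} where

    Row : Set
    Row = Vec Bool n

    asked : ∀ {k} → Queries n k → Vec Row k → Fin k → Pred n
    asked (ask F next) (x ∷ M) zero    = F
    asked (ask F next) (x ∷ M) (suc i) = asked (next x) M i

    total : ∀ {k} → (Fin k → Fin n) → Queries n k → Vec Row k → ℕ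
    total ι σ M = S (λ i → # (asked σ M i ∖ single (ι i)))

    caught : ∀ {k} (ι : Fin k → Fin n) σ (M : Vec Row k) j → escapes ι σ M j ≡ false → j ≤ total ι σ M →
             ∃₂ λ i v → v ∈ asked σ M i × v ≢ ι i × lookup (lookup M i) v ≡ true
    caught ι done [] zero () h
    caught ι (ask F next) (x ∷ M) j e h with ∧-false {avoids (off ι F) x} e
    ... | inj₁ p = let v , q , r = avoids-false (off ι F) x p
                       a , b = ∈∖ {P = F} {single (ι zero)} {v} q in zero , v , a , (λ e' →
                           b (subst (v ∈_) (cong single e') (single-∈ v))) , r
    ... | inj₂ (_ , p) = let i , v , q , r , s = caught (ι ∘ suc) (next x) M (j ∸ # (off ι F)) p (≤-trans (∸-monoˡ-≤ (# (off ι F)) h) (≤-reflexive (m+n∸m≡n (# (off ι F)) _))) in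
                         suc i , v , q , r , s

    blank : ∀ {k} → Vec Row k
    blank = replicateᵛ _ (replicateᵛ _ false)

    keep : ∀ {k} → Fin k → Vec Row k → Vec Row k
    keep zero    M       = blank
    keep (suc i) (x ∷ M) = x ∷ keep i M

    lookup-keep : ∀ {k} (i b : Fin k) M → toℕ b < toℕ i → lookup (keep i M) b ≡ lookup M b
    lookup-keep (suc i) zero    (x ∷ M) h       = refl
    lookup-keep (suc i) (suc b) (x ∷ M) (s≤s h) = lookup-keep i b M h

    queries : ∀ {k} → (Fin k → Vec Row k → Pred n) → Queries n k
    queries {zero}  g = done
    queries {suc k} g = ask (g zero blank) (λ x → queries (λ i M → g (suc i) (x ∷ M)))

    asked-queries : ∀ {k} (g : Fin k → Vec Row k → Pred n) M i → asked (queries g) M i ≡ g i (keep i M)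
    asked-queries g (x ∷ M) zero    = refl
    asked-queries g (x ∷ M) (suc i) = asked-queries (λ i M → g (suc i) (x ∷ M)) M i

  below : ∀ {n} → ℕ → Pred n
  below t c = toℕ c <ᵇ t

  #-below : ∀ n t → t ≤ n → # (below {n} t) ≡ t
  #-below n       zero    h       = #-∅ n
  #-below (suc n) (suc t) (s≤s h) = cong suc (#-below n t h)

  <ᵇ-true : ∀ i t → (i <ᵇ t) ≡ true → i < t
  <ᵇ-true zero    (suc t) e = s≤s z≤n
  <ᵇ-true (suc i) (suc t) e = s≤s (<ᵇ-true i t e)

  <ᵇ-false : ∀ i t → ¬ ((i <ᵇ t) ≡ true) → t ≤ i
  <ᵇ-false i       zero    e = z≤n
  <ᵇ-false zero    (suc t) e = ⊥-elim (e refl)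
  <ᵇ-false (suc i) (suc t) e = s≤s (<ᵇ-false i t e)

  some : ∀ {n} → Pred n → Bool
  some P = does (1 ≤? # P)

  some-witness : ∀ {n} (P : Pred n) → some P ≡ true → ∃ λ v → v ∈ P
  some-witness P h = #-find P (does-sound (1 ≤? # P) h)

  some-intro : ∀ {n} (P : Pred n) v → v ∈ P → some P ≡ true
  some-intro P v h = does-true (1 ≤? # P) (#-pos {P = P} h)

  all-vecs : ∀ {k} (x : Vec Bool k) → x ∈ˡ allVecs bools k
  all-vecs []      = here refl
  all-vecs (b ∷ x) = ∈ₚ.∈-concatMap⁺ (λ y → map (y ∷_) (allVecs bools _)) (prepend b)
    where open import Data.List.Relation.Unary.Any using (Any)
          prepend : ∀ b → Any (λ y → (b ∷ x) ∈ˡ map (y ∷_) (allVecs bools _)) bools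
          prepend true  = here (∈ₚ.∈-map⁺ (true ∷_) (all-vecs x))
          prepend false = there (here (∈ₚ.∈-map⁺ (false ∷_) (all-vecs x)))

  module Events {n} (D : Adj n) (m : ℕ) where

    holeQ : Vec Bool n → Vec Bool n → Queries n n
    holeQ X Y = queries (λ u _ → if lookup X u then lookup Y else ∅ᵖ)

    backQ : Queries n n
    backQ = queries (λ u _ v → D v u)

    popular : Pred n
    popular b = does (suc m ≤? # (λ v → D v b))

    t : ℕ
    t = n ∸ 2 * m

    -- For a late vertex c, the in-neighbours in D of the early popular vertices b with an edge b → c.
    closing : Fin n → Vec Row n → Pred n
    closing c M v = not (below t c) ∧ some (λ b → below t b ∧ (popular b ∧ (lookup (lookup M b) c ∧ D v b)))

    triangleQ : Queries n n
    triangleQ = queries closing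

    preds : List (Vec Bool n)
    preds = allVecs bools n

    allQ : List (Queries n n)
    allQ = backQ ∷ triangleQ ∷ concatMap (λ X → map (holeQ X) preds) preds

    threshold : ℕ
    threshold = m * (m ∸ 1)

    module Typical (loopless : Loopless D) (M : Matrix n)
        (safe : All (λ σ → escapes id σ M threshold ≡ false) allQ)
                   (1≤m : 1 ≤ m) (many-popular : 3 * m ≤ # popular) (2m≤n : 2 * m ≤ n) where

      G : Adj n
      G u v = toAdj M u v ∧ not (single v u)

      G-edge : ∀ {u v} → u ≢ v → toAdj M u v ≡ true → G u v ≡ true
      G-edge {u} {v} ne e = ∧-intro e (¬true⇒not (λ s → ne (single-≡ s)))

      H : Adj n
      H = D ∪ G

      H-loopless : ∀ v → H v v ≡ false
      H-loopless v = no-loop (H v v) refl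
        where no-loop : ∀ b → H v v ≡ b → b ≡ false
              no-loop false e = refl
              no-loop true  e with ∨-true {D v v} e
              ... | inj₁ p = ⊥-elim (true≢false (trans (sym p) (loopless v)))
              ... | inj₂ p = ⊥-elim (not⇒¬true (proj₂ (∧-true {toAdj M v v} p)) (single-∈ v))

      #∖single : ∀ (P : Pred n) u k → suc k ≤ # P → k ≤ # (P ∖ single u)
      #∖single P u k h = ≤-pred (≤-trans h
          (≤-trans (#-∖ P (single u)) (≤-reflexive
          (trans (cong (# (P ∖ single u) +_) (#-single u)) (+-comm _ 1)))))

      m∸1 : suc (m ∸ 1) ≡ m
      m∸1 = m+[n∸m]≡n 1≤m

      query : ∀ (g : Fin n → Vec Row n → Pred n) → queries g ∈ˡ allQ → ∀ (B : Pred n) → m ≤ # B →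
              (∀ u → u ∈ B → m ∸ 1 ≤ # (g u (keep u M) ∖ single u)) → ∃₂ λ u v → v ∈ g u (keep u M) ×
                  v ≢ u × toAdj M u v ≡ true
      query g i B B≥ h with caught id (queries g) M threshold (All.lookup safe i)
             (≤-trans (*-monoˡ-≤ (m ∸ 1) B≥)
                 (Matching.markov B (λ u → # (asked (queries g) M u ∖ single u)) (m ∸ 1)
               (λ u u∈ → ≤-trans (h u u∈) (≤-reflexive
                   (cong (λ F → # (F ∖ single u)) (sym (asked-queries g M u)))))))
      ... | u , v , v∈ , ne , e = u , v , subst (v ∈_) (asked-queries g M u) v∈ , ne , e

      hole-free : ∀ (X Y : Pred n) → m ≤ # X → m ≤ # Y → ∃₂ λ u v → u ∈ X × v ∈ Y × v ≢ u × toAdj M u v ≡ true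
      hole-free X Y hX hY = case query (λ u _ → if lookup X' u then lookup Y' else ∅ᵖ)
          (there (there (∈ₚ.∈-concatMap⁺ (λ X → map (holeQ X) preds)
              (lose (all-vecs X') (∈ₚ.∈-map⁺ (holeQ X') (all-vecs Y'))))))
          X hX (λ u u∈ → ≤-trans (#∖single Y u (m ∸ 1) (≤-trans (≤-reflexive m∸1) hY))
            (#-mono {P = Y ∖ single u} {Q = (if lookup X' u then lookup Y' else ∅ᵖ) ∖ single u}
               (λ v q → ∧-intro (subst (λ b → (if b then lookup Y' else ∅ᵖ) v ≡ true)
                   (sym (trans (lookup∘tabulate X u) u∈))
                   (trans (lookup∘tabulate Y v) (proj₁ (∧-true {Y v} q)))) (proj₂ (∧-true {Y v} q))))) of λ
          { (u , v , v∈ , ne , e) → let p , q = members (lookup X' u) u v refl v∈ in u , v , p , q , ne , e }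
        where
        X' = tabulateᵛ X
        Y' = tabulateᵛ Y
        members : ∀ b u v → lookup X' u ≡ b → (if b then lookup Y' else ∅ᵖ) v ≡ true → u ∈ X × v ∈ Y
        members true u v e h = trans (sym (lookup∘tabulate X u)) e , trans (sym (lookup∘tabulate Y v)) h

      G⊆H : ∀ {u v} → v ≢ u → toAdj M u v ≡ true → H u v ≡ true
      G⊆H {u} {v} ne e = ∨-introʳ {D u v} (G-edge (λ e' → ne (sym e')) e)

      H-hole-free : Walks.HoleFree H m
      H-hole-free X Y hX hY = let u , v , p , q , ne , e = hole-free X Y hX hY in u , v , p , q , G⊆H ne e

      back-edge : ∃₂ λ u v → u ≢ v × H u v ≡ true × H v u ≡ true
      back-edge = case query (λ u _ v → D v u) (here refl) popular (≤-trans (m≤n*m m 3) many-popular)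
          (λ u u∈ → ≤-trans (m∸n≤m m 1) (#∖single (λ v → D v u) u m (does-sound (suc m ≤? # (λ v → D v u)) u∈)))
              of λ
          { (u , v , v∈ , ne , e) → u , v , (λ e' → ne (sym e')) , G⊆H ne e , ∨-introˡ v∈ }

      early : Pred n
      early = below t

      t≤n : t ≤ n
      t≤n = m∸n≤m n (2 * m)

      late≡ : # (full ∖ early) ≡ 2 * m
      late≡ = +-cancelˡ-≡ t _ _ (trans (cong (_+ # (full ∖ early)) (sym (#-below n t t≤n)))
          (trans (#-compl early) (sym (m∸n+n≡m 2m≤n))))

      linked : Pred n
      linked c = some (λ b → below t b ∧ (popular b ∧ lookup (lookup M b) c))

      early-popular : m ≤ # (popular ∩ early)
      early-popular = +-cancelˡ-≤ (2 * m) _ _ (≤-trans (≤-reflexive (+-comm (2 * m) m)) (≤-trans many-popular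
        (≤-trans (≤-reflexive (#-split popular early))
            (+-monoˡ-≤ (# (popular ∩ early))
            (≤-trans (#-mono {P = popular ∖ early} {Q = full ∖ early} (λ v h → proj₂ (∧-true {popular v} h)))
            (≤-reflexive late≡))))))

      unlinked-few : # ((full ∖ early) ∖ linked) < m
      unlinked-few with m ≤? # ((full ∖ early) ∖ linked)
      ... | no h = ≰⇒> h
      ... | yes h = case hole-free (popular ∩ early) ((full ∖ early) ∖ linked) early-popular h of λ
            { (b , c , b∈ , c∈ , _ , e) → ⊥-elim (proj₂ (∈∖ {P = full ∖ early} {linked} {c} c∈)
                (some-intro (λ b → below t b ∧ (popular b ∧ lookup (lookup M b) c)) b
                  (let p , q = ∧-true {popular b} b∈ in ∧-intro q (∧-intro p e)))) }

      linked-many : m ≤ # ((full ∖ early) ∩ linked)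
      linked-many = +-cancelˡ-≤ m _ _
          (≤-trans (≤-reflexive (trans (cong (m +_) (sym (+-identityʳ m))) (sym late≡)))
        (≤-trans (≤-reflexive (#-split (full ∖ early) linked)) (+-monoˡ-≤ _ (<⇒≤ unlinked-few))))

      early-row : ∀ b c → below t b ≡ true → not (below t c) ≡ true → lookup (keep c M) b ≡ lookup M b
      early-row b c p q = lookup-keep c b M (≤-trans (<ᵇ-true (toℕ b) t p) (<ᵇ-false (toℕ c) t (not⇒¬true q)))

      triangle : ∃ λ u → ∃₂ λ v w → H u v ≡ true × H v w ≡ true × H w u ≡ true
      triangle = case query closing (there (here refl)) ((full ∖ early) ∩ linked) linked-many
          (λ c c∈ → enough c c∈) of λ
        { (c , v , v∈ , ne , e) → let lt , s = ∧-true {not (below t c)} v∈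
                                      b , h = some-witness _ s
                                      eb , h' = ∧-true {below t b} h
                                      _ , h″ = ∧-true {popular b} h'
                                      bc , vb = ∧-true {lookup (lookup (keep c M) b) c} h″ in
            b , c , v , G⊆H (λ e' → not⇒¬true lt (trans (cong (below t) e') eb))
                (trans (cong (λ r → lookup r c) (sym (early-row b c eb lt))) bc) , G⊆H ne e , ∨-introˡ vb }
        where
        enough : ∀ c → c ∈ (full ∖ early) ∩ linked → m ∸ 1 ≤ # (closing c (keep c M) ∖ single c)
        enough c c∈ = let lt , lk = ∧-true {(full ∖ early) c} c∈
                          b , h = some-witness _ lk
                          eb , h' = ∧-true {below t b} h
                          pb , bc = ∧-true {popular b} h' in
          ≤-trans (m∸n≤m m 1) (#∖single (closing c (keep c M)) c m
              (≤-trans (does-sound (suc m ≤? # (λ v → D v b)) pb)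
            (#-mono {P = λ v → D v b} {Q = closing c (keep c M)} (λ v vb → ∧-intro lt
               (some-intro (λ b → below t b ∧ (popular b ∧ (lookup (lookup (keep c M) b) c ∧ D v b))) b
                 (∧-intro eb (∧-intro pb (∧-intro
                     (trans (cong (λ r → lookup r c) (early-row b c eb lt)) bc) vb))))))))

  Contains-mono : ∀ {n ℓ} {A B : Adj n} {K : Adj ℓ} → (∀ u v → A u v ≡ true → B u v ≡ true) →
      Contains A K → Contains B K
  Contains-mono s (φ , inj , h) = φ , inj , λ i j e → s _ _ (h i j e)

  module Conclusion {n} (D : Adj n) (loopless : Loopless D) (a : ℕ) (1≤a : 1 ≤ a) (deg : ∀ v →
      2 * n ≤ a * (# (D v) + # (λ u → D u v)))
                    (e : ℕ) (1≤e : 1 ≤ e) (π : Params a e) (m : ℕ) (1≤m : 1 ≤ m)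
                    (mT≤n : m * Params.T π ≤ n) (n<T : n < suc m * Params.T π) (n≥b : 28 * suc (Params.b' π) ≤ n) where
    open Params π
    open Events D m public

    τ : Pred n
    τ v = does (# (λ u → D u v) ≤? # (D v))

    deg-τ : ∀ v → n ≤ a * # (Walks.E D (τ v) v)
    deg-τ v = by (τ v) refl
      where
      half : ∀ x y → 2 * n ≤ a * (x + y) → y ≤ x → n ≤ a * x
      half x y h k = *-cancelˡ-≤ 2 (≤-trans h (≤-trans (*-monoʳ-≤ a (+-monoʳ-≤ x k)) (≤-reflexive (eq a x))))
        where eq : ∀ a x → a * (x + x) ≡ 2 * (a * x)
              eq = solve-∀
      by : ∀ b → τ v ≡ b → n ≤ a * # (Walks.E D b v)
      by true  h = half (# (D v)) (# (λ u → D u v)) (deg v) (does-sound (# (λ u → D u v) ≤? # (D v)) h)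
      by false h = half (# (λ u → D u v)) (# (D v))
          (≤-trans (deg v) (≤-reflexive (cong (a *_) (+-comm (# (D v)) _))))
          (<⇒≤ (≰⇒> (does-false (# (λ u → D u v) ≤? # (D v)) h)))

    facts = holds n m 1≤m mT≤n n<T n≥b

    room : 2 * a * (6 * m + 2) < n
    room = proj₁ (proj₂ (proj₂ facts))

    many-popular : 3 * m ≤ # popular
    many-popular = Degrees.many D τ a deg-τ false (3 * m) (suc m)
        (≤-trans (s≤s (*-monoʳ-≤ (2 * a) (≤-trans (m≤m+n _ (2 * m + 1)) (≤-reflexive (eq m))))) room)
      where eq : ∀ m → 3 * m + suc m + (2 * m + 1) ≡ 6 * m + 2
            eq = solve-∀

    2m≤n : 2 * m ≤ n
    2m≤n = ≤-trans (*-mono-≤ (m≤m*n 2 a {{>-nonZero 1≤a}}) (≤-trans (m≤n*m m 6) (m≤m+n (6 * m) 2))) (<⇒≤ room)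

    all-cycles : (M : Matrix n) → All (λ σ → escapes id σ M threshold ≡ false) allQ →
                 ∀ ℓ → ℓ ≤ n → (K : CycleOrientation ℓ) → indeg1Count K * e + n ≤ e * n →
                     Contains (D ∪ toAdj M) (cycleAdj K)
    all-cycles M safe ℓ ℓ≤n K few = Contains-mono {A = H} {B = D ∪ toAdj M} up
        (Deterministic.contains H m 1≤m H-hole-free H-loopless τ a 1≤a deg-H b' b≡ q (proj₁ facts)
            (proj₁ (proj₂ facts)) n≥b room e 1≤e
          (proj₂ (proj₂ (proj₂ facts))) triangle back-edge ℓ ℓ≤n K few)
      where
      open Typical loopless M safe 1≤m many-popular 2m≤n
      up : ∀ u v → H u v ≡ true → (D ∪ toAdj M) u v ≡ true
      up u v h with ∨-true {D u v} h
      ... | inj₁ p = ∨-introˡ p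
      ... | inj₂ p = ∨-introʳ {D u v} (proj₁ (∧-true {toAdj M u v} p))
      deg-H : ∀ v → n ≤ a * # (Walks.E H (τ v) v)
      deg-H v = ≤-trans (deg-τ v) (*-monoʳ-≤ a (grow (τ v)))
        where grow : ∀ d → # (Walks.E D d v) ≤ # (Walks.E H d v)
              grow true  = #-mono {P = Walks.E D true v} {Q = Walks.E H true v} (λ u h → ∨-introˡ h)
              grow false = #-mono {P = Walks.E D false v} {Q = Walks.E H false v} (λ u h → ∨-introˡ h)

module Rationals where
  open import Defs using (ℕtoℚ)
  open Probability using (pow; *-mono; *-monoʳ; *-nonneg)
  open import Data.Nat as ℕ using (ℕ; zero; suc)
  import Data.Nat.Properties as ℕₚ
  import Data.Integer as ℤ
  import Data.Integer.Properties as ℤₚ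
  open import Data.Rational
  open import Data.Rational.Properties
  open import Data.Rational.Solver using (module +-*-Solver)
  import Data.Rational.Unnormalised as ℚᵘ
  import Data.Rational.Unnormalised.Properties as ℚᵘₚ
  open import Data.Product using (_×_; _,_; ∃)
  open import Relation.Binary.PropositionalEquality

  whole : ℕ → ℚᵘ.ℚᵘ
  whole k = ℚᵘ.mkℚᵘ (ℤ.+ k) 0

  ℕtoℚ-≃ : ∀ k → toℚᵘ (ℕtoℚ k) ℚᵘ.≃ whole k
  ℕtoℚ-≃ k = toℚᵘ-fromℚᵘ (whole k)

  ℕtoℚ-+ : ∀ j k → ℕtoℚ (j ℕ.+ k) ≡ ℕtoℚ j + ℕtoℚ k
  ℕtoℚ-+ j k = toℚᵘ-injective (ℚᵘₚ.≃-trans (ℕtoℚ-≃ (j ℕ.+ k)) (ℚᵘₚ.≃-trans (ℚᵘ.*≡* eq)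
      (ℚᵘₚ.≃-trans (ℚᵘₚ.+-cong (ℚᵘₚ.≃-sym (ℕtoℚ-≃ j)) (ℚᵘₚ.≃-sym (ℕtoℚ-≃ k)))
          (ℚᵘₚ.≃-sym (toℚᵘ-homo-+ (ℕtoℚ j) (ℕtoℚ k))))))
    where eq : (ℤ.+ (j ℕ.+ k)) ℤ.* (ℤ.+ 1) ≡ ((ℤ.+ j) ℤ.* (ℤ.+ 1) ℤ.+ (ℤ.+ k) ℤ.* (ℤ.+ 1)) ℤ.* (ℤ.+ 1)
          eq = cong (ℤ._* (ℤ.+ 1)) (sym (cong₂ ℤ._+_ (ℤₚ.*-identityʳ (ℤ.+ j)) (ℤₚ.*-identityʳ (ℤ.+ k))))

  ℕtoℚ-* : ∀ j k → ℕtoℚ (j ℕ.* k) ≡ ℕtoℚ j * ℕtoℚ k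
  ℕtoℚ-* j k = toℚᵘ-injective (ℚᵘₚ.≃-trans (ℕtoℚ-≃ (j ℕ.* k))
      (ℚᵘₚ.≃-trans (ℚᵘ.*≡* (cong (ℤ._* (ℤ.+ 1)) (ℤₚ.pos-* j k)))
      (ℚᵘₚ.≃-trans (ℚᵘₚ.*-cong (ℚᵘₚ.≃-sym (ℕtoℚ-≃ j)) (ℚᵘₚ.≃-sym (ℕtoℚ-≃ k)))
          (ℚᵘₚ.≃-sym (toℚᵘ-homo-* (ℕtoℚ j) (ℕtoℚ k))))))

  ℕtoℚ-mono : ∀ {j k} → j ℕ.≤ k → ℕtoℚ j ≤ ℕtoℚ k
  ℕtoℚ-mono {j} {k} h = toℚᵘ-cancel-≤ (ℚᵘₚ.≤-trans (ℚᵘₚ.≤-reflexive (ℕtoℚ-≃ j)) (ℚᵘₚ.≤-trans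
      (ℚᵘ.*≤* (ℤₚ.*-monoʳ-≤-nonNeg (ℤ.+ 1) (ℤ.+≤+ h))) (ℚᵘₚ.≤-reflexive (ℚᵘₚ.≃-sym (ℕtoℚ-≃ k)))))

  ℕtoℚ-cancel : ∀ {j k} → ℕtoℚ j ≤ ℕtoℚ k → j ℕ.≤ k
  ℕtoℚ-cancel {j} {k} h with ℚᵘₚ.≤-trans (ℚᵘₚ.≤-reflexive (ℚᵘₚ.≃-sym (ℕtoℚ-≃ j)))
      (ℚᵘₚ.≤-trans (toℚᵘ-mono-≤ h) (ℚᵘₚ.≤-reflexive (ℕtoℚ-≃ k)))
  ... | ℚᵘ.*≤* p = ℤₚ.drop‿+≤+ (subst₂ ℤ._≤_ (ℤₚ.*-identityʳ (ℤ.+ j)) (ℤₚ.*-identityʳ (ℤ.+ k)) p)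

  ℕtoℚ≥0 : ∀ k → 0ℚ ≤ ℕtoℚ k
  ℕtoℚ≥0 k = ℕtoℚ-mono {0} {k} ℕ.z≤n

  ℕtoℚ-pos : ∀ k → Positive (ℕtoℚ (suc k))
  ℕtoℚ-pos k = positive (<-≤-trans (positive⁻¹ 1ℚ) (ℕtoℚ-mono {1} {suc k} (ℕ.s≤s ℕ.z≤n)))

  inverse : ∀ x → ℕtoℚ (suc x) * ((ℤ.+ 1) / suc x) ≡ 1ℚ
  inverse x = toℚᵘ-injective (ℚᵘₚ.≃-trans (toℚᵘ-homo-* (ℕtoℚ (suc x)) ((ℤ.+ 1) / suc x))
     (ℚᵘₚ.≃-trans (ℚᵘₚ.*-cong (ℕtoℚ-≃ (suc x)) (toℚᵘ-fromℚᵘ (ℚᵘ.mkℚᵘ (ℤ.+ 1) x))) (ℚᵘ.*≡* eq)))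
    where eq : (ℤ.+ suc x) ℤ.* (ℤ.+ 1) ℤ.* (ℤ.+ 1) ≡ (ℤ.+ 1) ℤ.* (ℤ.+ suc (x ℕ.+ 0))
          eq = trans (ℤₚ.*-identityʳ _) (trans (ℤₚ.*-comm (ℤ.+ suc x) (ℤ.+ 1))
              (cong (λ t → (ℤ.+ 1) ℤ.* (ℤ.+ suc t)) (sym (ℕₚ.+-identityʳ x))))

  abstract
    archimedean : ∀ q → 0ℚ < q → ∃ λ a → 1 ℕ.≤ a × 1ℚ ≤ ℕtoℚ a * q
    archimedean q q>0 = archi q {{positive q>0}}
      where
      archi : ∀ q → .{{Positive q}} → ∃ λ a → 1 ℕ.≤ a × 1ℚ ≤ ℕtoℚ a * q
      archi q@(mkℚ (ℤ.+ suc k) d _) = suc d , ℕ.s≤s ℕ.z≤n , toℚᵘ-cancel-≤ (ℚᵘₚ.≤-trans (ℚᵘ.*≤* le)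
          (ℚᵘₚ.≤-reflexive (ℚᵘₚ.≃-sym (ℚᵘₚ.≃-trans (toℚᵘ-homo-* (ℕtoℚ (suc d)) q)
              (ℚᵘₚ.*-cong (ℕtoℚ-≃ (suc d)) ℚᵘₚ.≃-refl)))))
        where le : (ℤ.+ 1) ℤ.* (ℤ.+ suc (d ℕ.+ 0)) ℤ.≤ (ℤ.+ suc d) ℤ.* (ℤ.+ suc k) ℤ.* (ℤ.+ 1)
              le = subst₂ ℤ._≤_ (sym (ℤₚ.*-identityˡ _)) (sym (ℤₚ.*-identityʳ _))
                (ℤ.+≤+ (ℕₚ.≤-trans (ℕₚ.≤-reflexive (cong suc (ℕₚ.+-identityʳ d))) (ℕₚ.m≤m*n (suc d) (suc k))))

  open +-*-Solver

  clear-degree : ∀ α a n k → 1ℚ ≤ ℕtoℚ a * α → (ℕtoℚ 2 * α) * ℕtoℚ n ≤ ℕtoℚ k → 2 ℕ.* n ℕ.≤ a ℕ.* k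
  clear-degree α a n k ha h = ℕtoℚ-cancel (begin
    ℕtoℚ (2 ℕ.* n)                      ≡⟨ ℕtoℚ-* 2 n ⟩
    ℕtoℚ 2 * ℕtoℚ n                     ≡⟨ *-identityˡ _ ⟨
    1ℚ * (ℕtoℚ 2 * ℕtoℚ n)              ≤⟨ *-monoʳ _ (*-nonneg (ℕtoℚ≥0 2) (ℕtoℚ≥0 n)) ha ⟩
    (ℕtoℚ a * α) * (ℕtoℚ 2 * ℕtoℚ n)    ≡⟨ solve 4 (λ a α t n →
        (a :* α) :* (t :* n) := a :* ((t :* α) :* n)) refl (ℕtoℚ a) α (ℕtoℚ 2) (ℕtoℚ n) ⟩
    ℕtoℚ a * ((ℕtoℚ 2 * α) * ℕtoℚ n)    ≤⟨ *-mono (ℕtoℚ a) (ℕtoℚ≥0 a) h ⟩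
    ℕtoℚ a * ℕtoℚ k                     ≡⟨ ℕtoℚ-* a k ⟨
    ℕtoℚ (a ℕ.* k)                      ∎)
    where open ≤-Reasoning

  clear-through : ∀ η e n i → 1ℚ ≤ ℕtoℚ e * η → ℕtoℚ i ≤ (1ℚ - η) * ℕtoℚ n → i ℕ.* e ℕ.+ n ℕ.≤ e ℕ.* n
  clear-through η e n i he h = ℕtoℚ-cancel (begin
    ℕtoℚ (i ℕ.* e ℕ.+ n)                                     ≡⟨ ℕtoℚ-+ (i ℕ.* e) n ⟩
    ℕtoℚ (i ℕ.* e) + ℕtoℚ n                                  ≡⟨ cong (_+ ℕtoℚ n) (ℕtoℚ-* i e) ⟩
    ℕtoℚ i * ℕtoℚ e + ℕtoℚ n                                 ≤⟨ +-mono-≤ (*-monoʳ (ℕtoℚ e) (ℕtoℚ≥0 e) h)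
        (≤-trans (≤-reflexive (sym (*-identityˡ _))) (*-monoʳ (ℕtoℚ n) (ℕtoℚ≥0 n) he)) ⟩
    ((1ℚ - η) * ℕtoℚ n) * ℕtoℚ e + (ℕtoℚ e * η) * ℕtoℚ n     ≡⟨ solve 3 (λ η n e →
        ((con 1ℚ :- η) :* n) :* e :+ (e :* η) :* n := e :* n) refl η (ℕtoℚ n) (ℕtoℚ e) ⟩
    ℕtoℚ e * ℕtoℚ n                                          ≡⟨ ℕtoℚ-* e n ⟨
    ℕtoℚ (e ℕ.* n)                                           ∎)
    where open ≤-Reasoning

  pow-* : ∀ c j n r → c * ℕtoℚ n ≡ ℕtoℚ r → pow c j * ℕtoℚ (n ℕ.^ j) ≡ ℕtoℚ (r ℕ.^ j)
  pow-* c zero    n r h = refl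
  pow-* c (suc j) n r h = trans (cong (c * pow c j *_) (ℕtoℚ-* n (n ℕ.^ j)))
    (trans (solve 4 (λ c p n x → c :* p :* (n :* x) := c :* n :* (p :* x)) refl c (pow c j)
        (ℕtoℚ n) (ℕtoℚ (n ℕ.^ j)))
    (trans (cong₂ _*_ h (pow-* c j n r h)) (sym (ℕtoℚ-* r (r ℕ.^ j)))))

  small-total : ∀ c j x r L E B ε → c * ℕtoℚ (suc x) ≡ ℕtoℚ r → 1 ℕ.≤ E → 1ℚ ≤ ℕtoℚ E * ε → E ℕ.* L ℕ.≤ B →
      r ℕ.^ j ℕ.* B ℕ.≤ suc x ℕ.^ j →
                0ℚ ≤ pow c j → ℕtoℚ L * pow c j ≤ ε
  small-total c j x r L (suc E') B ε hc _ hE hL hr pos = *-cancelˡ-≤-pos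
      (ℕtoℚ E) {{ℕtoℚ-pos E'}} (≤-trans below-1 hE)
    where
    E = suc E'
    X = suc x ℕ.^ j
    instance X-pos : Positive (ℕtoℚ X)
             X-pos = positive (<-≤-trans (positive⁻¹ 1ℚ) (ℕtoℚ-mono {1} {X} (ℕₚ.m^n>0 (suc x) j)))
    below-1 : ℕtoℚ E * (ℕtoℚ L * pow c j) ≤ 1ℚ
    below-1 = *-cancelʳ-≤-pos (ℕtoℚ X) (begin
      ℕtoℚ E * (ℕtoℚ L * pow c j) * ℕtoℚ X      ≡⟨ solve 4 (λ e l p x →
          e :* (l :* p) :* x := (e :* l) :* (p :* x)) refl (ℕtoℚ E) (ℕtoℚ L) (pow c j) (ℕtoℚ X) ⟩
      (ℕtoℚ E * ℕtoℚ L) * (pow c j * ℕtoℚ X)    ≡⟨ cong₂ _*_ (sym (ℕtoℚ-* E L)) (pow-* c j (suc x) r hc) ⟩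
      ℕtoℚ (E ℕ.* L) * ℕtoℚ (r ℕ.^ j)           ≤⟨ *-monoʳ (ℕtoℚ (r ℕ.^ j)) (ℕtoℚ≥0 (r ℕ.^ j)) (ℕtoℚ-mono hL) ⟩
      ℕtoℚ B * ℕtoℚ (r ℕ.^ j)                   ≡⟨ trans (*-comm (ℕtoℚ B) _) (sym (ℕtoℚ-* (r ℕ.^ j) B)) ⟩
      ℕtoℚ (r ℕ.^ j ℕ.* B)                      ≤⟨ ℕtoℚ-mono hr ⟩
      ℕtoℚ X                                    ≡⟨ *-identityˡ _ ⟨
      1ℚ * ℕtoℚ X                               ∎)
      where open ≤-Reasoning

open import Defs
open FiniteSets using (#)
open Construction using (sum-allFin)
open Parameters
open Rationals
open Probability using (none; times; pow; *-nonneg; escapes)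
open import Data.Nat as ℕ using (ℕ; suc; _≥_)
import Data.Nat.Properties as ℕₚ
import Data.Nat.DivMod as DM
open import Data.Integer using (+_)
open import Data.Bool using (Bool; true; false)
open import Data.List using (List; []; _∷_; map; length)
open import Data.List.Properties using (length-map)
open import Data.List.Relation.Unary.All using (All; []; _∷_)
import Data.List.Relation.Unary.All.Properties as Allₚ
open import Data.Rational using (ℚ; 0ℚ; 1ℚ; _<_; _*_; _-_; _+_; _≤_; -_) renaming (_/_ to _/ℚ_)
open import Data.Rational.Properties
open import Data.Rational.Solver using (module +-*-Solver)
open import Data.Product using (Σ; _×_; _,_; ∃)
open import Function using (id)
open import Relation.Binary.PropositionalEquality

open +-*-Solver using (solve; _:=_; _:+_; _:*_; :-_; con)

times≡ : ∀ L δ → times L δ ≡ ℕtoℚ L * δ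
times≡ ℕ.zero  δ = sym (*-zeroˡ δ)
times≡ (suc L) δ = trans (cong₂ _+_ (sym (*-identityˡ δ)) (times≡ L δ))
    (trans (sym (*-distribʳ-+ δ 1ℚ (ℕtoℚ L))) (cong (_* δ) (sym (ℕtoℚ-+ 1 L))))

none-false : ∀ {n} {A : Set} (f : A → Matrix n → Bool) as M → none (map f as) M ≡ true →
    All (λ a → f a M ≡ false) as
none-false f []       M h = []
none-false f (a ∷ as) M h with f a M in e
... | false = e ∷ none-false f as M h

subtract-≤ : ∀ {ε s t} → 1ℚ ≤ s + t → t ≤ ε → 1ℚ - ε ≤ s
subtract-≤ {ε} {s} {t} h k = ≤-trans (+-monoˡ-≤ (- ε) h) (≤-trans (+-monoʳ-≤ (s + t) (neg-antimono-≤ k))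
  (≤-reflexive (solve 2 (λ s t → (s :+ t) :+ (:- t) := s) refl s t)))

module EdgeProb (C x r : ℕ) (r+C : r ℕ.+ C ≡ suc x) where
  n = suc x
  inv = (+ 1) /ℚ n
  p = edgeProb (ℕtoℚ C) n

  inv≥0 : 0ℚ ≤ inv
  inv≥0 = *-cancelˡ-≤-pos (ℕtoℚ n) {{ℕtoℚ-pos x}}
      (≤-trans (≤-reflexive (*-zeroʳ (ℕtoℚ n))) (≤-trans (ℕtoℚ≥0 1) (≤-reflexive (sym (inverse x)))))

  p≡ : p ≡ ℕtoℚ C * inv
  p≡ = p≤q⇒p⊓q≡p (≤-trans (Probability.*-monoʳ inv inv≥0
      (ℕtoℚ-mono (ℕₚ.≤-trans (ℕₚ.m≤n+m C r) (ℕₚ.≤-reflexive r+C)))) (≤-reflexive (inverse x)))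

  p≥0 : 0ℚ ≤ p
  p≥0 = ≤-trans (*-nonneg (ℕtoℚ≥0 C) inv≥0) (≤-reflexive (sym p≡))

  c*n : (1ℚ - p) * ℕtoℚ n ≡ ℕtoℚ r
  c*n = trans (cong (λ p → (1ℚ - p) * ℕtoℚ n) p≡)
    (trans (solve 3 (λ C i n → (con 1ℚ :+ (:- (C :* i))) :* n := n :+ (:- (C :* (n :* i))))
        refl (ℕtoℚ C) inv (ℕtoℚ n))
    (trans (cong₂ (λ m u → m + (- (ℕtoℚ C * u))) (trans (cong ℕtoℚ (sym r+C)) (ℕtoℚ-+ r C)) (inverse x))
      (solve 2 (λ r C → (r :+ C) :+ (:- (C :* con 1ℚ)) := r) refl (ℕtoℚ r) (ℕtoℚ C))))

  c≥0 : 0ℚ ≤ 1ℚ - p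
  c≥0 = *-cancelʳ-≤-pos (ℕtoℚ n) {{ℕtoℚ-pos x}}
      (≤-trans (≤-reflexive (*-zeroˡ (ℕtoℚ n))) (≤-trans (ℕtoℚ≥0 r) (≤-reflexive (sym c*n))))

  c≤1 : 1ℚ - p ≤ 1ℚ
  c≤1 = ≤-trans (+-monoʳ-≤ 1ℚ (neg-antimono-≤ p≥0)) (≤-reflexive (+-identityʳ 1ℚ))

module Threshold (α η : ℚ) (a : ℕ) (a≥1 : 1 ℕ.≤ a) (aα : 1ℚ ≤ ℕtoℚ a * α)
                 (e : ℕ) (e≥1 : 1 ℕ.≤ e) (eη : 1ℚ ≤ ℕtoℚ e * η) (π : Params a e) where
  open Params π using (T; 1≤T; b')
  Q C# : ℕ
  Q = 8 ℕ.* (T ℕ.* T)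
  C# = 4 ℕ.* Q
  Q≥1 : 1 ℕ.≤ Q
  Q≥1 = ℕₚ.≤-trans (ℕₚ.*-mono-≤ 1≤T 1≤T) (ℕₚ.m≤n*m (T ℕ.* T) 8)
  C>0 : 0ℚ < ℕtoℚ C#
  C>0 = <-≤-trans (positive⁻¹ 1ℚ) (ℕtoℚ-mono {1} {C#} (ℕₚ.≤-trans Q≥1 (ℕₚ.m≤n*m Q 4)))

  module _ (ε : ℚ) (E : ℕ) (E≥1 : 1 ℕ.≤ E) (Eε : 1ℚ ≤ ℕtoℚ E * ε) where

    N : ℕ
    N = 2 ℕ.* T ℕ.+ (28 ℕ.* suc b' ℕ.+ (C# ℕ.+ (E ℕ.+ 2)))

    typical : ∀ n → n ≥ N → (D₀ : Adj n) → Loopless D₀ → MinTotDegAtLeast D₀ ((ℕtoℚ 2 * α) * ℕtoℚ n) →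
      ProbAtLeast n (edgeProb (ℕtoℚ C#) n) (λ G → ContainsAllCycles η (D₀ ∪ G)) (1ℚ - ε)
    typical ℕ.zero n≥N with () ← ℕₚ.≤-trans
        (ℕₚ.≤-trans (ℕₚ.≤-trans (ℕₚ.≤-trans (ℕₚ.m≤n+m 1 (suc E))
        (ℕₚ.≤-reflexive (trans (cong suc (ℕₚ.+-comm E 1)) (ℕₚ.+-comm 2 E)))) (ℕₚ.m≤n+m (E ℕ.+ 2) C#))
        (ℕₚ.m≤n+m _ (28 ℕ.* suc b'))) (ℕₚ.≤-trans (ℕₚ.m≤n+m _ (2 ℕ.* T)) n≥N)
    typical (suc x) n≥N D₀ loopless min =
        none bs , (λ M h ℓ ℓ≤n K few → all-cycles M (none-false (λ σ M → escapes id σ M threshold) allQ M h) ℓ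
            ℓ≤n K (clear-through η e n (indeg1Count K) eη few)) ,
        subtract-≤ (Probability.union-bound p p≥0 c≥0 c≤1 (pow c threshold) bs (Allₚ.map⁺ (each allQ))) small
      where
      n = suc x
      above : ∀ {k} → k ℕ.≤ N → k ℕ.≤ n
      above h = ℕₚ.≤-trans h n≥N
      2T≤n : 2 ℕ.* T ℕ.≤ n
      2T≤n = above (ℕₚ.m≤m+n _ _)
      b≤n : 28 ℕ.* suc b' ℕ.≤ n
      b≤n = above (ℕₚ.≤-trans (ℕₚ.m≤m+n _ _) (ℕₚ.m≤n+m _ (2 ℕ.* T)))
      tail₂ = ℕₚ.≤-trans (ℕₚ.m≤n+m (C# ℕ.+ (E ℕ.+ 2)) (28 ℕ.* suc b')) (ℕₚ.m≤n+m _ (2 ℕ.* T))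
      C≤n : C# ℕ.≤ n
      C≤n = above (ℕₚ.≤-trans (ℕₚ.m≤m+n C# (E ℕ.+ 2)) tail₂)
      tail₃ = ℕₚ.≤-trans (ℕₚ.m≤n+m (E ℕ.+ 2) C#) tail₂
      E≤n : E ℕ.≤ n
      E≤n = above (ℕₚ.≤-trans (ℕₚ.m≤m+n E 2) tail₃)
      x≥1 : 1 ℕ.≤ x
      x≥1 = ℕₚ.≤-pred (above (ℕₚ.≤-trans (ℕₚ.m≤n+m 2 E) tail₃))
      instance T-nonzero : ℕ.NonZero T
               T-nonzero = ℕ.>-nonZero 1≤T
      m = n DM./ T
      mT≤n : m ℕ.* T ℕ.≤ n
      mT≤n = DM.m/n*n≤m n T
      n<T : n ℕ.< suc m ℕ.* T
      n<T = ℕₚ.≤-trans (ℕₚ.≤-reflexive (cong suc (DM.m≡m%n+[m/n]*n n T)))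
          (ℕₚ.+-monoˡ-≤ (m ℕ.* T) (DM.m%n<n n T))
      m≥2 : 2 ℕ.≤ m
      m≥2 = ℕₚ.≤-trans (ℕₚ.≤-reflexive (sym (DM.m*n/n≡m 2 T))) (DM./-monoˡ-≤ T 2T≤n)
      deg : ∀ v → 2 ℕ.* n ℕ.≤ a ℕ.* (# (D₀ v) ℕ.+ # (λ u → D₀ u v))
      deg v = ℕₚ.≤-trans (clear-degree α a n (totdeg D₀ v) aα (min v))
        (ℕₚ.≤-reflexive (cong (a ℕ.*_) (cong₂ ℕ._+_ (sum-allFin (λ u → b2n (D₀ v u)))
            (sum-allFin (λ u → b2n (D₀ u v))))))
      open Exposure.Conclusion D₀ loopless a a≥1 deg e e≥1 π m (ℕₚ.≤-trans (ℕ.s≤s ℕ.z≤n) m≥2) mT≤n n<T b≤n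
      r = n ℕ.∸ C#
      r+C : r ℕ.+ C# ≡ n
      r+C = ℕₚ.m∸n+n≡m C≤n
      open EdgeProb C# x r r+C using (p; p≥0; c≥0; c≤1; c*n)
      c : ℚ
      c = 1ℚ - p
      bs : List (Matrix n → Bool)
      bs = map (λ σ M → escapes id σ M threshold) allQ
      each : ∀ qs → All (λ σ → Probability.sumOver (allMatrices n) (λ M →
          Probability.when (escapes id σ M threshold) (weight p M)) ≤ pow c threshold) qs
      each []       = []
      each (σ ∷ qs) = Probability.prob-query p p≥0 c≥0 c≤1 σ threshold ∷ each qs
      events : length bs ≡ 2 ℕ.+ 2 ℕ.^ n ℕ.* 2 ℕ.^ n
      events = trans (length-map _ allQ)
          (cong (2 ℕ.+_) (trans (length-concatMap (λ X → map (holeQ X) preds) (2 ℕ.^ n) preds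
                 (λ X → trans (length-map (holeQ X) preds) (length-bools n)))
                     (cong (ℕ._* 2 ℕ.^ n) (length-bools n))))
      small : times (length bs) (pow c threshold) ≤ ε
      small = ≤-trans (≤-reflexive (times≡ (length bs) (pow c threshold)))
        (small-total c threshold x r (length bs) E (2 ℕ.^ (4 ℕ.* n)) ε c*n E≥1 Eε
          (subst (λ L → E ℕ.* L ℕ.≤ 2 ℕ.^ (4 ℕ.* n)) (sym events) (few-events n E (ℕ.s≤s ℕ.z≤n) E≤n))
          (decay-j x Q threshold r x≥1 Q≥1 r+C (threshold-large n m T m≥2 n<T))
              (Probability.pow≥0 c≥0 c≤1 threshold))

  Claim : ℚ → Set
  Claim ε = Σ ℕ λ N → (n : ℕ) → n ≥ N → (D₀ : Adj n) → Loopless D₀ →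
    MinTotDegAtLeast D₀ ((ℕtoℚ 2 * α) * ℕtoℚ n) →
    ProbAtLeast n (edgeProb (ℕtoℚ C#) n) (λ G → ContainsAllCycles η (D₀ ∪ G)) (1ℚ - ε)

  threshold-exists : (ε : ℚ) → 0ℚ < ε → Claim ε
  threshold-exists ε ε>0 = from (archimedean ε ε>0)
    where
    from : (∃ λ E → 1 ℕ.≤ E × 1ℚ ≤ ℕtoℚ E * ε) → Claim ε
    from (E , E≥1 , Eε) = N ε E E≥1 Eε , typical ε E E≥1 Eε

theorem1p4 : (α η : ℚ) → 0ℚ < α → 0ℚ < η →
    Σ ℚ λ C → 0ℚ < C ×
    ((ε : ℚ) → 0ℚ < ε →
    Σ ℕ λ N → (n : ℕ) → n ≥ N →
    (D₀ : Adj n) → Loopless D₀ →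
    MinTotDegAtLeast D₀ ((ℕtoℚ 2 * α) * ℕtoℚ n) →
    ProbAtLeast n (edgeProb C n) (λ G → ContainsAllCycles η (D₀ ∪ G)) (1ℚ - ε))
theorem1p4 α η α>0 η>0 = from (archimedean α α>0) (archimedean η η>0)
  where
  from : (∃ λ a → 1 ℕ.≤ a × 1ℚ ≤ ℕtoℚ a * α) → (∃ λ e → 1 ℕ.≤ e × 1ℚ ≤ ℕtoℚ e * η) → _
  from (a , a≥1 , aα) (e , e≥1 , eη) = ℕtoℚ C# , C>0 , threshold-exists
    where open Threshold α η a a≥1 aα e e≥1 eη (params a e a≥1 e≥1)
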